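{- Let $\mathcal{K}$ be a FUR-class with monster model $\mathbb{M}$. Let $a\in\mathbb{M}$, $A\subset\mathbb{M}$, and let $\alpha=\mathrm{Cb}(a/A)$. Then $t(a/\alpha)$ is stationary.
   Context: SETTING. $(\mathcal{K},\preccurlyeq)$ is an abstract elementary class (AEC) with monster model $\mathbb{M}$: a $\delta$-model homogeneous and $\delta$-universal member of $\mathcal{K}$, $\delta$ a large cardinal. "Bounded" means of size $<\delta$. "Model" means $\mathcal{A}\in\mathcal{K}$, $\mathcal{A}\preccurlyeq\mathbb{M}$; models and parameter sets are bounded unless $\mathbb{M}$ itself is mentioned. $a\in X$ may be a finite tuple; juxtaposition denotes union or concatenation. TYPES. $\mathrm{Aut}(\mathbb{M}/A)$ is the group of automorphisms of $\mathbb{M}$ fixing $A$ pointwise. $a,b$ have the same Galois type over $A$, $t^g(a/A)=t^g(b/A)$, if $f(a)=b$ for some $f\in\mathrm{Aut}(\mathbb{M}/A)$; they have the same weak type, $t(a/A)=t(b/A)$, if $t^g(a/B)=t^g(b/B)$ for all finite $B\subseteq A$ (types of models are types of enumerations). For $A\subseteq B$ with $A$ finite, $t(a/B)$ splits over $A$ if there are $b,c\in B$ with $t(b/A)=t(c/A)$ but $t(ab/A)\ne t(ac/A)$. $a\downarrow^{ns}_B C$ means that $t(a/B\cup C)$ does not split over some finite $A\subseteq B$; $A\downarrow^{ns}_B C$ means $a\downarrow^{ns}_BC$ for each $a\in A$. FUR-CLASS. $\mathcal{K}$ is a FUR-class if it has AP and JEP, $LS(\mathcal{K})=\omega$, has arbitrarily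 large structures, contains no finite models, and satisfies: (AI) Every countable model $\mathcal{A}$ is s-saturated: for any $b\in\mathbb{M}$ and finite $A\subseteq\mathcal{A}$ there is $a\in\mathcal{A}$ with $t(a/A)=t(b/A)$. (AII) For all $a$ and countable $\mathcal{A}$ there is an s-primary model $\mathcal{B}=\mathcal{A}a\cup\bigcup_{i<\omega}a_i$ over $\mathcal{A}a$. [s-primary: the $a_i$ are singletons and for all $n<\omega$ there is a finite $A_n\subset\mathcal{A}$ such that for all $(a',a_0',\dots,a_n')$ with $t(a'/\mathcal{A})=t(a/\mathcal{A})$: $t(a',a_0',\dots,a_n'/A_n)=t(a,a_0,\dots,a_n/A_n)$ implies $t(a',a_0',\dots,a_n'/\mathcal{A})=t(a,a_0,\dots,a_n/\mathcal{A})$.] (AIII) Let $\mathcal{A},\mathcal{B},\mathcal{C}$ be models with $\mathcal{A}\downarrow^{ns}_{\mathcal{B}}\mathcal{C}$ and $\mathcal{B}=\mathcal{A}\cap\mathcal{C}$. Then there is a unique (not only up to isomorphism) s-prime model $\mathcal{D}$ over $\mathcal{A}\cup\mathcal{C}$; furthermore, if $\mathcal{C}\subseteq\mathcal{C}'$ and $\mathcal{A}\downarrow^{ns}_{\mathcal{B}}\mathcal{C}'$, then $\mathcal{D}\downarrow^{ns}_{\mathcal{C}}\mathcal{C}'$. [For models $\mathcal{A}_i$, $i<\alpha$, and $A=\bigcup_{i<\alpha}\mathcal{A}_i$, a map $f:A\to\mathbb{M}$ is weakly elementary w.r.t. $(\mathcal{A}_i)_{i<\alpha}$ if $t(a/\emptyset)=t(f(a)/\emptyset)$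 for all $a\in A$ and $f(\mathcal{A}_i)\preccurlyeq\mathbb{M}$ for all $i$. A model $\mathcal{D}$ is s-prime over $A$ if for every model $\mathcal{B}$ and every $f:A\to\mathcal{B}$ weakly elementary w.r.t. $(\mathcal{A}_i)_{i<\alpha}$ there is an elementary embedding $g:\mathcal{D}\to\mathcal{B}$ with $f\subseteq g$.] (AIV) For each $a\in\mathbb{M}$ there is $n<\omega$ such that for every countable model $\mathcal{A}$ and finite $A\subset\mathcal{A}$, player II has a winning strategy in $GI(a,A,\mathcal{A})$ in $n$ moves. [$GI(a,A,\mathcal{A})$: start with $a_0=a$, $A_0=A$. At move $n$, player I chooses $a_{n+1}\in\mathbb{M}$ and a finite $A_{n+1}'\subseteq\mathcal{A}$ with $t(a_{n+1}/A_n)=t(a_n/A_n)$, $A_n\subseteq A'_{n+1}$ and $t(a_{n+1}/A'_{n+1})\ne t(a_n/A'_{n+1})$; then player II chooses a finite $A_{n+1}\subseteq\mathcal{A}$ with $A'_{n+1}\subseteq A_{n+1}$. Player II wins if player I can no longer move.] (AV) If $\mathcal{A}\subseteq\mathcal{B}$ are countable models, $a\in\mathbb{M}$ and $\mathcal{B}\downarrow^{ns}_{\mathcal{A}}a$, then $a\downarrow^{ns}_{\mathcal{A}}\mathcal{B}$. (AVI) For all models $\mathcal{A},\mathcal{B},\mathcal{D}$ with $\mathcal{A}\subseteq\mathcal{B}\cap\mathcal{D}$ there is a model $\mathcal{C}$ with $t(\mathcal{C}/\mathcal{A})=t(\mathcal{B}/\mathcal{A})$ and $\mathcal{C}\downarrow^{ns}_{\mathcal{A}}\mathcal{D}$.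 INDEPENDENCE. For finite $A$, $E(A)$ is the set of $\mathrm{Aut}(\mathbb{M}/A)$-invariant equivalence relations on powers $\mathbb{M}^n$ with boundedly many classes; $Lt(a/B)=Lt(b/B)$ means $(a,b)\in E$ for all finite $A\subseteq B$ and $E\in E(A)$. For $A\subseteq B$, $A$ finite, $t(a/B)$ Lascar splits over $A$ if there are $b,c\in B$ with $Lt(b/A)=Lt(c/A)$ and $t(ab/A)\neq t(ac/A)$. $a\downarrow_B C$ means: there is a finite $A\subseteq B$ such that for all $D\supseteq B\cup C$ there is $b$ with $t(b/B\cup C)=t(a/B\cup C)$ and $t(b/D)$ not Lascar splitting over $A$. For $B\subset C$, $t(d'/C)$ is a free extension of $t(d/B)$ into $C$ if $t(d/B)=t(d'/B)$ and $d'\downarrow_B C$; a type is stationary if it has a unique free extension to any set. IMAGINARIES. $\mathcal{E}$ is a countable collection of $\emptyset$-invariant equivalence relations $E\subseteq\mathbb{M}^n\times\mathbb{M}^n$ (various $n$), containing equality, each given by a countable collection $G_E$ of Galois types via $(a,b)\in E$ iff $t^g(ab/\emptyset)\in G_E$. $\mathbb{M}^{eq}=\{a/E:a\in\mathbb{M},E\in\mathcal{E}\}$, with $a$ identified with $a/{=}$, the structure of $\mathbb{M}$ on $P_=$, and predicates $P_E$ for $\{a/E:a\in\mathbb{M}\}$ and functions $F_E(a)=a/E$. All notions above also apply in $\mathbb{M}^{eq}$, with models $\mathcal{A}^{eq}=\{a/E:a\in\mathcal{A},E\in\mathcal{E}\}$; stationarity of $t(a/\alpha)$ is understood in $\mathbb{M}^{eq}$.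 GLOBAL TYPES. The supermonster $\mathbb{M}'\in\mathcal{K}$ is a $|\mathbb{M}'|$-model homogeneous and universal structure with $\mathbb{M}\preccurlyeq\mathbb{M}'$ and $|\mathbb{M}'|>|\mathbb{M}|$. Types, Lascar types and independence for elements of $\mathbb{M}'$ are computed in $\mathbb{M}'$. A global type $p$ is a maximal collection $\{p_A:A\subset\mathbb{M}\text{ finite}\}$ such that $p_A$ is a Galois type over $A$, whenever $A\subseteq B$ and $b\in\mathbb{M}$ realizes $p_B$ then $b$ realizes $p_A$, and some single $b\in\mathbb{M}'$ realizes $p_A$ for every finite $A\subset\mathbb{M}$. For $f\in\mathrm{Aut}(\mathbb{M}^{eq})$, $f(p)=p$ means: for all finite $A,B\subset\mathbb{M}$ with $f(B)=A$ and all $b$ realizing $p_B$, $f(b)$ realizes $p_A$. $\alpha\in\mathbb{M}^{eq}$ is a canonical base for $p$ if for every $f\in\mathrm{Aut}(\mathbb{M}^{eq})$: $f(p)=p$ iff $f(\alpha)=\alpha$. For $a\in\mathbb{M}$ and $A\subset\mathbb{M}$, there is $b\in\mathbb{M}'$ with $Lt(b/A)=Lt(a/A)$ and $b\downarrow_A\mathbb{M}$; a canonical base for $a$ over $A$, written $\alpha=\mathrm{Cb}(a/A)$, is a canonical base of $t(b/\mathbb{M})$. STANDING CHOICE OF $\mathcal{E}$ (ensuring canonical bases exist in $\mathbb{M}^{eq}$). For a global type $p$ realized by $b\in\mathbb{M}'$ with $t(b/\mathbb{M})$ not splitting over a finite tuple $a\in\mathbb{M}$: for $c\in\mathbb{M}$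 let $q_c=t(bc/\emptyset)$ and let $q_i^c$, $i<\omega$, be types over $\emptyset$ such that for all $d\in\mathbb{M}$, $bd$ realizes $q_c$ iff $ad$ realizes some $q_i^c$. Let $(a_0,a_1)\in E$ iff for all $c,d\in\mathbb{M}$: $a_0d$ realizes some $q_i^c$ iff $a_1d$ realizes some $q_i^c$. These $E$ depend only on $t(ba/\emptyset)$; $\mathcal{E}$ contains all of them. -}

module Defs where

open import Data.Bool.Base using (Bool; true; false)
open import Data.Empty.Polymorphic using (⊥)
open import Data.Fin.Base using (Fin; zero; suc; toℕ)
open import Data.Nat.Base using (ℕ; zero; suc; _+_)
open import Data.Product.Base using (Σ; Σ-syntax; ∃; ∃-syntax; _×_; _,_; proj₁; proj₂)
open import Data.Sum.Base using (_⊎_; inj₁; inj₂)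
open import Data.Sum.Relation.Binary.Pointwise using (_⊎ₛ_)
open import Data.Vec.Functional using (Vector; []; _++_)
open import Data.Vec.Functional.Relation.Binary.Equality.Setoid using (_≋_)
open import Function.Base using (_∘_)
open import Function.Bundles using (Injection; _⇔_; mk⇔; Equivalence)
open import Function.Definitions using (Congruent; Injective; StrictlySurjective)
open import Induction.WellFounded using (WellFounded)
open import Level using (Level; _⊔_; Lift; lift) renaming (suc to lsuc)
open import Relation.Binary.Bundles using (Setoid)
open import Relation.Binary.Core using (Rel)
import Relation.Binary.Construct.On as On
open import Relation.Binary.Definitions using (_Respects_)
open import Relation.Binary.PropositionalEquality using (_≡_; setoid; _→-setoid_)
open import Relation.Binary.Structures using (IsEquivalence; IsStrictTotalOrder)
open import Relation.Nullary.Negation using (¬_)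
open import Relation.Unary using (Pred)

-- A set is a setoid: the quotient set 𝕄^eq has no other rendering here.
-- Cardinals are represented by setoids and compared by injections, and a
-- finite tuple of elements of X is a function Fin n → X.

module _ {ℓ : Level} where

  record Subset (S : Setoid ℓ ℓ) : Set (lsuc ℓ) where
    open Setoid S
    field
      member : Pred Carrier ℓ
      resp   : member Respects _≈_

  module _ {S : Setoid ℓ ℓ} where
    open Setoid S
    open Subset

    infix 4 _∈_ _⊆_ _≐_ _⊑_
    infixr 7 _∩_
    infixr 6 _∪_

    _∈_ : Carrier → Subset S → Set ℓ
    x ∈ X = member X x

    _⊆_ : Subset S → Subset S → Set ℓ
    X ⊆ Y = ∀ {x} → x ∈ X → x ∈ Y

    _≐_ : Subset S → Subset S → Set ℓ
    X ≐ Y = X ⊆ Y × Y ⊆ X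

    _⊑_ : ∀ {i} {I : Set i} → (I → Carrier) → Subset S → Set (i ⊔ ℓ)
    s ⊑ X = ∀ i → s i ∈ X

    _∩_ : Subset S → Subset S → Subset S
    X ∩ Y = record
      { member = λ x → x ∈ X × x ∈ Y
      ; resp   = λ x≈y (p , q) → resp X x≈y p , resp Y x≈y q }

    _∪_ : Subset S → Subset S → Subset S
    X ∪ Y = record
      { member = λ x → x ∈ X ⊎ x ∈ Y
      ; resp   = λ { x≈y (inj₁ p) → inj₁ (resp X x≈y p)
                   ; x≈y (inj₂ q) → inj₂ (resp Y x≈y q) } }

    ⋃ : {I : Set ℓ} → (I → Subset S) → Subset S
    ⋃ X = record
      { member = λ x → ∃[ i ] x ∈ X i
      ; resp   = λ x≈y (i , p) → i , resp (X i) x≈y p }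

    image : {I : Set ℓ} → (I → Carrier) → Subset S
    image s = record
      { member = λ x → ∃[ i ] s i ≈ x
      ; resp   = λ x≈y (i , p) → i , trans p x≈y }

    range : ∀ {n} → Vector Carrier n → Subset S
    range s = record
      { member = λ x → ∃[ i ] s i ≈ x
      ; resp   = λ x≈y (i , p) → i , trans p x≈y }

    -- Finite subsets are given throughout as ranges of finite tuples.
    ∅ : Subset S
    ∅ = range []

    ⟪_⟫ : Subset S → Setoid ℓ ℓ
    ⟪ X ⟫ = On.setoid S (proj₁ {B = member X})

infix 4 _≲_ _≺_

_≲_ : ∀ {a b c d} → Setoid a b → Setoid c d → Set (a ⊔ b ⊔ c ⊔ d)
S ≲ T = Injection S T

_≺_ : ∀ {a b c d} → Setoid a b → Setoid c d → Set (a ⊔ b ⊔ c ⊔ d)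
S ≺ T = S ≲ T × ¬ (T ≲ S)

Countable : ∀ {a b} → Setoid a b → Set (a ⊔ b)
Countable S = S ≲ setoid ℕ

-- Bool-valued functions are all subsets, by excluded middle.
record UncountableInaccessible {ℓ} (δ : Setoid ℓ ℓ) : Set (lsuc ℓ) where
  field
    uncountable  : setoid ℕ ≺ δ
    strong-limit : ∀ (X : Set ℓ) → setoid X ≺ δ → (X →-setoid Bool) ≺ δ
    regular      : ∀ (I : Set ℓ) (X : I → Subset δ) → setoid I ≺ δ →
                   (∀ i → ⟪ X i ⟫ ≺ δ) → ¬ (∀ y → y ∈ ⋃ X)

record Language (ℓ : Level) : Set (lsuc ℓ) where
  field
    RelSym : ℕ → Set ℓ
    FunSym : ℕ → Set ℓ

open Language

record Structure {ℓ} (L : Language ℓ) : Set (lsuc ℓ) where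
  field
    dom : Setoid ℓ ℓ
  open Setoid dom public
  field
    rel      : ∀ {n} → RelSym L n → Pred (Vector Carrier n) ℓ
    fun      : ∀ {n} → FunSym L n → Vector Carrier n → Carrier
    rel-resp : ∀ {n} (R : RelSym L n) → rel R Respects (_≋_ dom)
    fun-cong : ∀ {n} (f : FunSym L n) → Congruent (_≋_ dom) _≈_ (fun f)

open Structure using (dom)

∣_∣ : ∀ {ℓ} {L : Language ℓ} → Structure L → Set ℓ
∣ N ∣ = Setoid.Carrier (dom N)

module _ {ℓ} {L : Language ℓ} where

  record Embedding (A B : Structure L) : Set ℓ where
    private
      module A = Structure A
      module B = Structure B
    field
      to        : ∣ A ∣ → ∣ B ∣
      cong      : Congruent A._≈_ B._≈_ to
      injective : Injective A._≈_ B._≈_ to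
      rel-⇔     : ∀ {n} (R : RelSym L n) xs → A.rel R xs ⇔ B.rel R (to ∘ xs)
      fun-hom   : ∀ {n} (f : FunSym L n) xs → to (A.fun f xs) B.≈ B.fun f (to ∘ xs)

  open Embedding

  Onto : ∀ {A B} → Embedding A B → Set ℓ
  Onto {B = B} f = StrictlySurjective (Structure._≈_ B) (to f)

  infix 4 _≗_
  _≗_ : ∀ {A B} → Embedding A B → Embedding A B → Set ℓ
  _≗_ {B = B} f g = ∀ x → Structure._≈_ B (to f x) (to g x)

  infixr 9 _∘ₑ_
  _∘ₑ_ : ∀ {A B C} → Embedding B C → Embedding A B → Embedding A C
  _∘ₑ_ {C = C} g f = record
    { to        = to g ∘ to f
    ; cong      = cong g ∘ cong f
    ; injective = injective f ∘ injective g
    ; rel-⇔     = λ R xs → mk⇔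
        (Equivalence.to (rel-⇔ g R (to f ∘ xs)) ∘ Equivalence.to (rel-⇔ f R xs))
        (Equivalence.from (rel-⇔ f R xs) ∘ Equivalence.from (rel-⇔ g R (to f ∘ xs)))
    ; fun-hom   = λ h xs → Structure.trans C (cong g (fun-hom f h xs)) (fun-hom g h (to f ∘ xs))
    }

  record Automorphism (N : Structure L) : Set ℓ where
    field
      embedding : Embedding N N
      onto      : Onto embedding
    open Embedding embedding public

  Closed : (N : Structure L) → Subset (dom N) → Set ℓ
  Closed N X = ∀ {n} (f : FunSym L n) (xs : Vector ∣ N ∣ n) → xs ⊑ X → Structure.fun N f xs ∈ X

  substructure : (N : Structure L) (X : Subset (dom N)) → Closed N X → Structure L
  substructure N X closed = record
    { dom      = ⟪ X ⟫
    ; rel      = λ R xs → rel R (proj₁ ∘ xs)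
    ; fun      = λ f xs → fun f (proj₁ ∘ xs) , closed f (proj₁ ∘ xs) (proj₂ ∘ xs)
    ; rel-resp = λ R xs≋ys → rel-resp R xs≋ys
    ; fun-cong = λ f xs≋ys → fun-cong f xs≋ys
    }
    where open Structure N

  inclusion : (N : Structure L) (X : Subset (dom N)) (closed : Closed N X) →
              Embedding (substructure N X closed) N
  inclusion N X closed = record
    { to        = proj₁
    ; cong      = λ p → p
    ; injective = λ p → p
    ; rel-⇔     = λ R xs → mk⇔ (λ p → p) (λ p → p)
    ; fun-hom   = λ f xs → Structure.refl N
    }

-- "A ≼ B" is rendered up to isomorphism: Strong f says that f is an
-- isomorphism of A onto some A′ ≼ B.

record AEC {ℓ} (L : Language ℓ) : Set (lsuc ℓ) where
  field
    K      : Pred (Structure L) ℓ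
    Strong : ∀ {A B} → Pred (Embedding {L = L} A B) ℓ

  -- κ can serve as a Löwenheim–Skolem number
  LöwenheimSkolem : ∀ {a b} → Setoid a b → Set (a ⊔ b ⊔ lsuc ℓ)
  LöwenheimSkolem κ =
    ∀ {A} → K A → (X : Subset (dom A)) →
    Σ[ Y ∈ Subset (dom A) ] Σ[ closed ∈ Closed A Y ]
      X ⊆ Y × Strong (inclusion A Y closed) × ⟪ Y ⟫ ≲ (⟪ X ⟫ ⊎ₛ κ)

  field
    strong-resp : ∀ {A B} {f g : Embedding A B} → f ≗ g → Strong f → Strong g
    strong⇒K    : ∀ {A B} {f : Embedding A B} → Strong f → K A × K B
    iso-closed  : ∀ {A B} (f : Embedding A B) → Onto f → K A → K B × Strong f
    ∘-closed    : ∀ {A B C} {g : Embedding B C} {f : Embedding A B} →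
                  Strong g → Strong f → Strong (g ∘ₑ f)
    coherence   : ∀ {A B C} {g : Embedding B C} {f : Embedding A B} →
                  Strong g → Strong (g ∘ₑ f) → Strong f

    -- N is the union of the ≼-increasing chain (A i), indexed by a
    -- nonempty well-order, with inclusions e and u.
    union : ∀ {I : Set ℓ} {_<_ : Rel I ℓ} → IsStrictTotalOrder _≡_ _<_ → WellFounded _<_ → I →
            (A : I → Structure L)
            (e : ∀ {i j} → i < j → Embedding (A i) (A j)) → (∀ {i j} (p : i < j) → Strong (e p)) →
            (∀ i → K (A i)) →
            (N : Structure L) (u : ∀ i → Embedding (A i) N) →
            (∀ {i j} (p : i < j) → (u j ∘ₑ e p) ≗ u i) →
            (∀ y → ∃[ i ] ∃[ x ] Structure._≈_ N (Embedding.to (u i) x) y) →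
            K N × (∀ i → Strong (u i)) ×
            (∀ {B} (g : Embedding N B) → (∀ i → Strong (g ∘ₑ u i)) → Strong g)

    löwenheim-skolem : Σ[ κ ∈ Setoid ℓ ℓ ] setoid ℕ ≲ κ × LöwenheimSkolem κ

module _ {ℓ} {L : Language ℓ} (𝒦 : AEC L) where
  open AEC 𝒦

  AmalgamationProperty : Set (lsuc ℓ)
  AmalgamationProperty =
    ∀ {A B C} (f : Embedding A B) (g : Embedding A C) → Strong f → Strong g →
    Σ[ D ∈ Structure L ] Σ[ h ∈ Embedding B D ] Σ[ k ∈ Embedding C D ]
      Strong h × Strong k × (h ∘ₑ f) ≗ (k ∘ₑ g)

  JointEmbeddingProperty : Set (lsuc ℓ)
  JointEmbeddingProperty =
    ∀ {B C} → K B → K C →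
    Σ[ D ∈ Structure L ] Σ[ h ∈ Embedding B D ] Σ[ k ∈ Embedding C D ] Strong h × Strong k

  ArbitrarilyLarge : Set (lsuc ℓ)
  ArbitrarilyLarge = ∀ (X : Setoid ℓ ℓ) → Σ[ A ∈ Structure L ] K A × X ≲ dom A

  NoFiniteModels : Set (lsuc ℓ)
  NoFiniteModels = ∀ {A} → K A → ∀ n → ¬ (dom A ≲ setoid (Fin n))

  record IsModel (N : Structure L) (X : Subset (dom N)) : Set ℓ where
    field
      closed : Closed N X
      strong : Strong (inclusion N X closed)

  record Model (N : Structure L) (κ : Setoid ℓ ℓ) : Set (lsuc ℓ) where
    field
      set     : Subset (dom N)
      isModel : IsModel N set
      bounded : ⟪ set ⟫ ≺ κ
    open IsModel isModel public
    structure : Structure L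
    structure = substructure N set closed

  open Model

  ModelHomogeneous : Structure L → Setoid ℓ ℓ → Set (lsuc ℓ)
  ModelHomogeneous N κ =
    ∀ (𝒜 ℬ : Model N κ) (f : Embedding (structure 𝒜) (structure ℬ)) → Onto f →
    Σ[ g ∈ Automorphism N ] ∀ x →
      Structure._≈_ N (Automorphism.to g (proj₁ x)) (proj₁ (Embedding.to f x))

  Universal : Structure L → Setoid ℓ ℓ → Set (lsuc ℓ)
  Universal N κ = ∀ {A} → K A → dom A ≺ κ → Σ[ f ∈ Embedding A N ] Strong f

  record Monster : Set (lsuc ℓ) where
    field
      M           : Structure L
      M∈K         : K M
      δ           : Setoid ℓ ℓ
      δ-large     : UncountableInaccessible δ
      homogeneous : ModelHomogeneous M δ
      universal   : Universal M δ

-- N is 𝕄, 𝕄^eq or the supermonster; "bounded" means of size < κ.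

module Types {ℓ} {L : Language ℓ} (N : Structure L) (κ : Setoid ℓ ℓ) where
  open Structure N using (_≈_)

  Set⊂ : Set (lsuc ℓ)
  Set⊂ = Subset (dom N)

  Bounded : Set⊂ → Set ℓ
  Bounded X = ⟪ X ⟫ ≺ κ

  record AutomorphismOver (A : Set⊂) : Set ℓ where
    field
      auto  : Automorphism N
      fixes : ∀ {x} → x ∈ A → Automorphism.to auto x ≈ x
    open Automorphism auto public

  -- Infinite index sets are needed for types of enumerations of models.

  SameGaloisType : ∀ {i} {I : Set i} (a b : I → ∣ N ∣) → Set⊂ → Set (i ⊔ ℓ)
  SameGaloisType a b A =
    Σ[ f ∈ AutomorphismOver A ] ∀ i → AutomorphismOver.to f (a i) ≈ b i

  SameType : ∀ {i} {I : Set i} (a b : I → ∣ N ∣) → Set⊂ → Set (i ⊔ ℓ)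
  SameType a b A = ∀ {k} (s : Vector ∣ N ∣ k) → s ⊑ A → SameGaloisType a b (range s)

  Splits : ∀ {n} → Vector ∣ N ∣ n → Set⊂ → Set⊂ → Set ℓ
  Splits a B A =
    ∃[ m ] Σ[ b ∈ Vector ∣ N ∣ m ] Σ[ c ∈ Vector ∣ N ∣ m ]
      b ⊑ B × c ⊑ B × SameType b c A × ¬ SameType (a ++ b) (a ++ c) A

  infix 4 _↓ns[_]_ _⇓ns[_]_ _↓[_]_

  _↓ns[_]_ : ∀ {n} → Vector ∣ N ∣ n → Set⊂ → Set⊂ → Set ℓ
  a ↓ns[ B ] C =
    ∃[ k ] Σ[ s ∈ Vector ∣ N ∣ k ] s ⊑ B × ¬ Splits a (B ∪ C) (range s)

  _⇓ns[_]_ : Set⊂ → Set⊂ → Set⊂ → Set ℓ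
  A ⇓ns[ B ] C = ∀ {n} (a : Vector ∣ N ∣ n) → a ⊑ A → a ↓ns[ B ] C

  record InvariantBoundedEquivalence (A : Set⊂) (n : ℕ) : Set (lsuc ℓ) where
    field
      E             : Rel (Vector ∣ N ∣ n) ℓ
      isEquivalence : IsEquivalence E
      ≋⇒E           : ∀ {x y} → _≋_ (dom N) x y → E x y
      invariant     : ∀ (f : AutomorphismOver A) {x y} → E x y →
                      E (AutomorphismOver.to f ∘ x) (AutomorphismOver.to f ∘ y)
      few-classes   : record { isEquivalence = isEquivalence } ≺ κ

  SameLascarType : ∀ {n} (a b : Vector ∣ N ∣ n) → Set⊂ → Set (lsuc ℓ)
  SameLascarType {n} a b B =
    ∀ {k} (s : Vector ∣ N ∣ k) → s ⊑ B →
    (E : InvariantBoundedEquivalence (range s) n) → InvariantBoundedEquivalence.E E a b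

  LascarSplits : ∀ {n} → Vector ∣ N ∣ n → Set⊂ → Set⊂ → Set (lsuc ℓ)
  LascarSplits a B A =
    ∃[ m ] Σ[ b ∈ Vector ∣ N ∣ m ] Σ[ c ∈ Vector ∣ N ∣ m ]
      b ⊑ B × c ⊑ B × SameLascarType b c A × ¬ SameType (a ++ b) (a ++ c) A

  _↓[_]_ : ∀ {n} → Vector ∣ N ∣ n → Set⊂ → Set⊂ → Set (lsuc ℓ)
  _↓[_]_ {n} a B C =
    ∃[ k ] Σ[ s ∈ Vector ∣ N ∣ k ] s ⊑ B ×
      (∀ (D : Set⊂) → Bounded D → (B ∪ C) ⊆ D →
       Σ[ b ∈ Vector ∣ N ∣ n ] SameType b a (B ∪ C) × ¬ LascarSplits b D (range s))

  FreeExtension : ∀ {n} (d′ : Vector ∣ N ∣ n) (C : Set⊂) (d : Vector ∣ N ∣ n) (B : Set⊂) → Set (lsuc ℓ)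
  FreeExtension d′ C d B = SameType d d′ B × d′ ↓[ B ] C

  Stationary : ∀ {n} → Vector ∣ N ∣ n → Set⊂ → Set (lsuc ℓ)
  Stationary {n} d B =
    ∀ (C : Set⊂) → Bounded C → B ⊆ C →
    (Σ[ d′ ∈ Vector ∣ N ∣ n ] FreeExtension d′ C d B) ×
    (∀ (d₁ d₂ : Vector ∣ N ∣ n) → FreeExtension d₁ C d B → FreeExtension d₂ C d B → SameType d₁ d₂ C)

module FURNotions {ℓ} {L : Language ℓ} (𝒦 : AEC L) (𝕄 : Monster 𝒦) where
  open AEC 𝒦
  open Monster 𝕄
  open Types M δ
  open Structure M using (_≈_)

  𝕄odel : Set (lsuc ℓ)
  𝕄odel = Model 𝒦 M δ

  open Model

  IsCountable : 𝕄odel → Set ℓ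
  IsCountable 𝒜 = Countable ⟪ set 𝒜 ⟫

  SSaturated : 𝕄odel → Set ℓ
  SSaturated 𝒜 =
    ∀ {n k} (b : Vector ∣ M ∣ n) (s : Vector ∣ M ∣ k) → s ⊑ set 𝒜 →
    Σ[ a ∈ Vector ∣ M ∣ n ] a ⊑ set 𝒜 × SameType a b (range s)

  -- ℬ = 𝒜 ∪ a ∪ {a₀, a₁, …} is s-primary over 𝒜 ∪ a
  record SPrimary (𝒜 : 𝕄odel) {m} (a : Vector ∣ M ∣ m) (ℬ : 𝕄odel) : Set ℓ where
    field
      a[_]      : ℕ → ∣ M ∣
      ℬ≐        : ∀ x → x ∈ set ℬ ⇔ (x ∈ set 𝒜 ⊎ x ∈ range {S = dom M} a ⊎ ∃[ i ] a[ i ] ≈ x)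
      determine : ∀ n → ∃[ k ] Σ[ s ∈ Vector ∣ M ∣ k ] s ⊑ set 𝒜 ×
                  (∀ (a′ : Vector ∣ M ∣ m) (as′ : Vector ∣ M ∣ (suc n)) →
                   SameType a′ a (set 𝒜) →
                   SameType (a′ ++ as′) (a ++ (λ (i : Fin (suc n)) → a[ toℕ i ])) (range s) →
                   SameType (a′ ++ as′) (a ++ (λ (i : Fin (suc n)) → a[ toℕ i ])) (set 𝒜))

  module _ {I : Set ℓ} (𝒜 : I → 𝕄odel) where
    private
      A : Subset (dom M)
      A = ⋃ (set ∘ 𝒜)

    record WeaklyElementary (f : Setoid.Carrier ⟪ A ⟫ → ∣ M ∣) : Set ℓ where
      field
        preserves : ∀ {n} (a : Vector (Setoid.Carrier ⟪ A ⟫) n) →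
                    SameType (proj₁ ∘ a) (f ∘ a) ∅
        models    : ∀ i → IsModel 𝒦 M
                    (image {I = ∃ (_∈ set (𝒜 i))} (λ (x , x∈) → f (x , (i , x∈))))

    record SPrime (𝒟 : 𝕄odel) : Set (lsuc ℓ) where
      field
        over   : A ⊆ set 𝒟
        extend : ∀ (ℬ : 𝕄odel) (f : Setoid.Carrier ⟪ A ⟫ → ∣ M ∣) → f ⊑ set ℬ → WeaklyElementary f →
                 Σ[ g ∈ Embedding (structure 𝒟) (structure ℬ) ] Strong g ×
                 (∀ x → proj₁ (Embedding.to g (proj₁ x , over (proj₂ x))) ≈ f x)

  pair : 𝕄odel → 𝕄odel → Lift ℓ Bool → 𝕄odel
  pair 𝒜 𝒞 (lift true)  = 𝒜
  pair 𝒜 𝒞 (lift false) = 𝒞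

  record Move (𝒜 : 𝕄odel) {m} (a : Vector ∣ M ∣ m) {k} (s : Vector ∣ M ∣ k) : Set ℓ where
    field
      a⁺        : Vector ∣ M ∣ m
      {k⁺}      : ℕ
      s⁺        : Vector ∣ M ∣ k⁺
      s⁺⊑𝒜      : s⁺ ⊑ set 𝒜
      same      : SameType a⁺ a (range s)
      extends   : s ⊑ range {S = dom M} s⁺
      different : ¬ SameType a⁺ a (range s⁺)

  -- Player II, from the position (a, range s), can force player I to be
  -- unable to move after at most n moves.
  IIWinsIn : ℕ → (𝒜 : 𝕄odel) {m : ℕ} (a : Vector ∣ M ∣ m) {k : ℕ} (s : Vector ∣ M ∣ k) → Set ℓ
  IIWinsIn zero    𝒜 a s = ¬ Move 𝒜 a s
  IIWinsIn (suc n) 𝒜 a s =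
    ∀ (μ : Move 𝒜 a s) → let open Move μ in
    ∃[ k ] Σ[ t ∈ Vector ∣ M ∣ k ] t ⊑ set 𝒜 × s⁺ ⊑ range {S = dom M} t × IIWinsIn n 𝒜 a⁺ t

  Enumerates : {I : Set ℓ} → (I → ∣ M ∣) → 𝕄odel → Set ℓ
  Enumerates e 𝒜 = image e ≐ set 𝒜

  -- t(ℬ/A) = t(𝒞/A) for models, with respect to some enumerations
  SameModelType : 𝕄odel → 𝕄odel → Subset (dom M) → Set (lsuc ℓ)
  SameModelType ℬ 𝒞 A =
    Σ[ I ∈ Set ℓ ] Σ[ b ∈ (I → ∣ M ∣) ] Σ[ c ∈ (I → ∣ M ∣) ]
      Enumerates b ℬ × Enumerates c 𝒞 × SameType b c A

  record FUR : Set (lsuc ℓ) where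
    field
      ap    : AmalgamationProperty 𝒦
      jep   : JointEmbeddingProperty 𝒦
      -- ω is the least possible Löwenheim–Skolem number
      ls=ω  : LöwenheimSkolem (setoid ℕ)
      large : ArbitrarilyLarge 𝒦
      noFin : NoFiniteModels 𝒦

      AI    : ∀ (𝒜 : 𝕄odel) → IsCountable 𝒜 → SSaturated 𝒜

      AII   : ∀ {m} (a : Vector ∣ M ∣ m) (𝒜 : 𝕄odel) → IsCountable 𝒜 →
              Σ[ ℬ ∈ 𝕄odel ] SPrimary 𝒜 a ℬ

      AIII  : ∀ (𝒜 ℬ 𝒞 : 𝕄odel) → set 𝒜 ⇓ns[ set ℬ ] set 𝒞 → set ℬ ≐ set 𝒜 ∩ set 𝒞 →
              Σ[ 𝒟 ∈ 𝕄odel ] SPrime (pair 𝒜 𝒞) 𝒟 ×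
                (∀ 𝒟′ → SPrime (pair 𝒜 𝒞) 𝒟′ → set 𝒟′ ≐ set 𝒟) ×
                (∀ (𝒞′ : 𝕄odel) → set 𝒞 ⊆ set 𝒞′ → set 𝒜 ⇓ns[ set ℬ ] set 𝒞′ →
                 set 𝒟 ⇓ns[ set 𝒞 ] set 𝒞′)

      AIV   : ∀ {m} (a : Vector ∣ M ∣ m) →
              ∃[ n ] (∀ (𝒜 : 𝕄odel) → IsCountable 𝒜 →
                      ∀ {k} (s : Vector ∣ M ∣ k) → s ⊑ set 𝒜 → IIWinsIn n 𝒜 a s)

      AV    : ∀ (𝒜 ℬ : 𝕄odel) → IsCountable 𝒜 → IsCountable ℬ → set 𝒜 ⊆ set ℬ →
              ∀ {m} (a : Vector ∣ M ∣ m) →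
              set ℬ ⇓ns[ set 𝒜 ] range a → a ↓ns[ set 𝒜 ] set ℬ

      AVI   : ∀ (𝒜 ℬ 𝒟 : 𝕄odel) → set 𝒜 ⊆ set ℬ ∩ set 𝒟 →
              Σ[ 𝒞 ∈ 𝕄odel ] SameModelType 𝒞 ℬ (set 𝒜) × set 𝒞 ⇓ns[ set 𝒜 ] set 𝒟

open FURNotions public using (FUR)

-- Sort n indexes the equivalence relations on 𝕄ⁿ belonging to ℰ.

record Imaginaries {ℓ} {L : Language ℓ} {𝒦 : AEC L} (𝕄 : Monster 𝒦) : Set (lsuc ℓ) where
  open Monster 𝕄
  open Types M δ
  field
    Sort          : ℕ → Set
    countable     : Countable (setoid (∃ Sort))
    _[_~_]        : ∀ {n} → Sort n → Rel (Vector ∣ M ∣ n) ℓ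
    isEquivalence : ∀ {n} (E : Sort n) → IsEquivalence (E [_~_])
    invariant     : ∀ {n} (E : Sort n) (f : Automorphism M) {x y} → E [ x ~ y ] →
                    E [ Automorphism.to f ∘ x ~ Automorphism.to f ∘ y ]
    -- G E i is a realization of the i-th Galois type of the collection G_E
    G             : ∀ {n} → Sort n → ℕ → Vector ∣ M ∣ (n + n)
    G-defines     : ∀ {n} (E : Sort n) x y →
                    E [ x ~ y ] ⇔ (∃[ i ] SameGaloisType (x ++ y) (G E i) ∅)
    eq            : Sort 1
    eq-equality   : ∀ x y → eq [ x ~ y ] ⇔ _≋_ (dom M) x y

module Meq {ℓ} {L : Language ℓ} {𝒦 : AEC L} {𝕄 : Monster 𝒦} (ℰ : Imaginaries 𝕄) where
  open Monster 𝕄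
  open Imaginaries ℰ

  data Element : Set ℓ where
    _/_ : ∀ {n} → Vector ∣ M ∣ n → Sort n → Element

  infix 4 _≈ᵉ_

  data _≈ᵉ_ : Rel Element ℓ where
    class : ∀ {n} {E : Sort n} {x y} → E [ x ~ y ] → x / E ≈ᵉ y / E

  ≈ᵉ-setoid : Setoid ℓ ℓ
  ≈ᵉ-setoid = record
    { Carrier       = Element
    ; _≈_           = _≈ᵉ_
    ; isEquivalence = record
        { refl  = λ { {x / E} → class (IsEquivalence.refl (isEquivalence E)) }
        ; sym   = λ { (class {E = E} p) → class (IsEquivalence.sym (isEquivalence E) p) }
        ; trans = λ { (class {E = E} p) (class q) → class (IsEquivalence.trans (isEquivalence E) p q) }
        }
    }

  -- the identification of a with a/=
  real : ∣ M ∣ → Element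
  real a = (λ _ → a) / eq

  -- The function symbols of L and the F_E are partial functions on
  -- 𝕄^eq, so they enter its language through their graphs.
  data RelSymᵉ : ℕ → Set ℓ where
    R[_] : ∀ {n} → RelSym L n → RelSymᵉ n
    f[_] : ∀ {n} → FunSym L n → RelSymᵉ (suc n)
    P[_] : ∀ {n} → Sort n → RelSymᵉ 1
    F[_] : ∀ {n} → Sort n → RelSymᵉ (suc n)

  Lᵉ : Language ℓ
  Lᵉ = record { RelSym = RelSymᵉ ; FunSym = λ _ → ⊥ }

  relᵉ : ∀ {n} → RelSymᵉ n → Pred (Vector Element n) ℓ
  relᵉ R[ R ] z = ∃[ x ] (∀ i → z i ≈ᵉ real (x i)) × Structure.rel M R x
  relᵉ f[ f ] z = ∃[ x ] (∀ i → z (suc i) ≈ᵉ real (x i)) × z zero ≈ᵉ real (Structure.fun M f x)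
  relᵉ P[ E ] z = ∃[ x ] z zero ≈ᵉ x / E
  relᵉ F[ E ] z = ∃[ x ] (∀ i → z (suc i) ≈ᵉ real (x i)) × z zero ≈ᵉ x / E

  private
    move : ∀ {x y z} → x ≈ᵉ y → x ≈ᵉ z → y ≈ᵉ z
    move p q = Setoid.trans ≈ᵉ-setoid (Setoid.sym ≈ᵉ-setoid p) q

  relᵉ-resp : ∀ {n} (R : RelSymᵉ n) → relᵉ R Respects (_≋_ ≈ᵉ-setoid)
  relᵉ-resp R[ R ] e (x , p , q) = x , (λ i → move (e i) (p i)) , q
  relᵉ-resp f[ f ] e (x , p , q) = x , (λ i → move (e (suc i)) (p i)) , move (e zero) q
  relᵉ-resp P[ E ] e (x , p)     = x , move (e zero) p
  relᵉ-resp F[ E ] e (x , p , q) = x , (λ i → move (e (suc i)) (p i)) , move (e zero) q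

  M^eq : Structure Lᵉ
  M^eq = record
    { dom      = ≈ᵉ-setoid
    ; rel      = relᵉ
    ; fun      = λ ()
    ; rel-resp = relᵉ-resp
    ; fun-cong = λ ()
    }

record SuperMonster {ℓ} {L : Language ℓ} {𝒦 : AEC L} (𝕄 : Monster 𝒦) : Set (lsuc ℓ) where
  open Monster 𝕄 using (M)
  field
    M′          : Structure L
    ι           : Embedding M M′
    ι-strong    : AEC.Strong 𝒦 ι
    larger      : dom M ≺ dom M′
    homogeneous : ModelHomogeneous 𝒦 M′ (dom M′)
    universal   : Universal 𝒦 M′ (dom M′)

module Global {ℓ} {L : Language ℓ} {𝒦 : AEC L} {𝕄 : Monster 𝒦}
              (𝕄′ : SuperMonster 𝕄) (ℰ : Imaginaries 𝕄) where
  open Monster 𝕄 using (M; δ)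
  open SuperMonster 𝕄′ using (M′; ι)
  open Imaginaries ℰ
  open Meq ℰ using (M^eq; real; ≈ᵉ-setoid)
  module T  = Types M δ
  module T′ = Types M′ (dom M′)
  module Tᵉ = Types M^eq δ
  open Setoid ≈ᵉ-setoid using (_≈_)

  j : ∣ M ∣ → ∣ M′ ∣
  j = Embedding.to ι

  j⟨_⟩ : Subset (dom M) → Subset (dom M′)
  j⟨ A ⟩ = image {I = ∃ (_∈ A)} (j ∘ proj₁)

  𝕄-in-𝕄′ : Subset (dom M′)
  𝕄-in-𝕄′ = image j

  -- The p_A, A = range s, are orbits of Aut(𝕄/A).  Galois types being
  -- complete, maximality of the collection means that p_A is present
  -- for every finite A.
  record GlobalType (n : ℕ) : Set (lsuc ℓ) where
    field
      p        : ∀ {k} → Vector ∣ M ∣ k → Pred (Vector ∣ M ∣ n) ℓ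
      galois   : ∀ {k} (s : Vector ∣ M ∣ k) →
                 ∃[ a ] (∀ x → p s x ⇔ T.SameGaloisType x a (range s))
      coherent : ∀ {k l} (s : Vector ∣ M ∣ k) (t : Vector ∣ M ∣ l) →
                 range {S = dom M} s ⊆ range t → ∀ {b} → p t b → p s b

    RealizedBy : Vector ∣ M′ ∣ n → Set ℓ
    RealizedBy b = ∀ {k} (s : Vector ∣ M ∣ k) →
                   ∃[ a ] p s a × T′.SameGaloisType b (j ∘ a) (range (j ∘ s))

    field
      realized : ∃ RealizedBy

  open GlobalType

  FixedBy : ∀ {n} → GlobalType n → Automorphism M^eq → Set ℓ
  FixedBy {n} p f =
    ∀ {k} (s t : Vector ∣ M ∣ k) → (∀ i → to (real (s i)) ≈ real (t i)) →
    ∀ (b c : Vector ∣ M ∣ n) → (∀ i → to (real (b i)) ≈ real (c i)) →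
    GlobalType.p p s b → GlobalType.p p t c
    where open Automorphism f using (to)

  IsCanonicalBase : ∀ {n k} → Vector ∣ M^eq ∣ k → GlobalType n → Set ℓ
  IsCanonicalBase α p =
    ∀ (f : Automorphism M^eq) → FixedBy p f ⇔ (∀ i → Automorphism.to f (α i) ≈ α i)

  -- α = Cb(a/A)
  IsCb : ∀ {n k} → Vector ∣ M^eq ∣ k → Vector ∣ M ∣ n → Subset (dom M) → Set (lsuc ℓ)
  IsCb {n} α a A =
    Σ[ b ∈ Vector ∣ M′ ∣ n ]
      T′.SameLascarType b (j ∘ a) j⟨ A ⟩ ×
      b T′.↓[ j⟨ A ⟩ ] 𝕄-in-𝕄′ ×
      (Σ[ p ∈ GlobalType n ] RealizedBy p b × IsCanonicalBase α p)

  -- q c i is a realization of the type q_i^c.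
  Standing : Set (lsuc ℓ)
  Standing =
    ∀ {n m} (p : GlobalType n) (b : Vector ∣ M′ ∣ n) (a : Vector ∣ M ∣ m) →
    RealizedBy p b → ¬ T′.Splits b 𝕄-in-𝕄′ (range (j ∘ a)) →
    Σ[ q ∈ (∀ {k} → Vector ∣ M ∣ k → ℕ → Vector ∣ M ∣ (m + k)) ]
      (∀ {k} (c d : Vector ∣ M ∣ k) →
         T′.SameType (b ++ (j ∘ d)) (b ++ (j ∘ c)) ∅ ⇔ (∃[ i ] T.SameType (a ++ d) (q c i) ∅)) ×
      Σ[ E ∈ Sort m ] (∀ a₀ a₁ →
         E [ a₀ ~ a₁ ] ⇔
         (∀ {k} (c d : Vector ∣ M ∣ k) →
            (∃[ i ] T.SameType (a₀ ++ d) (q c i) ∅) ⇔ (∃[ i ] T.SameType (a₁ ++ d) (q c i) ∅)))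

-- The global type p of b over 𝕄 does not split over some finite tuple w, so it is defined by a
-- scheme assigning a type to each conjugate of w, and α is fixed exactly by the group H of the
-- automorphisms g of 𝕄 for which g w defines the same type as w.
--
-- The number of moves in the game of (AIV) is a rank.  It increases along limits of Morley
-- sequences, so that tuples of maximal rank have types with few conjugates.  As there are few
-- types over a bounded model, this gives the lifting property of Lascar types in the supermonster:
-- if Lt(x) = Lt(y), then for each z there is z′ with Lt(xz) = Lt(yz′).  Hence Lt(b/A) = Lt(a/A)
-- yields f ∈ H such that f(a) realizes p over any given countable model.
--
-- Realizations of p over C are therefore free extensions of t(a/α).  Conversely, let d be a free
-- extension, and let c ∈ C.  A conjugate under H of the type of cw over a suitable model has a
-- scheme that H does not move, and symmetry of independence (AV) makes a late element c′ of its
-- Morley sequence related to d as it is to a realization of p.  Since c and c′ have the same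
-- Lascar type over α, the type of d over c is that of a realization of p.
module Submission where

open import Axiom.ExcludedMiddle using (ExcludedMiddle)
open import Axiom.Extensionality.Propositional using (Extensionality)
open import Data.Bool.Base using (Bool; true; false)
open import Data.Empty using (⊥; ⊥-elim)
open import Data.Fin.Base using (Fin; zero; suc; toℕ; splitAt; _↑ˡ_; _↑ʳ_)
open import Data.Fin.Properties using (toℕ-injective)
open import Data.List.Base using (List; length; tabulate)
open import Data.List.Properties using (∷-injectiveˡ; ∷-injectiveʳ; length-tabulate)
open import Data.Nat.Base using (ℕ; zero; suc; _+_)
import Data.Nat.Base as ℕ
open import Data.Nat.Induction using (<-wellFounded)
import Data.Nat.Properties as ℕ
open import Data.Product.Base using (Σ; Σ-syntax; ∃; ∃-syntax; _×_; _,_; proj₁; proj₂)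
open import Data.Sum.Base using (_⊎_; inj₁; inj₂; [_,_])
open import Data.Sum.Properties using (inj₁-injective; inj₂-injective)
open import Data.Sum.Relation.Binary.Pointwise using (_⊎ₛ_)
open import Data.Vec.Functional using (Vector; _++_)
open import Data.Vec.Functional.Properties using (lookup-++ˡ; lookup-++ʳ)
open import Data.Vec.Functional.Relation.Binary.Equality.Setoid using (_≋_)
open import Function.Base using (_∘_; id; case_of_)
open import Function.Bundles using (Injection; mk⇔; Equivalence)
open import Induction.WellFounded using (WellFounded; Acc; acc)
open import Level using (Level; _⊔_; Lift; lift; lower) renaming (suc to lsuc)
open import Relation.Binary.Bundles using (Setoid)
open import Relation.Binary.Core using (Rel)
open import Relation.Binary.Definitions using (Tri; tri<; tri≈; tri>)
open import Relation.Binary.PropositionalEquality as ≡ using (_≡_; setoid; _→-setoid_)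
open import Relation.Binary.Structures using (IsEquivalence; IsStrictTotalOrder)
open import Relation.Nullary using (¬_; Dec; yes; no)
open import Defs

-- Elements of `H` may move the tuple `w`; they preserve only the type that it defines.
--
-- The rank grows for this reason: the limit tuple of a Morley sequence agrees with a late
-- approximating tuple on any given finite set, but not on the whole model, so player I can spend a
-- move on passing from the limit to that tuple. Since (AIV) bounds the game uniformly, a choice of
-- extremal rank excludes this, and then all conjugates define one type. The argument occurs twice,
-- for tuples conjugate under `H` and for tuples equivalent to a tuple of the model.
--
-- The axioms of a FUR-class concern `M`, whereas the Lascar types of the hypothesis are those of
-- `M′`. Finite and countable configurations of `M′` are moved into `M` by homogeneity; local
-- character over larger models, such as `M` itself, is reduced to countable ones.

module Tuples {ℓ : Level} {L : Language ℓ} (N : Structure L) where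
  open import Data.Vec.Functional using ([])
  open Structure N
  open Equivalence using (to; from)

  Aut : Set ℓ
  Aut = Automorphism N

  infixr 10 _·_
  _·_ : Aut → Carrier → Carrier
  g · x = Automorphism.to g x

  ·-cong : ∀ (g : Aut) {x y} → x ≈ y → g · x ≈ g · y
  ·-cong g = Automorphism.cong g

  idₐ : Aut
  idₐ = record
    { embedding = record
      { to = id ; cong = id ; injective = id ; rel-⇔ = λ R xs → mk⇔ id id ; fun-hom = λ f xs → refl }
    ; onto = λ y → y , refl
    }

  infixr 9 _∘ₐ_
  _∘ₐ_ : Aut → Aut → Aut
  g ∘ₐ f = record
    { embedding = Automorphism.embedding g ∘ₑ Automorphism.embedding f
    ; onto      = λ y → let (x , p) = Automorphism.onto g y
                            (w , q) = Automorphism.onto f x in w , trans (·-cong g q) p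
    }

  inv : Aut → Aut
  inv g = record
    { embedding = record
      { to        = g⁻¹
      ; cong      = λ p → Automorphism.injective g (trans (g-g⁻¹ _) (trans p (sym (g-g⁻¹ _))))
      ; injective = λ {x} {y} p → trans (sym (g-g⁻¹ x)) (trans (·-cong g p) (g-g⁻¹ y))
      ; rel-⇔     = λ R xs → mk⇔
          (λ r → from (Automorphism.rel-⇔ g R (g⁻¹ ∘ xs)) (rel-resp R (λ i → sym (g-g⁻¹ (xs i))) r))
          (λ r → rel-resp R (λ i → g-g⁻¹ (xs i)) (to (Automorphism.rel-⇔ g R (g⁻¹ ∘ xs)) r))
      ; fun-hom   = λ f xs → Automorphism.injective g
          (trans (g-g⁻¹ _) (trans (fun-cong f (λ i → sym (g-g⁻¹ (xs i)))) (sym (Automorphism.fun-hom g f (g⁻¹ ∘ xs)))))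
      }
    ; onto = λ y → g · y , Automorphism.injective g (g-g⁻¹ _)
    }
    where
    g⁻¹ : Carrier → Carrier
    g⁻¹ y = proj₁ (Automorphism.onto g y)
    g-g⁻¹ : ∀ y → g · g⁻¹ y ≈ y
    g-g⁻¹ y = proj₂ (Automorphism.onto g y)

  inv-· : ∀ g {x y} → g · x ≈ y → inv g · y ≈ x
  inv-· g p = Automorphism.injective g (trans (proj₂ (Automorphism.onto g _)) (sym p))

  ·-inv : ∀ g x → g · inv g · x ≈ x
  ·-inv g x = proj₂ (Automorphism.onto g x)

  Tup : ℕ → Set ℓ
  Tup = Vector Carrier

  Maps : ∀ {i} {I : Set i} → Aut → (I → Carrier) → (I → Carrier) → Set (i ⊔ ℓ)
  Maps g x y = ∀ i → g · x i ≈ y i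

  Fixes : ∀ {i} {I : Set i} → Aut → (I → Carrier) → Set (i ⊔ ℓ)
  Fixes g x = Maps g x x

  module _ {i} {I : Set i} where

    maps-id : ∀ {x : I → Carrier} → Fixes idₐ x
    maps-id _ = refl

    maps-∘ : ∀ {x y z : I → Carrier} g f → Maps g y z → Maps f x y → Maps (g ∘ₐ f) x z
    maps-∘ g f p q i = trans (·-cong g (q i)) (p i)

    maps-inv : ∀ {x y : I → Carrier} g → Maps g x y → Maps (inv g) y x
    maps-inv g p i = inv-· g (p i)

    maps-img : ∀ g {x : I → Carrier} → Maps g x (λ i → g · x i)
    maps-img g i = refl

    maps-≈ˡ : ∀ g {x x′ y : I → Carrier} → (∀ i → x i ≈ x′ i) → Maps g x′ y → Maps g x y
    maps-≈ˡ g e p i = trans (·-cong g (e i)) (p i)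

    maps-≈ʳ : ∀ g {x y y′ : I → Carrier} → (∀ i → y i ≈ y′ i) → Maps g x y → Maps g x y′
    maps-≈ʳ g e p i = trans (p i) (e i)

  along : Aut → Aut → Aut → Aut
  along g k g′ = g′ ∘ₐ k ∘ₐ inv g

  conj : Aut → Aut → Aut
  conj g k = inv g ∘ₐ k ∘ₐ g

  module _ {i} {I : Set i} where

    maps-along : ∀ {x x′ y y′ : I → Carrier} g k g′ → Maps g x y → Maps k x x′ → Maps g′ x′ y′ → Maps (along g k g′) y y′
    maps-along g k g′ p q r = maps-∘ g′ (k ∘ₐ inv g) r (maps-∘ k (inv g) q (maps-inv g p))

    maps-conj : ∀ {x x′ y y′ : I → Carrier} g k → Maps g x x′ → Maps g y y′ → Maps k x′ y′ → Maps (conj g k) x y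
    maps-conj g k p q r = maps-∘ (inv g) (k ∘ₐ g) (maps-inv g q) (maps-∘ k g r p)

  ++-↑ˡ : ∀ {m n} (x : Tup m) (y : Tup n) i → (x ++ y) (i ↑ˡ n) ≈ x i
  ++-↑ˡ x y i = reflexive (lookup-++ˡ x y i)

  ++-↑ʳ : ∀ {m n} (x : Tup m) (y : Tup n) i → (x ++ y) (m ↑ʳ i) ≈ y i
  ++-↑ʳ x y i = reflexive (lookup-++ʳ x y i)

  maps-++ : ∀ {m n} g {x x′ : Tup m} {y y′ : Tup n} → Maps g x x′ → Maps g y y′ → Maps g (x ++ y) (x′ ++ y′)
  maps-++ {m} g p q i with splitAt m i
  ... | inj₁ j = p j
  ... | inj₂ j = q j

  maps-++ˡ : ∀ {m n} g {x x′ : Tup m} {y y′ : Tup n} → Maps g (x ++ y) (x′ ++ y′) → Maps g x x′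
  maps-++ˡ g {x} {x′} {y} {y′} p i =
    trans (·-cong g (sym (++-↑ˡ x y i))) (trans (p _) (++-↑ˡ x′ y′ i))

  maps-++ʳ : ∀ {m n} g {x x′ : Tup m} {y y′ : Tup n} → Maps g (x ++ y) (x′ ++ y′) → Maps g y y′
  maps-++ʳ g {x} {x′} {y} {y′} p i =
    trans (·-cong g (sym (++-↑ʳ x y i))) (trans (p _) (++-↑ʳ x′ y′ i))

  ++-⊑ : ∀ {m n} {x : Tup m} {y : Tup n} {X : Subset dom} → x ⊑ X → y ⊑ X → (x ++ y) ⊑ X
  ++-⊑ {m} p q i with splitAt m i
  ... | inj₁ j = p j
  ... | inj₂ j = q j

  ++-⊑ˡ : ∀ {m n} {x : Tup m} {y : Tup n} {X : Subset dom} → (x ++ y) ⊑ X → x ⊑ X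
  ++-⊑ˡ {x = x} {y} {X} p i = Subset.resp X (++-↑ˡ x y i) (p _)

  ++-⊑ʳ : ∀ {m n} {x : Tup m} {y : Tup n} {X : Subset dom} → (x ++ y) ⊑ X → y ⊑ X
  ++-⊑ʳ {x = x} {y} {X} p i = Subset.resp X (++-↑ʳ x y i) (p _)

  ⊑-range : ∀ {m} {x : Tup m} → x ⊑ range {S = dom} x
  ⊑-range i = i , refl

  fixes-range : ∀ {k} {s : Tup k} (g : Aut) → Fixes g s → ∀ {x} → x ∈ range {S = dom} s → g · x ≈ x
  fixes-range g p (i , e) = trans (·-cong g (sym e)) (trans (p i) e)

  -- Types over finite tuples, and nonsplitting

  infix 4 _∼[_]_
  _∼[_]_ : ∀ {i} {I : Set i} {k} → (I → Carrier) → Tup k → (I → Carrier) → Set (i ⊔ ℓ)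
  x ∼[ s ] y = ∃[ g ] Fixes g s × Maps g x y

  module _ {i} {I : Set i} {k} {s : Tup k} where

    ∼-sym : ∀ {x y : I → Carrier} → x ∼[ s ] y → y ∼[ s ] x
    ∼-sym (g , p , q) = inv g , maps-inv g p , maps-inv g q

    ∼-trans : ∀ {x y z : I → Carrier} → x ∼[ s ] y → y ∼[ s ] z → x ∼[ s ] z
    ∼-trans (g , p , q) (h , p′ , q′) = h ∘ₐ g , maps-∘ h g p′ p , maps-∘ h g q′ q

  module _ {κ : Setoid ℓ ℓ} where
    open Types N κ

    galois⇒∼ : ∀ {i} {I : Set i} {k} {s : Tup k} {x y : I → Carrier} → SameGaloisType x y (range s) → x ∼[ s ] y
    galois⇒∼ (f , p) = AutomorphismOver.auto f , (λ i → AutomorphismOver.fixes f (i , refl)) , p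

    ∼⇒galois : ∀ {i} {I : Set i} {k} {s : Tup k} {x y : I → Carrier} → x ∼[ s ] y → SameGaloisType x y (range s)
    ∼⇒galois (g , p , q) = record { auto = g ; fixes = fixes-range g p } , q

    type⇒∼ : ∀ {i} {I : Set i} {k} {s : Tup k} {x y : I → Carrier} → SameType x y (range s) → x ∼[ s ] y
    type⇒∼ h = galois⇒∼ (h _ ⊑-range)

    ∼⇒type : ∀ {i} {I : Set i} {k} {s : Tup k} {x y : I → Carrier} → x ∼[ s ] y → SameType x y (range s)
    ∼⇒type (g , p , q) t t⊑s = ∼⇒galois (g , (λ i → fixes-range g p (t⊑s i)) , q)

  -- A positive form of nonsplitting: not the absence of a bad pair, but an automorphism that moves
  -- `b` to `d` while fixing `s` and `c`. The two forms agree by excluded middle.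
  record NonSplit {n k} (c : Tup n) (s : Tup k) (D : Subset dom) : Set ℓ where
    constructor nonsplit
    field
      ns : ∀ {m} (b d : Tup m) → b ⊑ D → d ⊑ D → b ∼[ s ] d → ∃[ g ] Fixes g s × Maps g b d × Fixes g c
  open NonSplit public

  nonsplit-⊆ : ∀ {n k} {c : Tup n} {s : Tup k} {D D′} → D′ ⊆ D → NonSplit c s D → NonSplit c s D′
  nonsplit-⊆ i n = nonsplit λ b d b⊑ d⊑ → ns n b d (λ j → i (b⊑ j)) (λ j → i (d⊑ j))

  -- The new part `t` of the base is appended to both `b` and `d`, so that the automorphism obtained
  -- over `s` fixes `t` as well.
  nonsplit-++ : ∀ {n k l} {c : Tup n} {s : Tup k} {t : Tup l} {D} → t ⊑ D → NonSplit c s D → NonSplit c (t ++ s) D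
  nonsplit-++ {s = s} {t} {D} t⊑ n = nonsplit λ b d b⊑ d⊑ (h , p , q) →
    let (g , u , v , w) = ns n (b ++ t) (d ++ t) (++-⊑ {X = D} b⊑ t⊑) (++-⊑ {X = D} d⊑ t⊑)
                            (h , maps-++ʳ h {t} {t} p , maps-++ h q (maps-++ˡ h p))
    in g , maps-++ g (maps-++ʳ g {b} {d} v) u , maps-++ˡ g v , w

  nonsplit-≈ : ∀ {n k} {c c′ : Tup n} {s : Tup k} {D} → (∀ i → c i ≈ c′ i) → NonSplit c s D → NonSplit c′ s D
  nonsplit-≈ e n = nonsplit λ b d b⊑ d⊑ p →
    let (g , u , v , w) = ns n b d b⊑ d⊑ p in g , u , v , maps-≈ˡ g (sym ∘ e) (maps-≈ʳ g e w)

  -- Conjugation by `f`, which moves nothing in `D`, turns the witnesses for `f · c` into witnesses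
  -- for `c`.
  nonsplit-fix : ∀ {n k} {c : Tup n} {s : Tup k} {D} f → (∀ {x} → x ∈ D → f · x ≈ x) → s ⊑ D →
                 NonSplit (λ i → f · c i) s D → NonSplit c s D
  nonsplit-fix {c = c} {s} {D} f fix s⊑ n = nonsplit go
    where
    go : ∀ {m} (b d : Tup m) → b ⊑ D → d ⊑ D → b ∼[ s ] d → ∃[ g ] Fixes g s × Maps g b d × Fixes g c
    go b d b⊑ d⊑ p with ns n b d b⊑ d⊑ p
    ... | g , u , v , w = conj f g , maps-conj f g (fix ∘ s⊑) (fix ∘ s⊑) u , maps-conj f g (fix ∘ b⊑) (fix ∘ d⊑) v
                        , maps-conj f g (maps-img f) (maps-img f) w

-- Automorphisms of `M^eq`, and tuples of imaginaries

module ImaginaryElements {ℓ : Level} {L : Language ℓ} {𝒦 : AEC L} {𝕄 : Monster 𝒦} (ℰ : Imaginaries 𝕄) where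
  open import Data.Vec.Functional using ([])
  open Monster 𝕄
  open Structure M hiding (isEquivalence)
  open Tuples M
  open Imaginaries ℰ
  open Meq ℰ
  module Aᵉ = Tuples M^eq
  open Types M δ using (AutomorphismOver)
  private
    module Mᵉ = Structure M^eq

  -- Compatibility with `≈` comes from `G-defines`: reflexivity places `x ++ x` in some Galois type
  -- of the collection, and an orbit is closed under `≈`.
  ≋⇒sort : ∀ {n} (E : Sort n) {x y : Tup n} → (∀ i → x i ≈ y i) → E [ x ~ y ]
  ≋⇒sort E {x} {y} p =
    let (l , f , q) = Equivalence.to (G-defines E x x) (IsEquivalence.refl (isEquivalence E))
    in Equivalence.from (G-defines E x y) (l , f , maps-≈ˡ (AutomorphismOver.auto f) (λ i → sym (xx≈xy i)) q)
    where
    xx≈xy : ∀ i → (x ++ x) i ≈ (x ++ y) i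
    xx≈xy = maps-++ idₐ {x} {x} {x} {y} (λ _ → refl) p

  real-cong : ∀ {x y} → x ≈ y → real x ≈ᵉ real y
  real-cong p = class (≋⇒sort eq (λ _ → p))

  real-injective : ∀ {x y} → real x ≈ᵉ real y → x ≈ y
  real-injective (class p) = Equivalence.to (eq-equality _ _) p zero

  private
    act : Aut → Element → Element
    act g (x / E) = (λ i → g · x i) / E

    act-cong : ∀ g {u v} → u ≈ᵉ v → act g u ≈ᵉ act g v
    act-cong g (class {E = E} p) = class (invariant E g p)

    act-inv : ∀ g u → act (inv g) (act g u) ≈ᵉ u
    act-inv g (x / E) = class (≋⇒sort E (λ i → inv-· g refl))

    inv-act : ∀ g u → act g (act (inv g) u) ≈ᵉ u
    inv-act g (x / E) = class (≋⇒sort E (λ i → ·-inv g (x i)))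

    act-rel : ∀ g {n} (R : RelSymᵉ n) {z} → relᵉ R z → relᵉ R (act g ∘ z)
    act-rel g R[ R ] (x , p , q) = (λ i → g · x i) , (λ i → act-cong g (p i)) , Equivalence.to (Automorphism.rel-⇔ g R x) q
    act-rel g f[ f ] (x , p , q) = (λ i → g · x i) , (λ i → act-cong g (p i)) ,
      Mᵉ.trans (act-cong g q) (real-cong (Automorphism.fun-hom g f x))
    act-rel g P[ E ] (x , p)     = (λ i → g · x i) , act-cong g p
    act-rel g F[ E ] (x , p , q) = (λ i → g · x i) , (λ i → act-cong g (p i)) , act-cong g q

  infix 20 _ᵉ
  _ᵉ : Aut → Aᵉ.Aut
  g ᵉ = record
    { embedding = record
      { to        = act g
      ; cong      = act-cong g
      ; injective = λ {u} {v} p → Mᵉ.trans (Mᵉ.sym (act-inv g u)) (Mᵉ.trans (act-cong (inv g) p) (act-inv g v))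
      ; rel-⇔     = λ R z → mk⇔ (act-rel g R) (λ r → relᵉ-resp R (λ i → act-inv g (z i)) (act-rel (inv g) R r))
      ; fun-hom   = λ ()
      }
    ; onto = λ u → act (inv g) u , inv-act g u
    }

  -- The relations P[ eq ] and F[ E ] determine an automorphism of M^eq by its values on M.
  module Restrict (f : Aᵉ.Aut) where
    private
      image-real : ∀ x → ∃[ y ] f Aᵉ.· real x ≈ᵉ real y
      image-real x =
        let (y , p) = Equivalence.to (Automorphism.rel-⇔ f P[ eq ] (λ _ → real x)) ((λ _ → x) , Mᵉ.refl)
        in y zero , Mᵉ.trans p (class (≋⇒sort eq (λ { zero → refl })))

      f₀ : Carrier → Carrier
      f₀ x = proj₁ (image-real x)

      spec : ∀ x → f Aᵉ.· real x ≈ᵉ real (f₀ x)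
      spec x = proj₂ (image-real x)

      same : ∀ {n} {x y : Tup n} → (∀ i → f Aᵉ.· real (x i) ≈ᵉ real (y i)) → ∀ i → y i ≈ f₀ (x i)
      same p i = real-injective (Mᵉ.trans (Mᵉ.sym (p i)) (spec _))

      _∷ᵉ_ : ∀ {n} → Element → Vector Element n → Vector Element (suc n)
      (u ∷ᵉ z) zero    = u
      (u ∷ᵉ z) (suc i) = z i

    restrict : Aut
    restrict = record
      { embedding = record
        { to        = f₀
        ; cong      = λ p → real-injective (Mᵉ.trans (Mᵉ.sym (spec _)) (Mᵉ.trans (Aᵉ.·-cong f (real-cong p)) (spec _)))
        ; injective = λ p → real-injective (Automorphism.injective f (Mᵉ.trans (spec _) (Mᵉ.trans (real-cong p) (Mᵉ.sym (spec _)))))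
        ; rel-⇔     = λ R xs → mk⇔
            (λ r → let (x , p , q) = Equivalence.to (Automorphism.rel-⇔ f R[ R ] (real ∘ xs)) (xs , (λ i → Mᵉ.refl) , r)
                   in rel-resp R (same p) q)
            (λ r → let (x , p , q) = Equivalence.from (Automorphism.rel-⇔ f R[ R ] (real ∘ xs)) (f₀ ∘ xs , (λ i → spec (xs i)) , r)
                   in rel-resp R (λ i → sym (real-injective (p i))) q)
        ; fun-hom   = λ h xs →
            let (x , p , q) = Equivalence.to (Automorphism.rel-⇔ f f[ h ] (real (fun h xs) ∷ᵉ (real ∘ xs))) (xs , (λ i → Mᵉ.refl) , Mᵉ.refl)
            in trans (sym (real-injective (Mᵉ.trans (Mᵉ.sym q) (spec _)))) (fun-cong h (same p))
        }
      ; onto = λ y →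
          let (u , p) = Automorphism.onto f (real y)
              (x , q) = Equivalence.from (Automorphism.rel-⇔ f P[ eq ] (λ _ → u)) ((λ _ → y) , p)
              q′ = Mᵉ.trans q (class (≋⇒sort eq (λ { zero → refl })))
          in x zero , real-injective (Mᵉ.trans (Mᵉ.sym (spec (x zero))) (Mᵉ.trans (Aᵉ.·-cong f (Mᵉ.sym q′)) p))
      }

    restrict-real : ∀ x → f Aᵉ.· real x ≈ᵉ real (restrict · x)
    restrict-real = spec

    restrict-≈ : ∀ u → f Aᵉ.· u ≈ᵉ restrict ᵉ Aᵉ.· u
    restrict-≈ (x / E) =
      let (y , p , q) = Equivalence.to (Automorphism.rel-⇔ f F[ E ] ((x / E) ∷ᵉ (real ∘ x))) (x , (λ i → Mᵉ.refl) , Mᵉ.refl)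
      in Mᵉ.trans q (class (≋⇒sort E (same p)))

  open Restrict public using (restrict; restrict-real; restrict-≈)

  -- A tuple of imaginaries is given by its sorts and by one long tuple of M.

  Shape : ℕ → Set
  Shape m = Vector (∃ Sort) m

  Values : ∀ {m} → Shape m → Set ℓ
  Values sh = ∀ i → Tup (proj₁ (sh i))

  el : ∀ {m} (sh : Shape m) → Values sh → Aᵉ.Tup m
  el sh v i = v i / proj₂ (sh i)

  sortOf : Element → ∃ Sort
  sortOf (_ / E) = _ , E

  valueOf : (u : Element) → Tup (proj₁ (sortOf u))
  valueOf (x / _) = x

  shape : ∀ {m} → Aᵉ.Tup m → Shape m
  shape y i = sortOf (y i)

  values : ∀ {m} (y : Aᵉ.Tup m) → Values (shape y)
  values y i = valueOf (y i)

  el-values : ∀ {m} (y : Aᵉ.Tup m) i → el (shape y) (values y) i ≡ y i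
  el-values y i = go (y i)
    where
    go : ∀ u → valueOf u / proj₂ (sortOf u) ≡ u
    go (x / E) = ≡.refl

  size : ∀ {m} → Shape m → ℕ
  size {zero}  sh = 0
  size {suc m} sh = proj₁ (sh zero) + size (sh ∘ suc)

  flat : ∀ {m} (sh : Shape m) → Values sh → Tup (size sh)
  flat {zero}  sh v = []
  flat {suc m} sh v = v zero ++ flat (sh ∘ suc) (v ∘ suc)

  pos : ∀ {m} (sh : Shape m) i → Fin (proj₁ (sh i)) → Fin (size sh)
  pos {suc m} sh zero    l = l ↑ˡ size (sh ∘ suc)
  pos {suc m} sh (suc i) l = proj₁ (sh zero) ↑ʳ pos (sh ∘ suc) i l

  flat-pos : ∀ {m} (sh : Shape m) v i l → flat sh v (pos sh i l) ≡ v i l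
  flat-pos {suc m} sh v zero    l = lookup-++ˡ (v zero) (flat (sh ∘ suc) (v ∘ suc)) l
  flat-pos {suc m} sh v (suc i) l = ≡.trans (lookup-++ʳ (v zero) (flat (sh ∘ suc) (v ∘ suc)) (pos (sh ∘ suc) i l)) (flat-pos (sh ∘ suc) (v ∘ suc) i l)

  flat-⊑ : ∀ {m} (sh : Shape m) v {X : Subset dom} → (∀ i → v i ⊑ X) → flat sh v ⊑ X
  flat-⊑ {zero}  sh v p ()
  flat-⊑ {suc m} sh v {X} p = ++-⊑ {X = X} (p zero) (flat-⊑ (sh ∘ suc) (v ∘ suc) {X} (p ∘ suc))

  flat-maps : ∀ {m} (sh : Shape m) v v′ g → Maps g (flat sh v) (flat sh v′) → Aᵉ.Maps (g ᵉ) (el sh v) (el sh v′)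
  flat-maps sh v v′ g p i = class (≋⇒sort (proj₂ (sh i)) (λ l →
    trans (·-cong g (reflexive (≡.sym (flat-pos sh v i l)))) (trans (p (pos sh i l)) (reflexive (flat-pos sh v′ i l)))))

  ⌊_⌋ : ∀ {m} (y : Aᵉ.Tup m) → Tup (size (shape y))
  ⌊ y ⌋ = flat (shape y) (values y)

  fixes-⌊⌋ : ∀ {m} (y : Aᵉ.Tup m) g → Fixes g ⌊ y ⌋ → Aᵉ.Fixes (g ᵉ) y
  fixes-⌊⌋ y g p = Aᵉ.maps-≈ˡ (g ᵉ) (λ i → Mᵉ.reflexive (≡.sym (el-values y i)))
    (Aᵉ.maps-≈ʳ (g ᵉ) (λ i → Mᵉ.reflexive (el-values y i)) (flat-maps (shape y) (values y) (values y) g p))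

module _ (em : ∀ {a : Level} → ExcludedMiddle a) (fe : ∀ {a b : Level} → Extensionality a b) where

  -- Choice, Zorn's lemma and cardinal arithmetic

  module Cardinals where
    open import Data.List.Base using ([]; _∷_; map)
    open import Data.Nat.Properties using (+-suc; +-identityʳ; suc-injective)
    open import Data.Sum.Relation.Binary.Pointwise using (inj₁; inj₂)
    open import Data.Unit.Base using (⊤; tt)
    open ≡ using (refl; sym; trans; cong; cong₂; subst)
    open Injection using (to; injective)

    -- Excluded middle decides types, not only propositions, so it yields choice.
    truth : ∀ {a} → Set a → Bool
    truth P with em {P = P}
    ... | yes _ = true
    ... | no  _ = false

    truth-intro : ∀ {a} {P : Set a} → P → truth P ≡ true
    truth-intro {P = P} p with em {P = P}
    ... | yes _ = refl
    ... | no ¬p = ⊥-elim (¬p p)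

    truth-elim : ∀ {a} {P : Set a} → truth P ≡ true → P
    truth-elim {P = P} e with em {P = P}
    ... | yes p = p

    truth-cong : ∀ {a b} {P : Set a} {Q : Set b} → (P → Q) → (Q → P) → truth P ≡ truth Q
    truth-cong {P = P} {Q} f g with em {P = P} | em {P = Q}
    ... | yes _ | yes _ = refl
    ... | yes p | no ¬q = ⊥-elim (¬q (f p))
    ... | no ¬p | yes q = ⊥-elim (¬p (g q))
    ... | no _  | no _  = refl

    by-contradiction : ∀ {a} {P : Set a} → ¬ ¬ P → P
    by-contradiction {P = P} ¬¬p with em {P = P}
    ... | yes p = p
    ... | no ¬p = ⊥-elim (¬¬p ¬p)

    -- The given witness serves only to refute the negative answer of `em`; the value is the one
    -- found by `em` and depends on `χ` alone. This makes representatives of classes well defined.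
    choose : ∀ {a} {X : Set a} (χ : X → Bool) → ∃[ x ] χ x ≡ true → ∃[ x ] χ x ≡ true
    choose χ w with em {P = ∃[ x ] χ x ≡ true}
    ... | yes v = v
    ... | no ¬v = ⊥-elim (¬v w)

    choose-irr : ∀ {a} {X : Set a} {χ χ′ : X → Bool} (w : ∃[ x ] χ x ≡ true) (w′ : ∃[ x ] χ′ x ≡ true) →
                 χ ≡ χ′ → proj₁ (choose χ w) ≡ proj₁ (choose χ′ w′)
    choose-irr {χ = χ} w w′ refl with em {P = ∃[ x ] χ x ≡ true}
    ... | yes v = refl
    ... | no ¬v = ⊥-elim (¬v w)

    uip : ∀ {a} {X : Set a} {x y : X} (p q : x ≡ y) → p ≡ q
    uip refl refl = refl

    module _ {a b} (S : Setoid a b) where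
      open Setoid S renaming (refl to ≈-refl; sym to ≈-sym; trans to ≈-trans)

      private
        χ : Carrier → Carrier → Bool
        χ x y = truth (x ≈ y)

      rep : Carrier → Carrier
      rep x = proj₁ (choose (χ x) (x , truth-intro ≈-refl))

      rep-≈ : ∀ x → x ≈ rep x
      rep-≈ x = truth-elim (proj₂ (choose (χ x) (x , truth-intro ≈-refl)))

      rep-cong : ∀ {x y} → x ≈ y → rep x ≡ rep y
      rep-cong p = choose-irr _ _ (fe λ z → truth-cong (≈-trans (≈-sym p)) (≈-trans p))

      Reps : Set _
      Reps = ∃[ x ] rep x ≡ x

      private
        Reps-≡ : {u v : Reps} → proj₁ u ≡ proj₁ v → u ≡ v
        Reps-≡ {x , _} refl = cong (x ,_) (uip _ _)

      toReps : S ≲ setoid Reps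
      toReps = record
        { to        = λ x → rep x , sym (rep-cong (rep-≈ x))
        ; cong      = λ p → Reps-≡ (rep-cong p)
        ; injective = λ {x} {y} e → ≈-trans (rep-≈ x) (≈-trans (reflexive (cong proj₁ e)) (≈-sym (rep-≈ y)))
        }

      fromReps : setoid Reps ≲ S
      fromReps = record
        { to        = proj₁
        ; cong      = λ e → reflexive (cong proj₁ e)
        ; injective = λ {u} {v} p → Reps-≡ (trans (sym (proj₂ u)) (trans (rep-cong p) (proj₂ v)))
        }

    -- Zorn's lemma for families of subsets of U that are closed under unions
    -- of chains, by the tower construction: the subsets reached from the
    -- bottom by enlarging and taking unions form a chain, whose union cannot
    -- be enlarged.

    module _ {u} {U : Set u} where

      Sub : Set u
      Sub = U → Bool

      infix 4 _≤_
      _≤_ : Sub → Sub → Set u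
      A ≤ B = ∀ x → A x ≡ true → B x ≡ true

      ≤-antisym : ∀ {A B} → A ≤ B → B ≤ A → A ≡ B
      ≤-antisym {A} {B} p q = fe λ x → eq x (A x) (B x) refl refl
        where
        eq : ∀ x a b → A x ≡ a → B x ≡ b → A x ≡ B x
        eq x true  _     e _ = trans e (sym (p x e))
        eq x false true  _ e = trans (q x e) (sym e)
        eq x false false e d = trans e (sym d)

      sup : (Sub → Bool) → Sub
      sup C x = truth (∃[ A ] C A ≡ true × A x ≡ true)

      sup-upper : ∀ {C A} → C A ≡ true → A ≤ sup C
      sup-upper c x e = truth-intro (_ , c , e)

      sup-least : ∀ {C B} → (∀ A → C A ≡ true → A ≤ B) → sup C ≤ B
      sup-least h x e with truth-elim e
      ... | A , c , Ax = h A c x Ax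

      module Zorn {g} (𝒢 : Sub → Set g)
                  (chain : ∀ C → (∀ A → C A ≡ true → 𝒢 A) →
                           (∀ A B → C A ≡ true → C B ≡ true → A ≤ B ⊎ B ≤ A) → 𝒢 (sup C)) where

        Bigger : Sub → Set (u ⊔ g)
        Bigger A = Σ[ B ∈ Sub ] 𝒢 B × A ≤ B × ¬ (B ≤ A)

        private
          f : Sub → Sub
          f A with em {P = Bigger A}
          ... | yes (B , _) = B
          ... | no  _       = A

          f-𝒢 : ∀ {A} → 𝒢 A → 𝒢 (f A)
          f-𝒢 {A} p with em {P = Bigger A}
          ... | yes (_ , q , _) = q
          ... | no  _           = p

          f-infl : ∀ A → A ≤ f A
          f-infl A with em {P = Bigger A}
          ... | yes (_ , _ , q , _) = q
          ... | no  _               = λ _ e → e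

          f-max : ∀ {A} → f A ≤ A → ¬ Bigger A
          f-max {A} p b with em {P = Bigger A}
          ... | yes (_ , _ , _ , q) = q p
          ... | no  ¬b              = ¬b b

          data T : Sub → Set u where
            step : ∀ {A} → T A → T (f A)
            ⋃T   : ∀ C → (∀ A → C A ≡ true → T A) → T (sup C)

          -- The notion from the proof of the Bourbaki-Witt theorem: `f` does not jump over `E` from
          -- below. Every member of the tower is comparable with such an `E`, and every member turns
          -- out to be extreme.
          Extreme : Sub → Set u
          Extreme E = ∀ {A} → T A → A ≤ E → ¬ (E ≤ A) → f A ≤ E

          ≤-trans : ∀ {A B C : Sub} → A ≤ B → B ≤ C → A ≤ C
          ≤-trans p q x e = q x (p x e)

          extreme⇒ : ∀ {E A} → Extreme E → T A → A ≤ E ⊎ f E ≤ A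
          extreme⇒ {E} ex (step {A} t) with extreme⇒ ex t
          ... | inj₂ q = inj₂ (≤-trans q (f-infl A))
          ... | inj₁ p with em {P = E ≤ A}
          ...   | no ¬q = inj₁ (ex t p ¬q)
          ...   | yes q = inj₂ (λ x e → subst (λ B → f B x ≡ true) (≤-antisym q p) e)
          extreme⇒ {E} ex (⋃T C t) with em {P = ∀ A → C A ≡ true → A ≤ E}
          ... | yes all = inj₁ (sup-least all)
          ... | no ¬all = inj₂ (by-contradiction λ ¬q → ¬all λ A c → case A c ¬q)
            where
            case : ∀ A → C A ≡ true → ¬ (f E ≤ sup C) → A ≤ E
            case A c ¬q with extreme⇒ ex (t A c)
            ... | inj₁ p = p
            ... | inj₂ q = ⊥-elim (¬q (≤-trans q (sup-upper c)))

          extreme : ∀ {E} → T E → Extreme E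
          extreme (step {E} t) {A} s p ¬q with extreme⇒ (extreme t) s
          ... | inj₂ q = ⊥-elim (¬q q)
          ... | inj₁ r with em {P = E ≤ A}
          ...   | no ¬r = ≤-trans (extreme t s r ¬r) (f-infl E)
          ...   | yes r′ = λ x e → subst (λ B → f B x ≡ true) (≤-antisym r r′) e
          extreme (⋃T C t) {A} s p ¬q = by-contradiction λ ¬r → ¬q (sup-least λ B c → below B c ¬r)
            where
            below : ∀ B → C B ≡ true → ¬ (f A ≤ sup C) → B ≤ A
            below B c ¬r with extreme⇒ (extreme (t B c)) s
            ... | inj₂ q = ≤-trans (f-infl B) q
            ... | inj₁ r with em {P = B ≤ A}
            ...   | yes r′ = r′
            ...   | no ¬r′ = ⊥-elim (¬r (≤-trans (extreme (t B c) s r ¬r′) (sup-upper c)))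

          T-𝒢 : ∀ {A} → T A → 𝒢 A
          T-𝒢 (step t) = f-𝒢 (T-𝒢 t)
          T-𝒢 (⋃T C t) = chain C (λ A c → T-𝒢 (t A c)) linear
            where
            linear : ∀ A B → C A ≡ true → C B ≡ true → A ≤ B ⊎ B ≤ A
            linear A B c d with extreme⇒ (extreme (t B d)) (t A c)
            ... | inj₁ p = inj₁ p
            ... | inj₂ q = inj₂ (≤-trans (f-infl B) q)

          top : Sub → Bool
          top A = truth (T A)

          T-top : T (sup top)
          T-top = ⋃T top (λ A e → truth-elim e)

        maximal : Σ[ A ∈ Sub ] 𝒢 A × ¬ Bigger A
        maximal = sup top , T-𝒢 T-top , f-max (sup-upper {top} (truth-intro (step T-top)))

    infix 0 _↣_
    _↣_ : ∀ {a b} → Set a → Set b → Set (a ⊔ b)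
    X ↣ Y = setoid X ≲ setoid Y

    mk↣ : ∀ {a b} {X : Set a} {Y : Set b} (f : X → Y) → (∀ {x y} → f x ≡ f y → x ≡ y) → X ↣ Y
    mk↣ f inj = record { to = f ; cong = cong f ; injective = inj }

    ≲-refl : ∀ {a b} {S : Setoid a b} → S ≲ S
    ≲-refl = record { to = id ; cong = id ; injective = id }

    infixr 9 _⊙_
    _⊙_ : ∀ {a b c d e f} {S : Setoid a b} {T : Setoid c d} {V : Setoid e f} → T ≲ V → S ≲ T → S ≲ V
    g ⊙ f = record
      { to        = to g ∘ to f
      ; cong      = Injection.cong g ∘ Injection.cong f
      ; injective = injective f ∘ injective g
      }

    ×-↣ : ∀ {a b c d} {X : Set a} {Y : Set b} {V : Set c} {W : Set d} → X ↣ Y → V ↣ W → X × V ↣ Y × W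
    ×-↣ f g = mk↣ (λ (x , v) → to f x , to g v)
      (λ e → cong₂ _,_ (injective f (cong proj₁ e)) (injective g (cong proj₂ e)))

    ⊎-↣ : ∀ {a b c d} {X : Set a} {Y : Set b} {V : Set c} {W : Set d} → X ↣ Y → V ↣ W → X ⊎ V ↣ Y ⊎ W
    ⊎-↣ {X = X} {Y} {V} {W} f g = mk↣ h h-inj
      where
      h : X ⊎ V → Y ⊎ W
      h (inj₁ x) = inj₁ (to f x)
      h (inj₂ v) = inj₂ (to g v)
      h-inj : ∀ {u v} → h u ≡ h v → u ≡ v
      h-inj {inj₁ _} {inj₁ _} e = cong inj₁ (injective f (inj₁-injective e))
      h-inj {inj₂ _} {inj₂ _} e = cong inj₂ (injective g (inj₂-injective e))

    lift↣ : ∀ {a b} {X : Set a} → Lift b X ↣ X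
    lift↣ = mk↣ lower (λ { refl → refl })

    lower↣ : ∀ {a b} {X : Set a} → X ↣ Lift b X
    lower↣ = mk↣ lift (λ { refl → refl })

    -- The sum of two copies of X is recovered from X × X as soon as X has two elements.
    ⊎↣× : ∀ {a} {X : Set a} {x₀ x₁ : X} → ¬ (x₀ ≡ x₁) → X ⊎ X ↣ X × X
    ⊎↣× {X = X} {x₀} {x₁} ne = mk↣ h inj
      where
      h : X ⊎ X → X × X
      h (inj₁ x) = x₀ , x
      h (inj₂ x) = x₁ , x
      inj : ∀ {u v} → h u ≡ h v → u ≡ v
      inj {inj₁ _} {inj₁ _} refl = refl
      inj {inj₁ _} {inj₂ _} e    = ⊥-elim (ne (cong proj₁ e))
      inj {inj₂ _} {inj₁ _} e    = ⊥-elim (ne (sym (cong proj₁ e)))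
      inj {inj₂ _} {inj₂ _} refl = refl

    module _ {a b} (X : Set a) (Y : Set b) where
      private
        U : Set (a ⊔ b)
        U = X × Y

        record Matching (R : Sub {U = U}) : Set (a ⊔ b) where
          field
            fun : ∀ {x y y′} → R (x , y) ≡ true → R (x , y′) ≡ true → y ≡ y′
            inj : ∀ {x x′ y} → R (x , y) ≡ true → R (x′ , y) ≡ true → x ≡ x′
        open Matching

        chain : ∀ C → (∀ R → C R ≡ true → Matching R) →
                (∀ R R′ → C R ≡ true → C R′ ≡ true → R ≤ R′ ⊎ R′ ≤ R) → Matching (sup C)
        chain C good lin = record { fun = fun′ ; inj = inj′ }
          where
          fun′ : ∀ {x y y′} → sup C (x , y) ≡ true → sup C (x , y′) ≡ true → y ≡ y′
          fun′ p q with truth-elim p | truth-elim q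
          ... | R , c , r | R′ , c′ , r′ with lin R R′ c c′
          ...   | inj₁ le = fun (good R′ c′) (le _ r) r′
          ...   | inj₂ le = fun (good R c) r (le _ r′)
          inj′ : ∀ {x x′ y} → sup C (x , y) ≡ true → sup C (x′ , y) ≡ true → x ≡ x′
          inj′ p q with truth-elim p | truth-elim q
          ... | R , c , r | R′ , c′ , r′ with lin R R′ c c′
          ...   | inj₁ le = inj (good R′ c′) (le _ r) r′
          ...   | inj₂ le = inj (good R c) r (le _ r′)

        open Zorn Matching chain

        add : ∀ R → Matching R → ∀ x₀ y₀ → (∀ y → ¬ R (x₀ , y) ≡ true) → (∀ x → ¬ R (x , y₀) ≡ true) → Bigger R
        add R m x₀ y₀ nx ny =
          R′ , record { fun = fun′ ; inj = inj′ } , (λ _ e → truth-intro (inj₁ e)) ,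
          λ le → nx y₀ (le _ (truth-intro (inj₂ refl)))
          where
          R′ : Sub
          R′ u = truth (R u ≡ true ⊎ u ≡ (x₀ , y₀))
          fun′ : ∀ {x y y′} → R′ (x , y) ≡ true → R′ (x , y′) ≡ true → y ≡ y′
          fun′ p q with truth-elim p | truth-elim q
          ... | inj₁ r    | inj₁ r′   = fun m r r′
          ... | inj₁ r    | inj₂ refl = ⊥-elim (nx _ r)
          ... | inj₂ refl | inj₁ r    = ⊥-elim (nx _ r)
          ... | inj₂ refl | inj₂ refl = refl
          inj′ : ∀ {x x′ y} → R′ (x , y) ≡ true → R′ (x′ , y) ≡ true → x ≡ x′
          inj′ p q with truth-elim p | truth-elim q
          ... | inj₁ r    | inj₁ r′   = inj m r r′
          ... | inj₁ r    | inj₂ refl = ⊥-elim (ny _ r)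
          ... | inj₂ refl | inj₁ r    = ⊥-elim (ny _ r)
          ... | inj₂ refl | inj₂ refl = refl

      opaque
       compare : (X ↣ Y) ⊎ (Y ↣ X)
       compare with maximal
       ... | R , m , max with em {P = ∀ x → ∃[ y ] R (x , y) ≡ true}
       ...   | yes h = inj₁ (mk↣ (proj₁ ∘ h)
                         (λ {x} {x′} e → inj m (proj₂ (h x)) (subst (λ y → R (x′ , y) ≡ true) (sym e) (proj₂ (h x′)))))
       -- Some `x` is unmatched. An unmatched `y` could be paired with it, against maximality, so
       -- every `y` is matched.
       ...   | no ¬h = inj₂ (mk↣ (proj₁ ∘ k)
                         (λ {y} {y′} e → fun m (proj₂ (k y)) (subst (λ x → R (x , y′) ≡ true) (sym e) (proj₂ (k y′)))))
         where
         k : ∀ y → ∃[ x ] R (x , y) ≡ true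
         k y = by-contradiction λ ny → ¬h λ x → by-contradiction λ nx →
                 max (add R m x y (λ y′ r → nx (y′ , r)) (λ x′ r → ny (x′ , r)))

    private
      next : ℕ × ℕ → ℕ × ℕ
      next (zero  , j) = suc j , zero
      next (suc i , j) = i , suc j

    unpair : ℕ → ℕ × ℕ
    unpair zero    = zero , zero
    unpair (suc n) = next (unpair n)

    private
      -- The walk `next` descends each antidiagonal from `(s , 0)` to `(0 , s)` and then jumps to
      -- `(suc s , 0)`; a pair is reached from its predecessor on the diagonal or from the end of
      -- the preceding one.
      reach : ∀ s j i → i + j ≡ s → ∃[ n ] unpair n ≡ (i , j)
      reach zero    zero    zero    e = zero , refl
      reach (suc s) zero    (suc i) e with reach s s zero refl
      ... | n , p = suc n , trans (cong next p) (cong (λ k → suc k , zero) (sym (suc-injective (trans (sym (+-identityʳ (suc i))) e))))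
      reach s       (suc j) i       e with reach s j (suc i) (trans (sym (+-suc i j)) e)
      ... | n , p = suc n , cong next p

    ℕ×ℕ↣ℕ : ℕ × ℕ ↣ ℕ
    ℕ×ℕ↣ℕ = mk↣ (λ (i , j) → proj₁ (reach _ j i refl))
      λ {p} {q} e → trans (sym (proj₂ (reach _ (proj₂ p) (proj₁ p) refl)))
                      (trans (cong unpair e) (proj₂ (reach _ (proj₂ q) (proj₁ q) refl)))

    -- Hessenberg's theorem, by Zorn's lemma for injections D × D → D with D ⊆ X.

    module _ {a} {X : Set a} (ι : ℕ ↣ X) where
      private
        U : Set a
        U = (X × X) × X

        -- The partial operation is a set of triples whose domain is read off the diagonal. The
        -- field `base` keeps a copy of `ℕ` in the domain, which supplies the two elements needed
        -- for `D ⊎ D ↣ D`.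
        record Square {p} (P : U → Set p) : Set (a ⊔ p) where
          Dom : X → Set (a ⊔ p)
          Dom x = ∃[ z ] P ((x , x) , z)
          field
            fun    : ∀ {p z z′} → P (p , z) → P (p , z′) → z ≡ z′
            inj    : ∀ {p p′ z} → P (p , z) → P (p′ , z) → p ≡ p′
            closed : ∀ {x y z} → P ((x , y) , z) → Dom x × Dom y × Dom z
            total  : ∀ {x y} → Dom x → Dom y → ∃[ z ] P ((x , y) , z)
            base   : ∀ i → Dom (to ι i)

        IsSquare : Sub {U = U} → Set a
        IsSquare R = Square (λ u → R u ≡ true)

        truth-Square : ∀ {p} {P : U → Set p} → Square P → IsSquare (λ u → truth (P u))
        truth-Square {P = P} s = record
          { fun    = λ r r′ → S.fun (truth-elim r) (truth-elim r′)
          ; inj    = λ r r′ → S.inj (truth-elim r) (truth-elim r′)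
          ; closed = λ r → let (x , y , z) = S.closed (truth-elim r) in dom x , dom y , dom z
          ; total  = λ (_ , x) (_ , y) → let (z , r) = S.total (_ , truth-elim x) (_ , truth-elim y) in z , truth-intro r
          ; base   = λ i → dom (S.base i)
          }
          where
          module S = Square s
          dom : ∀ {x} → S.Dom x → ∃[ z ] truth (P ((x , x) , z)) ≡ true
          dom (z , r) = z , truth-intro r

        P₀ : U → Set a
        P₀ ((x , y) , z) = ∃[ i ] ∃[ j ] x ≡ to ι i × y ≡ to ι j × z ≡ to ι (to ℕ×ℕ↣ℕ (i , j))

        square₀ : Square P₀
        square₀ = record
          { fun    = λ { (i , j , refl , refl , refl) (i′ , j′ , e , f , refl) →
                         cong (to ι ∘ to ℕ×ℕ↣ℕ) (cong₂ _,_ (injective ι e) (injective ι f)) }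
          ; inj    = λ { {p} {p′} (i , j , refl , refl , refl) (i′ , j′ , refl , refl , g) →
                         cong (λ (i , j) → to ι i , to ι j) (injective ℕ×ℕ↣ℕ {i , j} {i′ , j′} (injective ι g)) }
          ; closed = λ { (i , j , refl , refl , refl) → dom i , dom j , dom _ }
          ; total  = λ { (_ , i , _ , refl , _ , _) (_ , j , _ , refl , _ , _) → _ , i , j , refl , refl , refl }
          ; base   = dom
          }
          where
          dom : ∀ i → ∃[ z ] P₀ ((to ι i , to ι i) , z)
          dom i = _ , i , i , refl , refl , refl

        -- The empty relation is admitted so that the empty chain has a bound.
        𝒢 : Sub {U = U} → Set a
        𝒢 R = (∀ u → ¬ R u ≡ true) ⊎ IsSquare R

        good : ∀ {R u} → R u ≡ true → 𝒢 R → IsSquare R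
        good r (inj₁ e) = ⊥-elim (e _ r)
        good r (inj₂ s) = s

        chain : ∀ C → (∀ R → C R ≡ true → 𝒢 R) →
                (∀ R R′ → C R ≡ true → C R′ ≡ true → R ≤ R′ ⊎ R′ ≤ R) → 𝒢 (sup C)
        chain C g lin with em {P = ∃[ R ] C R ≡ true × IsSquare R}
        ... | no none = inj₁ λ u r → let (R , c , r′) = truth-elim r in none (R , c , good r′ (g R c))
        ... | yes (R₀ , c₀ , s₀) = inj₂ record
          { fun    = λ p q → let (_ , _ , s , r , r′) = common p q in Square.fun s r r′
          ; inj    = λ p q → let (_ , _ , s , r , r′) = common p q in Square.inj s r r′
          ; closed = λ p → let (_ , c , s , r , _) = common p p
                               (x , y , z) = Square.closed s r in dom c x , dom c y , dom c z
          ; total  = λ (_ , p) (_ , q) → let (_ , c , s , r , r′) = common p q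
                                             (z , t) = Square.total s (_ , r) (_ , r′) in z , sup-upper c _ t
          ; base   = λ i → dom c₀ (Square.base s₀ i)
          }
          where
          dom : ∀ {R x} → C R ≡ true → ∃[ z ] R ((x , x) , z) ≡ true → ∃[ z ] sup C ((x , x) , z) ≡ true
          dom c (z , r) = z , sup-upper c _ r
          common : ∀ {u v} → sup C u ≡ true → sup C v ≡ true →
                   ∃[ R ] C R ≡ true × IsSquare R × R u ≡ true × R v ≡ true
          common p q with truth-elim p | truth-elim q
          ... | R , c , r | R′ , c′ , r′ with lin R R′ c c′
          ...   | inj₁ le = R′ , c′ , good r′ (g R′ c′) , le _ r , r′
          ...   | inj₂ le = R , c , good r (g R c) , r , le _ r′

        open Zorn 𝒢 chain

        module Max {R : Sub} (s : IsSquare R) where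
          open Square s

          D : Set a
          D = ∃[ x ] truth (Dom x) ≡ true

          D≡ : {u v : D} → proj₁ u ≡ proj₁ v → u ≡ v
          D≡ {x , _} refl = cong (x ,_) (uip _ _)

          D↣X : D ↣ X
          D↣X = mk↣ proj₁ D≡

          sq : D × D → D
          sq ((_ , p) , (_ , q)) = let (z , r) = total (truth-elim p) (truth-elim q) in
            z , truth-intro (proj₂ (proj₂ (closed r)))

          opaque
            D×D↣D : D × D ↣ D
            D×D↣D = mk↣ sq inj′
              where
              inj′ : ∀ {u v} → sq u ≡ sq v → u ≡ v
              inj′ {(x , p) , (y , q)} {(x′ , p′) , (y′ , q′)} e = cong₂ _,_ (D≡ (cong proj₁ e′)) (D≡ (cong proj₂ e′))
                where
                e′ : (x , y) ≡ (x′ , y′)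
                e′ = inj (proj₂ (total (truth-elim p) (truth-elim q)))
                         (subst (λ z → R ((x′ , y′) , z) ≡ true) (sym (cong proj₁ e))
                                (proj₂ (total (truth-elim p′) (truth-elim q′))))

          d : ℕ → D
          d i = to ι i , truth-intro (base i)

          opaque
            D⊎D↣D : D ⊎ D ↣ D
            D⊎D↣D = D×D↣D ⊙ ⊎↣× {x₀ = d 0} {d 1} (λ e → case (injective ι (cong proj₁ e)))
              where
              case : ¬ (0 ≡ 1)
              case ()

          Co : Set a
          Co = ∃[ x ] truth (¬ Dom x) ≡ true

          Co≡ : {u v : Co} → proj₁ u ≡ proj₁ v → u ≡ v
          Co≡ {x , _} refl = cong (x ,_) (uip _ _)

          X↣D⊎Co : X ↣ D ⊎ Co
          X↣D⊎Co = mk↣ h inj′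
            where
            h : X → D ⊎ Co
            h x with em {P = Dom x}
            ... | yes p = inj₁ (x , truth-intro p)
            ... | no ¬p = inj₂ (x , truth-intro ¬p)
            back : D ⊎ Co → X
            back (inj₁ u) = proj₁ u
            back (inj₂ u) = proj₁ u
            back-h : ∀ x → back (h x) ≡ x
            back-h x with em {P = Dom x}
            ... | yes p = refl
            ... | no ¬p = refl
            inj′ : ∀ {x y} → h x ≡ h y → x ≡ y
            inj′ {x} {y} e = trans (sym (back-h x)) (trans (cong back e) (back-h y))

          -- If the complement of `D` contains a copy of `D`, the operation extends to the union of
          -- both: a pair outside `D × D` is coded in `D × D` through `E ↣ D ⊎ D ↣ D`, and its value
          -- is put into the copy, away from all old values.
          module Enlarge (g : D ↣ Co) where
            E : X → Set a
            E x = Dom x ⊎ ∃[ u ] proj₁ (to g u) ≡ x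

            g₁-inj : ∀ {u v} → proj₁ (to g u) ≡ proj₁ (to g v) → u ≡ v
            g₁-inj = injective g ∘ Co≡

            g∉ : ∀ u → ¬ Dom (proj₁ (to g u))
            g∉ u = truth-elim (proj₂ (to g u))

            φ′ : X → D ⊎ D
            φ′ x with em {P = Dom x}
            ... | yes p = inj₁ (x , truth-intro p)
            ... | no  _ with em {P = ∃[ u ] proj₁ (to g u) ≡ x}
            ...   | yes (u , _) = inj₂ u
            ...   | no  _       = inj₁ (d 0)

            back : D ⊎ D → X
            back (inj₁ u) = proj₁ u
            back (inj₂ u) = proj₁ (to g u)

            back-φ′ : ∀ x → E x → back (φ′ x) ≡ x
            back-φ′ x e with em {P = Dom x}
            ... | yes p = refl
            ... | no ¬p with em {P = ∃[ u ] proj₁ (to g u) ≡ x}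
            ...   | yes (u , q) = q
            back-φ′ x (inj₁ p) | no ¬p | no ¬q = ⊥-elim (¬p p)
            back-φ′ x (inj₂ q) | no ¬p | no ¬q = ⊥-elim (¬q q)

            φ : X → D
            φ = to D⊎D↣D ∘ φ′

            φ-inj : ∀ {x y} → E x → E y → φ x ≡ φ y → x ≡ y
            φ-inj {x} {y} p q e =
              trans (sym (back-φ′ x p)) (trans (cong back (injective D⊎D↣D e)) (back-φ′ y q))

            h : X × X → X
            h (x , y) = proj₁ (to g (to D×D↣D (φ x , φ y)))

            P′ : U → Set a
            P′ ((x , y) , z) = R ((x , y) , z) ≡ true ⊎ (¬ (Dom x × Dom y) × E x × E y × z ≡ h (x , y))

            dom : ∀ {x} → E x → ∃[ z ] P′ ((x , x) , z)
            dom {x} e with em {P = Dom x}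
            ... | yes (z , p) = z , inj₁ p
            ... | no ¬p = _ , inj₂ (¬p ∘ proj₁ , e , e , refl)

            undom : ∀ {x} → ∃[ z ] P′ ((x , x) , z) → E x
            undom (z , inj₁ r) = inj₁ (z , r)
            undom (z , inj₂ (_ , e , _)) = e

            square′ : Square P′
            square′ = record { fun = fun′ ; inj = inj′ ; closed = closed′ ; total = total′ ; base = λ i → dom (inj₁ (base i)) }
              where
              fun′ : ∀ {p z z′} → P′ (p , z) → P′ (p , z′) → z ≡ z′
              fun′ (inj₁ r) (inj₁ r′) = fun r r′
              fun′ (inj₁ r) (inj₂ (n , _)) = let (x , y , _) = closed r in ⊥-elim (n (x , y))
              fun′ (inj₂ (n , _)) (inj₁ r) = let (x , y , _) = closed r in ⊥-elim (n (x , y))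
              fun′ (inj₂ (_ , _ , _ , e)) (inj₂ (_ , _ , _ , e′)) = trans e (sym e′)
              inj′ : ∀ {p p′ z} → P′ (p , z) → P′ (p′ , z) → p ≡ p′
              inj′ (inj₁ r) (inj₁ r′) = inj r r′
              inj′ (inj₁ r) (inj₂ (_ , _ , _ , refl)) = ⊥-elim (g∉ _ (proj₂ (proj₂ (closed r))))
              inj′ (inj₂ (_ , _ , _ , refl)) (inj₁ r) = ⊥-elim (g∉ _ (proj₂ (proj₂ (closed r))))
              inj′ {x , y} {x′ , y′} (inj₂ (_ , ex , ey , e)) (inj₂ (_ , ex′ , ey′ , e′)) =
                cong₂ _,_ (φ-inj ex ex′ (cong proj₁ q)) (φ-inj ey ey′ (cong proj₂ q))
                where
                q : (φ x , φ y) ≡ (φ x′ , φ y′)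
                q = injective D×D↣D (g₁-inj (trans (sym e) e′))
              closed′ : ∀ {x y z} → P′ ((x , y) , z) → _
              closed′ (inj₁ r) = let (x , y , z) = closed r in dom (inj₁ x) , dom (inj₁ y) , dom (inj₁ z)
              closed′ (inj₂ (_ , ex , ey , refl)) = dom ex , dom ey , dom (inj₂ (_ , refl))
              total′ : ∀ {x y} → ∃[ z ] P′ ((x , x) , z) → ∃[ z ] P′ ((y , y) , z) → ∃[ z ] P′ ((x , y) , z)
              total′ {x} {y} p q with em {P = Dom x × Dom y}
              ... | yes (u , v) = let (z , r) = total u v in z , inj₁ r
              ... | no n        = _ , inj₂ (n , undom p , undom q , refl)

            bigger : Bigger R
            bigger = (λ u → truth (P′ u)) , inj₂ (truth-Square square′) , (λ _ r → truth-intro (inj₁ r)) ,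
              λ le → let x  = proj₁ (to g (d 0))
                         (z , r) = dom {x} (inj₂ (_ , refl)) in g∉ _ (z , le _ (truth-intro r))

      opaque
       infinite-square : X × X ↣ X
       infinite-square with maximal
       ... | R , inj₁ e , max = ⊥-elim (max
         ((λ u → truth (P₀ u)) , inj₂ (truth-Square square₀) , (λ u r → ⊥-elim (e u r)) ,
          λ le → e _ (le _ (truth-intro (proj₂ (Square.base square₀ 0))))))
       ... | R , inj₂ s , max with compare (Max.Co s) (Max.D s)
       ...   | inj₂ g = ⊥-elim (max (Max.Enlarge.bigger s g))
       ...   | inj₁ k = D↣X ⊙ D×D↣D ⊙ ×-↣ X↣D X↣D
         where
         open Max s
         X↣D : X ↣ D
         X↣D = D⊎D↣D ⊙ ⊎-↣ ≲-refl k ⊙ X↣D⊎Co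

    infinite-⊎ : ∀ {a} {X : Set a} → ℕ ↣ X → X ⊎ X ↣ X
    infinite-⊎ ι = infinite-square ι ⊙ ⊎↣× {x₀ = to ι 0} {to ι 1} (λ e → case (injective ι e))
      where
      case : ¬ (0 ≡ 1)
      case ()

    opaque
     infinite-list : ∀ {a} {X : Set a} → ℕ ↣ X → List X ↣ X
     infinite-list {X = X} ι = mk↣ enc enc-inj
       where
       sq : X × X ↣ X
       sq = infinite-square ι
       φ : ⊤ ⊎ (X × X) ↣ X
       φ = infinite-⊎ ι ⊙ ⊎-↣ (mk↣ (λ _ → to ι 0) (λ _ → refl)) sq
       enc : List X → X
       enc []       = to φ (inj₁ tt)
       enc (x ∷ xs) = to φ (inj₂ (x , enc xs))
       enc-inj : ∀ {xs ys} → enc xs ≡ enc ys → xs ≡ ys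
       enc-inj {[]}     {[]}     e = refl
       enc-inj {[]}     {y ∷ ys} e with injective φ {inj₁ tt} {inj₂ (y , enc ys)} e
       ... | ()
       enc-inj {x ∷ xs} {[]}     e with injective φ {inj₂ (x , enc xs)} {inj₁ tt} e
       ... | ()
       enc-inj {x ∷ xs} {y ∷ ys} e = cong₂ _∷_ (cong proj₁ e′) (enc-inj (cong proj₂ e′))
         where
         e′ : (x , enc xs) ≡ (y , enc ys)
         e′ = inj₂-injective (injective φ {inj₂ (x , enc xs)} {inj₂ (y , enc ys)} e)

    List-↣ : ∀ {a b} {X : Set a} {Y : Set b} → X ↣ Y → List X ↣ List Y
    List-↣ {X = X} {Y} f = mk↣ (map (to f)) inj
      where
      inj : ∀ {xs ys} → map (to f) xs ≡ map (to f) ys → xs ≡ ys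
      inj {[]}     {[]}     e = refl
      inj {x ∷ xs} {y ∷ ys} e = cong₂ _∷_ (injective f (∷-injectiveˡ e)) (inj (∷-injectiveʳ e))

    module Small {a b} (κ : Setoid a b) (ℕ≺κ : setoid ℕ ≺ κ) where

      opaque
        small-≲ : ∀ {c d e f} {S : Setoid c d} {T : Setoid e f} → S ≲ T → T ≺ κ → S ≺ κ
        small-≲ f (g , h) = g ⊙ f , λ k → h (f ⊙ k)

        private
          ι : ℕ ↣ Reps κ
          ι = toReps κ ⊙ proj₁ ℕ≺κ

        -- Strictness is the point: an embedding of `κ` into `X ⊎ ℕ` would give one into the larger
        -- of `X` and `ℕ`.
        small-+ℕ : ∀ {c} {X : Set c} → setoid X ≺ κ → setoid (X ⊎ ℕ) ≺ κ
        small-+ℕ {X = X} (f , h) = fromReps κ ⊙ infinite-⊎ ι ⊙ ⊎-↣ (toReps κ ⊙ f) ι , λ k → big k (compare X ℕ)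
          where
          big : κ ≲ setoid (X ⊎ ℕ) → ¬ ((X ↣ ℕ) ⊎ (ℕ ↣ X))
          big k (inj₁ g) = proj₂ ℕ≺κ (infinite-⊎ ≲-refl ⊙ ⊎-↣ g ≲-refl ⊙ k)
          big k (inj₂ g) = h (infinite-⊎ g ⊙ ⊎-↣ ≲-refl g ⊙ k)

        private
          inj₂↣ : ∀ {c} {X : Set c} → ℕ ↣ X ⊎ ℕ
          inj₂↣ = mk↣ inj₂ (λ { refl → refl })

          inj₁↣ : ∀ {c} {X : Set c} → X ↣ X ⊎ ℕ
          inj₁↣ = mk↣ inj₁ (λ { refl → refl })

        small-× : ∀ {c d} {X : Set c} {Y : Set d} → setoid X ≺ κ → setoid Y ≺ κ → setoid (X × Y) ≺ κ
        small-× {X = X} {Y} p q with compare X Y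
        ... | inj₁ f = small-≲ (infinite-square inj₂↣ ⊙ ×-↣ (inj₁↣ ⊙ f) inj₁↣) (small-+ℕ q)
        ... | inj₂ f = small-≲ (infinite-square inj₂↣ ⊙ ×-↣ inj₁↣ (inj₁↣ ⊙ f)) (small-+ℕ p)

        small-⊎ : ∀ {c d} {X : Set c} {Y : Set d} → setoid X ≺ κ → setoid Y ≺ κ → setoid (X ⊎ Y) ≺ κ
        small-⊎ {X = X} {Y} p q with compare X Y
        ... | inj₁ f = small-≲ (infinite-⊎ inj₂↣ ⊙ ⊎-↣ (inj₁↣ ⊙ f) inj₁↣) (small-+ℕ q)
        ... | inj₂ f = small-≲ (infinite-⊎ inj₂↣ ⊙ ⊎-↣ inj₁↣ (inj₁↣ ⊙ f)) (small-+ℕ p)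

        small-List : ∀ {c} {X : Set c} → setoid X ≺ κ → setoid (List X) ≺ κ
        small-List p = small-≲ (infinite-list inj₂↣ ⊙ List-↣ inj₁↣) (small-+ℕ p)

    -- `F` need not be constant on classes: it is evaluated at chosen representatives, so separating
    -- the classes is enough.
    invariant-≲ : ∀ {a b c} {S : Setoid a b} {Z : Set c} (F : Setoid.Carrier S → Z) →
                  (∀ {x y} → F x ≡ F y → Setoid._≈_ S x y) → S ≲ setoid Z
    invariant-≲ {S = S} F h = mk↣ F′ inj ⊙ toReps S
      where
      F′ : Reps S → _
      F′ = F ∘ proj₁
      inj : ∀ {u v} → F′ u ≡ F′ v → u ≡ v
      inj {u} {v} e = trans (sym (retract u)) (trans (Injection.cong (toReps S) (h e)) (retract v))
        where
        retract : ∀ w → to (toReps S) (proj₁ w) ≡ w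
        retract w = injective (fromReps S) (S.sym (rep-≈ S (proj₁ w)))
          where module S = Setoid S

    ⊎ₛ-≲ : ∀ {a b c} {S : Setoid a b} {X : Set c} → S ≲ setoid X → (S ⊎ₛ setoid ℕ) ≲ setoid (X ⊎ ℕ)
    ⊎ₛ-≲ {S = S} {X} f = record { to = h ; cong = h-cong ; injective = h-inj }
      where
      h : Setoid.Carrier (S ⊎ₛ setoid ℕ) → X ⊎ ℕ
      h (inj₁ x) = inj₁ (to f x)
      h (inj₂ n) = inj₂ n
      h-cong : ∀ {u v} → Setoid._≈_ (S ⊎ₛ setoid ℕ) u v → h u ≡ h v
      h-cong (inj₁ p) = cong inj₁ (Injection.cong f p)
      h-cong (inj₂ p) = cong inj₂ p
      h-inj : ∀ {u v} → h u ≡ h v → Setoid._≈_ (S ⊎ₛ setoid ℕ) u v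
      h-inj {inj₁ _} {inj₁ _} e = inj₁ (injective f (inj₁-injective e))
      h-inj {inj₂ _} {inj₂ _} refl = inj₂ refl

    module _ {ℓ} {S : Setoid ℓ ℓ} where
      private module S = Setoid S

      cover-≲ : ∀ {c} {Z : Set c} (X : Subset S) (f : Z → S.Carrier) → (∀ {x} → x ∈ X → ∃[ z ] f z S.≈ x) →
                ⟪ X ⟫ ≲ setoid Z
      cover-≲ {Z = Z} X f cov = record
        { to        = λ (x , p) → proj₁ (pick p)
        ; cong      = λ {u} {v} p → choose-irr (preimage (proj₂ u)) (preimage (proj₂ v))
                        (fe λ z → truth-cong (λ q → S.trans q p) (λ q → S.trans q (S.sym p)))
        ; injective = λ {u} {v} e → S.trans (S.sym (truth-elim (proj₂ (pick (proj₂ u)))))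
                        (S.trans (S.reflexive (cong f e)) (truth-elim (proj₂ (pick (proj₂ v)))))
        }
        where
        preimage : ∀ {x} → x ∈ X → ∃[ z ] truth (f z S.≈ x) ≡ true
        preimage p = let (z , e) = cov p in z , truth-intro e
        pick : ∀ {x} → x ∈ X → ∃[ z ] truth (f z S.≈ x) ≡ true
        pick p = choose _ (preimage p)

      reps-cover : ∀ (X : Subset S) {x} → x ∈ X → ∃[ z ] proj₁ {B = Subset.member X} (proj₁ {B = λ u → rep ⟪ X ⟫ u ≡ u} z) S.≈ x
      reps-cover X p = to (toReps ⟪ X ⟫) (_ , p) , S.sym (rep-≈ ⟪ X ⟫ (_ , p))

      ∪-≲ : ∀ (X Y : Subset S) → ⟪ X ∪ Y ⟫ ≲ setoid (Reps ⟪ X ⟫ ⊎ Reps ⟪ Y ⟫)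
      ∪-≲ X Y = cover-≲ (X ∪ Y) el cov
        where
        el : Reps ⟪ X ⟫ ⊎ Reps ⟪ Y ⟫ → S.Carrier
        el (inj₁ z) = proj₁ (proj₁ z)
        el (inj₂ z) = proj₁ (proj₁ z)
        cov : ∀ {x} → x ∈ (X ∪ Y) → ∃[ z ] el z S.≈ x
        cov (inj₁ p) = let (z , e) = reps-cover X p in inj₁ z , e
        cov (inj₂ p) = let (z , e) = reps-cover Y p in inj₂ z , e

    nth : ∀ {a} {X : Set a} → X → List X → ℕ → X
    nth d []       _       = d
    nth d (x ∷ xs) zero    = x
    nth d (x ∷ xs) (suc n) = nth d xs n

    nth-tabulate : ∀ {a} {X : Set a} (d : X) {n} (f : Vector X n) i → nth d (tabulate f) (toℕ i) ≡ f i
    nth-tabulate d f zero    = refl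
    nth-tabulate d f (suc i) = nth-tabulate d (f ∘ suc) i

    tabulate↣ : ∀ {a} {X : Set a} n → Vector X n ↣ List X
    tabulate↣ {X = X} n = mk↣ tabulate (λ e → fe (inj e))
      where
      inj : ∀ {n} {f g : Vector X n} → tabulate f ≡ tabulate g → ∀ i → f i ≡ g i
      inj {f = f} {g} e i =
        trans (sym (nth-tabulate (f i) f i)) (trans (cong (λ xs → nth (f i) xs (toℕ i)) e) (nth-tabulate (f i) g i))

  open Cardinals

  -- Countable models, chains and homogeneity

  module Models {ℓ : Level} {L : Language ℓ} (𝒦 : AEC L) (ls : AEC.LöwenheimSkolem 𝒦 (setoid ℕ))
                (N : Structure L) (N∈K : AEC.K 𝒦 N) (κ : Setoid ℓ ℓ) (ℕ≺κ : setoid ℕ ≺ κ) where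
    open Tuples N
    open AEC 𝒦
    open Structure N
    open Small κ ℕ≺κ
    open Injection using () renaming (to to ⟨_⟩; injective to ⟨⟩-injective)

    Countable⊂ : Subset dom → Set ℓ
    Countable⊂ X = Countable ⟪ X ⟫

    opaque
      countable-∪ : ∀ {X Y} → Countable⊂ X → Countable⊂ Y → Countable⊂ (X ∪ Y)
      countable-∪ {X} {Y} f g = infinite-⊎ ≲-refl ⊙ ⊎-↣ (f ⊙ fromReps ⟪ X ⟫) (g ⊙ fromReps ⟪ Y ⟫) ⊙ ∪-≲ X Y

      bounded-∪ : ∀ {X Y : Subset dom} → ⟪ X ⟫ ≺ κ → ⟪ Y ⟫ ≺ κ → ⟪ X ∪ Y ⟫ ≺ κ
      bounded-∪ {X} {Y} p q =
        small-≲ (∪-≲ X Y) (small-⊎ (small-≲ (fromReps ⟪ X ⟫) p) (small-≲ (fromReps ⟪ Y ⟫) q))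

      countable-range : ∀ {n} (x : Tup n) → Countable⊂ (range x)
      countable-range x = mk↣ toℕ toℕ-injective ⊙ cover-≲ (range x) x id

      bounded-range : ∀ {n} (x : Tup n) → ⟪ range {S = dom} x ⟫ ≺ κ
      bounded-range x = small-≲ (countable-range x) ℕ≺κ

    ⋃ℕ : (ℕ → Subset dom) → Subset dom
    ⋃ℕ X = ⋃ {I = Lift ℓ ℕ} (X ∘ lower)

    opaque
      countable-⋃ : ∀ {X : ℕ → Subset dom} → (∀ i → Countable⊂ (X i)) → Countable⊂ (⋃ℕ X)
      countable-⋃ {X} f = ℕ×ℕ↣ℕ ⊙ mk↣ h h-inj ⊙ cover-≲ (⋃ℕ X) el cov
        where
        Z : Set ℓ
        Z = Σ[ i ∈ ℕ ] Reps ⟪ X i ⟫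
        el : Z → Carrier
        el (i , z) = proj₁ (proj₁ z)
        cov : ∀ {x} → x ∈ ⋃ℕ X → ∃[ z ] el z ≈ x
        cov (lift i , p) = let (z , e) = reps-cover (X i) p in (i , z) , e
        code : ∀ i → Reps ⟪ X i ⟫ ↣ ℕ
        code i = f i ⊙ fromReps ⟪ X i ⟫
        h : Z → ℕ × ℕ
        h (i , z) = i , ⟨ code i ⟩ z
        h-inj : ∀ {u v} → h u ≡ h v → u ≡ v
        h-inj {i , z} {j , w} e with ≡.cong proj₁ e
        ... | ≡.refl = ≡.cong (i ,_) (⟨⟩-injective (code i) (≡.cong proj₂ e))

    module _ {A : Structure L} (f : Embedding A N) (f-strong : Strong f) where
      private
        module A = Structure A
        module f = Embedding f
        Y : Subset dom
        Y = image f.to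
        Y-closed : Closed N Y
        Y-closed h xs p = A.fun h (proj₁ ∘ p) , trans (f.fun-hom h (proj₁ ∘ p)) (fun-cong h (proj₂ ∘ p))
        k : Embedding A (substructure N Y Y-closed)
        k = record
          { to        = λ x → f.to x , x , refl
          ; cong      = f.cong
          ; injective = f.injective
          ; rel-⇔     = f.rel-⇔
          ; fun-hom   = f.fun-hom
          }
        k⁻¹ : Embedding (substructure N Y Y-closed) A
        k⁻¹ = record
          { to        = λ (y , x , _) → x
          ; cong      = λ { {_ , _ , p} {_ , _ , q} e → f.injective (trans p (trans e (sym q))) }
          ; injective = λ { {_ , _ , p} {_ , _ , q} e → trans (sym p) (trans (f.cong e) q) }
          ; rel-⇔     = λ R xs → mk⇔
              (λ r → Equivalence.from (f.rel-⇔ R _) (rel-resp R (λ i → sym (proj₂ (proj₂ (xs i)))) r))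
              (λ r → rel-resp R (λ i → proj₂ (proj₂ (xs i))) (Equivalence.to (f.rel-⇔ R _) r))
          ; fun-hom   = λ h xs → A.refl
          }

      opaque
        -- The inclusion of the image is `f` after the inverse of an isomorphism, and isomorphisms
        -- are strong.
        image-isModel : IsModel 𝒦 N Y
        image-isModel = record
          { closed = Y-closed
          ; strong = strong-resp (λ (_ , _ , p) → p)
              (∘-closed f-strong (proj₂ (iso-closed k⁻¹ (λ x → (f.to x , x , refl) , A.refl)
                (proj₁ (iso-closed k (λ (y , x , p) → x , p) (proj₁ (strong⇒K f-strong)))))))
          }

    aut-strong : ∀ (g : Aut) → Strong (Automorphism.embedding g)
    aut-strong g = proj₂ (iso-closed _ (Automorphism.onto g) N∈K)

    corestrict : ∀ {A : Structure L} (f : Embedding A N) → Strong f → ∀ {Y} (q : IsModel 𝒦 N Y) → (∀ x → Embedding.to f x ∈ Y) →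
      Σ[ e ∈ Embedding A (substructure N Y (IsModel.closed q)) ] Strong e × (∀ x → proj₁ (Embedding.to e x) ≡ Embedding.to f x)
    corestrict f f-strong q h = e , coherence (IsModel.strong q) (strong-resp (λ _ → refl) f-strong) , λ _ → ≡.refl
      where
      e : Embedding _ _
      e = record
        { to        = λ x → Embedding.to f x , h x
        ; cong      = Embedding.cong f
        ; injective = Embedding.injective f
        ; rel-⇔     = Embedding.rel-⇔ f
        ; fun-hom   = Embedding.fun-hom f
        }

    record CModel : Set (lsuc ℓ) where
      field
        set       : Subset dom
        isModel   : IsModel 𝒦 N set
        countable : Countable⊂ set
      model : Model 𝒦 N κ
      model = record { set = set ; isModel = isModel ; bounded = small-≲ countable ℕ≺κ }
    open CModel public

    infix 4 _⊑ᵐ_ _⊆ᵐ_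
    _⊑ᵐ_ : ∀ {n} → Tup n → CModel → Set ℓ
    x ⊑ᵐ 𝒟 = x ⊑ set 𝒟

    _⊆ᵐ_ : CModel → CModel → Set ℓ
    𝒟 ⊆ᵐ ℰ = set 𝒟 ⊆ set ℰ

    opaque
      cmodel : ∀ (X : Subset dom) → Countable⊂ X → Σ[ 𝒟 ∈ CModel ] X ⊆ set 𝒟
      cmodel X c = let (Y , closed , X⊆Y , str , le) = ls N∈K X in
        record { set = Y ; isModel = record { closed = closed ; strong = str }
               ; countable = infinite-⊎ ≲-refl ⊙ ⊎ₛ-≲ c ⊙ le } , X⊆Y

      bmodel : ∀ (X : Subset dom) → ⟪ X ⟫ ≺ κ → Σ[ 𝒟 ∈ Model 𝒦 N κ ] X ⊆ Model.set 𝒟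
      bmodel X b = let (Y , closed , X⊆Y , str , le) = ls N∈K X in
        record { set = Y ; isModel = record { closed = closed ; strong = str }
               ; bounded = small-≲ (⊎ₛ-≲ (toReps ⟪ X ⟫) ⊙ le) (small-+ℕ (small-≲ (fromReps ⟪ X ⟫) b)) } , X⊆Y

      -- Löwenheim-Skolem is applied inside `Y`, which need not be bounded; the substructure of a
      -- substructure so obtained is then read as an image in `N`.
      cmodel-in : ∀ {Y} → IsModel 𝒦 N Y → ∀ X → Countable⊂ X → X ⊆ Y → Σ[ 𝒟 ∈ CModel ] X ⊆ set 𝒟 × set 𝒟 ⊆ Y
      cmodel-in {Y} m X c X⊆Y with ls (proj₁ (strong⇒K (IsModel.strong m)))
          (record { member = λ (x , _) → x ∈ X ; resp = λ e → Subset.resp X e })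
      ... | Z , closed , X⊆Z , str , le = record
        { set       = image f
        ; isModel   = image-isModel (inclusion N Y (IsModel.closed m) ∘ₑ inclusion _ Z closed) (∘-closed (IsModel.strong m) str)
        ; countable = infinite-⊎ ≲-refl ⊙ ⊎ₛ-≲ (c ⊙ X₀≲) ⊙ le ⊙ Y≲
        } , (λ {x} p → ((x , X⊆Y p) , X⊆Z p) , refl) , λ { (((x , q) , _) , e) → Subset.resp Y e q }
        where
        X₀ : Subset ⟪ Y ⟫
        X₀ = record { member = λ (x , _) → x ∈ X ; resp = λ e → Subset.resp X e }
        f : Setoid.Carrier ⟪ Z ⟫ → Carrier
        f u = proj₁ (proj₁ u)
        X₀≲ : ⟪ X₀ ⟫ ≲ ⟪ X ⟫
        X₀≲ = record { to = λ ((x , _) , p) → x , p ; cong = id ; injective = id }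
        Y≲ : ⟪ image {S = dom} f ⟫ ≲ ⟪ Z ⟫
        Y≲ = record
          { to        = λ (_ , z , _) → z
          ; cong      = λ { {_ , _ , p} {_ , _ , q} e → trans p (trans e (sym q)) }
          ; injective = λ { {_ , _ , p} {_ , _ , q} e → trans (sym p) (trans e q) }
          }

    aut-image : Aut → Subset dom → Subset dom
    aut-image g X = image {I = ∃ (_∈ X)} (λ (x , _) → g · x)

    aut-image-isModel : ∀ g {X} → IsModel 𝒦 N X → IsModel 𝒦 N (aut-image g X)
    aut-image-isModel g {X} m =
      image-isModel (Automorphism.embedding g ∘ₑ inclusion N X (IsModel.closed m)) (∘-closed (aut-strong g) (IsModel.strong m))

    aut-image-≲ : ∀ g X → ⟪ aut-image g X ⟫ ≲ ⟪ X ⟫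
    aut-image-≲ g X = record
      { to        = λ (_ , x , _) → x
      ; cong      = λ { {_ , _ , p} {_ , _ , q} e → Automorphism.injective g (trans p (trans e (sym q))) }
      ; injective = λ { {_ , _ , p} {_ , _ , q} e → trans (sym p) (trans (·-cong g e) q) }
      }

    infixr 10 _·ᵐ_
    _·ᵐ_ : Aut → CModel → CModel
    g ·ᵐ 𝒟 = record
      { set = aut-image g (set 𝒟) ; isModel = aut-image-isModel g (isModel 𝒟)
      ; countable = countable 𝒟 ⊙ aut-image-≲ g (set 𝒟) }

    ∈-·ᵐ : ∀ g 𝒟 {x} → x ∈ set 𝒟 → g · x ∈ set (g ·ᵐ 𝒟)
    ∈-·ᵐ g 𝒟 p = (_ , p) , refl

    ∈-·ᵐ⁻ : ∀ g 𝒟 {x} → x ∈ set (g ·ᵐ 𝒟) → inv g · x ∈ set 𝒟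
    ∈-·ᵐ⁻ g 𝒟 ((x , p) , e) = Subset.resp (set 𝒟) (sym (inv-· g e)) p

    private
      _<ˡ_ : Rel (Lift ℓ ℕ) ℓ
      i <ˡ j = Lift ℓ (lower i ℕ.< lower j)

      <ˡ-order : IsStrictTotalOrder _≡_ _<ˡ_
      <ˡ-order = record
        { isStrictPartialOrder = record
          { isEquivalence = ≡.isEquivalence
          ; irrefl   = λ { ≡.refl (lift p) → ℕ.<-irrefl ≡.refl p }
          ; trans    = λ (lift p) (lift q) → lift (ℕ.<-trans p q)
          ; <-resp-≈ = (λ { ≡.refl p → p }) , (λ { ≡.refl p → p })
          }
        ; compare = cmp
        }
        where
        cmp : ∀ i j → Tri (i <ˡ j) (i ≡ j) (j <ˡ i)
        cmp (lift i) (lift j) with ℕ.<-cmp i j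
        ... | tri< a b c = tri< (lift a) (λ { ≡.refl → b ≡.refl }) (c ∘ lower)
        ... | tri≈ a b c = tri≈ (a ∘ lower) (≡.cong lift b) (c ∘ lower)
        ... | tri> a b c = tri> (a ∘ lower) (λ { ≡.refl → b ≡.refl }) (lift c)

      <ˡ-wf : WellFounded _<ˡ_
      <ˡ-wf (lift i) = go (<-wellFounded i)
        where
        go : ∀ {i} → Acc ℕ._<_ i → Acc _<ˡ_ (lift i)
        go (acc r) = acc λ (lift p) → go (r p)

    module Chain (𝒟 : ℕ → CModel) (inc : ∀ i → 𝒟 i ⊆ᵐ 𝒟 (suc i)) where

      mono : ∀ {i j} → i ℕ.≤ j → 𝒟 i ⊆ᵐ 𝒟 j
      mono {i} i≤j = go (ℕ.≤⇒≤′ i≤j)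
        where
        go : ∀ {j} → i ℕ.≤′ j → 𝒟 i ⊆ᵐ 𝒟 j
        go (ℕ.≤′-reflexive ≡.refl) p = p
        go (ℕ.≤′-step q)           p = inc _ (go q p)

      common : ∀ {n} {x : Tup n} → x ⊑ ⋃ℕ (set ∘ 𝒟) → ∃[ i ] x ⊑ᵐ 𝒟 i
      common {zero}      p = 0 , λ ()
      common {suc n} {x} p with p zero | common {x = x ∘ suc} (p ∘ suc)
      ... | lift i , q | j , r = i ℕ.⊔ j , λ
        { zero    → mono (ℕ.m≤m⊔n i j) q
        ; (suc k) → mono (ℕ.m≤n⊔m i j) (r k) }

      private
        ω : Subset dom
        ω = ⋃ℕ (set ∘ 𝒟)

        ω-closed : Closed N ω
        ω-closed f xs p = let (i , q) = common p in lift i , IsModel.closed (isModel (𝒟 i)) f xs q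

        A : Lift ℓ ℕ → Structure L
        A i = substructure N (set (𝒟 (lower i))) (IsModel.closed (isModel (𝒟 (lower i))))

        e : ∀ {i j} (p : i <ˡ j) → Σ[ e ∈ Embedding (A i) (A j) ] Strong e × (∀ x → proj₁ (Embedding.to e x) ≡ proj₁ x)
        e {i} {j} p = corestrict (inclusion N (set (𝒟 (lower i))) (IsModel.closed (isModel (𝒟 (lower i))))) (IsModel.strong (isModel (𝒟 (lower i))))
                      (isModel (𝒟 (lower j))) (λ (_ , q) → mono (ℕ.<⇒≤ (lower p)) q)

        u : ∀ i → Embedding (A i) (substructure N ω ω-closed)
        u i = record
          { to        = λ (x , p) → x , i , p
          ; cong      = id
          ; injective = id
          ; rel-⇔     = λ R xs → mk⇔ id id
          ; fun-hom   = λ h xs → refl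
          }

      limit : CModel
      limit = record
        { set       = ω
        ; isModel   = record
          { closed = ω-closed
          -- The last clause of `union`: the inclusion of the union into `N` is strong because it is
          -- so on every member of the chain.
          ; strong = proj₂ (proj₂ (union <ˡ-order <ˡ-wf (lift 0) A (proj₁ ∘ e) (proj₁ ∘ proj₂ ∘ e)
              (λ i → proj₁ (strong⇒K (IsModel.strong (isModel (𝒟 (lower i))))))
              (substructure N ω ω-closed) u (λ p x → reflexive (proj₂ (proj₂ (e p)) x))
              (λ (y , i , p) → i , (y , p) , refl)))
              (inclusion N ω ω-closed)
              (λ i → strong-resp (λ _ → refl) (IsModel.strong (isModel (𝒟 (lower i)))))
          }
        ; countable = countable-⋃ {set ∘ 𝒟} (countable ∘ 𝒟)
        }

      ⊆-limit : ∀ i → 𝒟 i ⊆ᵐ limit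
      ⊆-limit i p = lift i , p

    module Homogeneous (homogeneous : ModelHomogeneous 𝒦 N κ) where

      extend-strong : (𝒟 : Model 𝒦 N κ) (f : Embedding (Model.structure 𝒟) N) → Strong f →
                      Σ[ g ∈ Aut ] ∀ x → g · proj₁ x ≈ Embedding.to f x
      extend-strong 𝒟 f s = homogeneous 𝒟 ℬ k (λ (y , x , p) → x , p)
        where
        ℬ : Model 𝒦 N κ
        ℬ = record
          { set     = image (Embedding.to f)
          ; isModel = image-isModel f s
          ; bounded = small-≲ (record
              { to        = λ (_ , x , _) → x
              ; cong      = λ { {_ , _ , p} {_ , _ , q} e → Embedding.injective f (trans p (trans e (sym q))) }
              ; injective = λ { {_ , _ , p} {_ , _ , q} e → trans (sym p) (trans (Embedding.cong f e) q) }
              }) (Model.bounded 𝒟)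
          }
        k : Embedding (Model.structure 𝒟) (Model.structure ℬ)
        k = record
          { to        = λ x → Embedding.to f x , x , refl
          ; cong      = Embedding.cong f
          ; injective = Embedding.injective f
          ; rel-⇔     = Embedding.rel-⇔ f
          ; fun-hom   = Embedding.fun-hom f
          }

  module _ {ℓ : Level} {L : Language ℓ} (𝒦 : AEC L) (𝕄 : Monster 𝒦) (fur : FUR 𝒦 𝕄) where
    open Monster 𝕄
    open FUR fur using (ls=ω)
    open AEC 𝒦
    open Structure M
    open Tuples M
    module δ = UncountableInaccessible δ-large
    open Models 𝒦 ls=ω M M∈K δ δ.uncountable

    -- Independence in the monster model

    module InMonster where
      open import Data.Vec.Functional using ([])
      open FUR fur hiding (ls=ω)
      open Small δ δ.uncountable
      open Types M δ hiding (Set⊂)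
      open FURNotions 𝒦 𝕄 using (Move; IIWinsIn)

      ¬splits⇒ : ∀ {n k} {c : Tup n} {s : Tup k} {D} → ¬ Splits c D (range s) → NonSplit c s D
      ¬splits⇒ {c = c} {s} {D} ¬split = nonsplit go
        where
        go : ∀ {m} (b d : Tup m) → b ⊑ D → d ⊑ D → b ∼[ s ] d → ∃[ g ] Fixes g s × Maps g b d × Fixes g c
        go b d b⊑ d⊑ p with em {P = SameType (c ++ b) (c ++ d) (range s)}
        ... | no q  = ⊥-elim (¬split (_ , b , d , b⊑ , d⊑ , ∼⇒type p , q))
        ... | yes q = let (g , u , v) = type⇒∼ q in g , u , maps-++ʳ g {c} {c} v , maps-++ˡ g v

      ⇒¬splits : ∀ {n k} {c : Tup n} {s : Tup k} {D} → NonSplit c s D → ¬ Splits c D (range s)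
      ⇒¬splits n (_ , b , d , b⊑ , d⊑ , p , q) =
        let (g , u , v , w) = ns n b d b⊑ d⊑ (type⇒∼ p) in q (∼⇒type (g , u , maps-++ g w v))

      s-saturated : ∀ (𝒟 : CModel) {n k} (b : Tup n) (s : Tup k) → s ⊑ᵐ 𝒟 → ∃[ a ] a ⊑ᵐ 𝒟 × a ∼[ s ] b
      s-saturated 𝒟 b s p = let (a , q , r) = AI (model 𝒟) (countable 𝒟) b s p in a , q , type⇒∼ r

      -- The copy of `ℬ` is given by an automorphism, so that individual tuples of `ℬ` can be
      -- followed into it.
      IndependentCopy : CModel → CModel → Subset dom → Aut → Set ℓ
      IndependentCopy 𝒟 ℬ X f =
        (∀ {x} → x ∈ set 𝒟 → f · x ≈ x) ×
        (∀ {n} (c : Tup n) → c ⊑ᵐ ℬ → ∃[ k ] Σ[ s ∈ Tup k ] s ⊑ᵐ 𝒟 × NonSplit (λ i → f · c i) s (set 𝒟 ∪ X))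

      opaque
        independent : ∀ (𝒟 ℬ : CModel) → 𝒟 ⊆ᵐ ℬ → ∀ X → Bounded X → ∃[ f ] IndependentCopy 𝒟 ℬ X f
        independent 𝒟 ℬ 𝒟⊆ℬ X X-bdd
          with bmodel (set 𝒟 ∪ X) (bounded-∪ {set 𝒟} {X} (small-≲ (countable 𝒟) δ.uncountable) X-bdd)
        ... | 𝒟′ , ⊆𝒟′ with AVI (model 𝒟) (model ℬ) 𝒟′ (λ p → 𝒟⊆ℬ p , ⊆𝒟′ (inj₁ p))
        ... | 𝒞 , (I , b , c , (b⊆ , _) , (_ , ⊆c) , same) , free = f , fix , λ x x⊑ →
          let (k , s , s⊑ , q) = free (λ i → f · x i) (λ i → into (x⊑ i))
          in k , s , s⊑ , nonsplit-⊆ {D = set 𝒟 ∪ Model.set 𝒟′} (λ p → inj₂ (⊆𝒟′ p)) (¬splits⇒ q)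
          where
          f₀ : b ∼[ [] ] c
          f₀ = galois⇒∼ (same [] λ ())
          f : Aut
          f = inv (proj₁ f₀)
          f-c : Maps f c b
          f-c = maps-inv (proj₁ f₀) (proj₂ (proj₂ f₀))
          fix : ∀ {x} → x ∈ set 𝒟 → f · x ≈ x
          -- Equality of types over `𝒟` is used at a single point: an automorphism that fixes `x`
          -- and takes `b i` to `c i`, which is `x`, forces `b i` to be `x`.
          fix {x} p with ⊆c (𝒟⊆ℬ p) | galois⇒∼ (same {1} (λ _ → x) (λ _ → p))
          ... | i , ci≈x | g , r , q =
            trans (·-cong f (sym ci≈x)) (trans (f-c i) (Automorphism.injective g (trans (q i) (trans ci≈x (sym (r zero))))))
          into : ∀ {x} → x ∈ set ℬ → f · x ∈ Model.set 𝒞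
          into p with ⊆c p
          ... | i , ci≈x = b⊆ (i , trans (sym (f-c i)) (·-cong f ci≈x))

      symmetric : ∀ (𝒟 ℬ : CModel) → 𝒟 ⊆ᵐ ℬ → ∀ {m} (x : Tup m) →
                  (∀ {n} (c : Tup n) → c ⊑ᵐ ℬ → ∃[ k ] Σ[ s ∈ Tup k ] s ⊑ᵐ 𝒟 × NonSplit c s (set 𝒟 ∪ range x)) →
                  ∃[ k ] Σ[ t ∈ Tup k ] t ⊑ᵐ 𝒟 × NonSplit x t (set ℬ)
      symmetric 𝒟 ℬ 𝒟⊆ℬ x h =
        let (k , t , t⊑ , p) = AV (model 𝒟) (model ℬ) (countable 𝒟) (countable ℬ) 𝒟⊆ℬ x
              (λ c c⊑ → let (k , s , s⊑ , q) = h c c⊑ in k , s , s⊑ , ⇒¬splits q)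
        in k , t , t⊑ , nonsplit-⊆ {D = set 𝒟 ∪ set ℬ} inj₂ (¬splits⇒ p)

      opaque
        -- By AVI some copy of `c` over `𝒟` has a finite base in `𝒟`. The copy comes from an
        -- automorphism that fixes `𝒟`, so `c` has the same base.
        local-character : ∀ {n} (c : Tup n) (𝒟 : CModel) → ∃[ k ] Σ[ s ∈ Tup k ] s ⊑ᵐ 𝒟 × NonSplit c s (set 𝒟)
        local-character c 𝒟 = go (cmodel (set 𝒟 ∪ range c) (countable-∪ {set 𝒟} {range c} (countable 𝒟) (countable-range c)))
          where
          go : Σ[ ℬ ∈ CModel ] (set 𝒟 ∪ range c) ⊆ set ℬ → ∃[ k ] Σ[ s ∈ Tup k ] s ⊑ᵐ 𝒟 × NonSplit c s (set 𝒟)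
          go (ℬ , ⊆ℬ) = let (f , fix , free) = independent 𝒟 ℬ (λ p → ⊆ℬ (inj₁ p)) (set 𝒟) (small-≲ (countable 𝒟) δ.uncountable)
                            (k , s , s⊑ , q) = free c (λ i → ⊆ℬ (inj₂ (⊑-range i)))
            in k , s , s⊑ , nonsplit-fix {D = set 𝒟} f fix s⊑ (nonsplit-⊆ {D = set 𝒟 ∪ set 𝒟} {D′ = set 𝒟} inj₁ q)

      -- Defining schemes of types

      record Scheme (k n : ℕ) : Set (lsuc ℓ) where
        field
          𝒟   : CModel
          s   : Tup k
          s⊑𝒟 : s ⊑ᵐ 𝒟
          c   : Tup n
          c-ns : NonSplit c s (set 𝒟)

        -- By nonsplitting, the type of c over 𝒟 defines a type over every set; R z x e says that e
        -- realizes over x the type so defined after s has been moved to z.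
        R : ∀ {m} → Tup k → Tup m → Tup n → Set ℓ
        R {m} z x e = Σ[ d ∈ Tup m ] d ⊑ᵐ 𝒟 × ∃[ g ] Maps g s z × Maps g d x × Maps g c e

        R-maps : ∀ {m z z′} {x x′ : Tup m} {e e′} h → Maps h z z′ → Maps h x x′ → Maps h e e′ → R z x e → R z′ x′ e′
        R-maps h p q r (d , d⊑ , g , u , v , w) = d , d⊑ , h ∘ₐ g , maps-∘ h g p u , maps-∘ h g q v , maps-∘ h g r w

        -- Both realizations are images of `c` with samples `d` and `d′` in `𝒟`. Nonsplitting of `c`
        -- identifies the samples over `s`, and this is carried to `z` and `z′`.
        R-unique : ∀ {m z z′} {x x′ : Tup m} {e e′} h → Maps h z z′ → Maps h x x′ → R z x e → R z′ x′ e′ →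
                   ∃[ h′ ] Maps h′ z z′ × Maps h′ x x′ × Maps h′ e e′
        R-unique h p q (d , d⊑ , g , u , v , w) (d′ , d′⊑ , g′ , u′ , v′ , w′)
          with ns c-ns d d′ d⊑ d′⊑ (along (inv g) h (inv g′) , maps-along (inv g) h (inv g′) (maps-inv g u) p (maps-inv g′ u′)
                                                             , maps-along (inv g) h (inv g′) (maps-inv g v) q (maps-inv g′ v′))
        ... | k , a , b , c′ = along g k g′ , maps-along g k g′ u a u′ , maps-along g k g′ v b v′ , maps-along g k g′ w c′ w′

        R-sub : ∀ {m m′ z} {x : Tup m} {x′ : Tup m′} {e} (σ : Fin m′ → Fin m) → (∀ i → x (σ i) ≈ x′ i) → R z x e → R z x′ e
        R-sub σ p (d , d⊑ , g , u , v , w) = d ∘ σ , d⊑ ∘ σ , g , u , maps-≈ʳ g p (v ∘ σ) , w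

        R-++ˡ : ∀ {m m′ z} {x : Tup m} {x′ : Tup m′} {e} → R z (x ++ x′) e → R z x e
        R-++ˡ {x = x} {x′} = R-sub (_↑ˡ _) (++-↑ˡ x x′)

        R-++ʳ : ∀ {m m′ z} {x : Tup m} {x′ : Tup m′} {e} → R z (x ++ x′) e → R z x′ e
        R-++ʳ {m = m} {x = x} {x′} = R-sub (m ↑ʳ_) (++-↑ʳ x x′)

        R-self : ∀ {m} {x : Tup m} → x ⊑ᵐ 𝒟 → R s x c
        R-self x⊑ = _ , x⊑ , idₐ , maps-id , maps-id , maps-id

        private opaque
          extend₀ : ∀ X → Bounded X → Σ[ e ∈ Tup n ] (∀ {m} (x : Tup m) → x ⊑ X → R s x e)
          extend₀ X X-bdd = go₁ (cmodel (set 𝒟 ∪ range c) (countable-∪ {set 𝒟} {range c} (countable 𝒟) (countable-range c)))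
            where
            go : ∀ f → (∀ {x} → x ∈ set 𝒟 → f · x ≈ x) → ∀ {k} (s′ : Tup k) → s′ ⊑ᵐ 𝒟 →
                 NonSplit (λ i → f · c i) s′ (set 𝒟 ∪ X) → ∀ {m} (x : Tup m) → x ⊑ X → R s x (λ i → f · c i)
            go f fix s′ s′⊑ q x x⊑ =
              -- The sample of `x` in `𝒟` is taken over `s′ ++ s`: the base `s′` of the copy need
              -- not contain `s`, which must be fixed as well.
              let (d , d⊑ , h , u , v) = s-saturated 𝒟 x (s′ ++ s) (++-⊑ {X = set 𝒟} s′⊑ s⊑𝒟)
                  (g , u′ , v′ , w′) = ns q (d ++ s) (x ++ s)
                     (++-⊑ {X = set 𝒟 ∪ X} (inj₁ ∘ d⊑) (inj₁ ∘ s⊑𝒟)) (++-⊑ {X = set 𝒟 ∪ X} (inj₂ ∘ x⊑) (inj₁ ∘ s⊑𝒟))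
                     (h , maps-++ˡ h u , maps-++ h v (maps-++ʳ h {s′} {s′} u))
              in d , d⊑ , g ∘ₐ f , maps-∘ g f (maps-++ʳ g {d} {x} v′) (λ i → fix (s⊑𝒟 i))
                 , maps-∘ g f (maps-++ˡ g v′) (λ i → fix (d⊑ i)) , maps-∘ g f w′ (maps-img f)
            go₁ : Σ[ ℬ ∈ CModel ] (set 𝒟 ∪ range c) ⊆ set ℬ → Σ[ e ∈ Tup n ] (∀ {m} (x : Tup m) → x ⊑ X → R s x e)
            go₁ (ℬ , ⊆ℬ) =
              let (f , fix , free) = independent 𝒟 ℬ (λ p → ⊆ℬ (inj₁ p)) X X-bdd
                  (k , s′ , s′⊑ , q) = free c (λ i → ⊆ℬ (inj₂ (⊑-range i)))
              in (λ i → f · c i) , go f fix s′ s′⊑ q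

        opaque
          extend : ∀ {z} g → Maps g s z → ∀ X → Bounded X → Σ[ e ∈ Tup n ] (∀ {m} (x : Tup m) → x ⊑ X → R z x e)
          extend g p X X-bdd =
            let (e , h) = extend₀ (aut-image (inv g) X) (small-≲ (aut-image-≲ (inv g) X) X-bdd)
            in (λ i → g · e i) , λ x x⊑ →
                 R-maps g p (λ i → ·-inv g (x i)) (maps-img g) (h (λ i → inv g · x i) (λ i → (_ , x⊑ i) , refl))

        opaque
          realize : ∀ {z} g → Maps g s z → ∀ {m} (x : Tup m) → ∃[ e ] R z x e
          realize g p x = let (e , h) = extend g p (range x) (bounded-range x) in e , h x ⊑-range

        -- The types defined at z and at z′ agree.
        infix 4 _≅_
        _≅_ : Tup k → Tup k → Set ℓ
        z ≅ z′ = ∀ {m} (x : Tup m) → ∃[ e ] R z x e × R z′ x e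

        ≅-sym : ∀ {z z′} → z ≅ z′ → z′ ≅ z
        ≅-sym p x = let (e , r , r′) = p x in e , r′ , r

        ≅-maps : ∀ {z z′ w w′} h → Maps h z w → Maps h z′ w′ → z ≅ z′ → w ≅ w′
        ≅-maps h p q r x with r (λ i → inv h · x i)
        ... | e , u , v = (λ i → h · e i) , R-maps h p (λ i → ·-inv h (x i)) (maps-img h) u
                                          , R-maps h q (λ i → ·-inv h (x i)) (maps-img h) v

        -- A common realization `e′` is moved to `e` by an automorphism that fixes `z′`, since `z′`
        -- is among the parameters. Agreement on some realization thus becomes agreement on all.
        ≅-transfer : ∀ {z z′} → z ≅ z′ → ∀ {m} {x : Tup m} {e} → R z (x ++ z′) e → R z′ x e
        ≅-transfer {z} {z′} p {x = x} {e} r with p (x ++ z′)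
        ... | e′ , u , v with R-unique idₐ maps-id maps-id u r
        ... | h , a , b , c′ = R-maps h (maps-++ʳ h {x} {x} b) (maps-++ˡ h b) c′ (R-++ˡ v)

        ≅-trans : ∀ {z z′ z″} → z ≅ z′ → z′ ≅ z″ → z ≅ z″
        -- Having `z″` among the parameters lets the same `e` pass from `z′` to `z″`.
        ≅-trans {z} {z′} {z″} p q x with p ((x ++ z″) ++ z′)
        ... | e , u , v = e , R-++ˡ (R-++ˡ u) , ≅-transfer q (R-++ˡ v)

      infix 4 _⊨_at_over_
      _⊨_at_over_ : ∀ {n k} → Tup n → Scheme k n → Tup k → CModel → Set ℓ
      c ⊨ S at z over 𝒟 = ∀ {m} (d : Tup m) → d ⊑ᵐ 𝒟 → Scheme.R S z d c

      module _ {n k} (S : Scheme k n) where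
        open Scheme S hiding (𝒟)

        opaque
          -- Symmetry of independence, by AV.
          realizes-over : ∀ {z} (𝒟 𝒟⁺ : CModel) → z ⊑ᵐ 𝒟 → 𝒟 ⊆ᵐ 𝒟⁺ → ∀ {c′} → c′ ⊑ᵐ 𝒟⁺ → c′ ⊨ S at z over 𝒟 →
                          ∀ {m} (x : Tup m) {l} (t : Tup l) → t ⊑ᵐ 𝒟 → NonSplit x t (set 𝒟⁺) →
                          ∀ {j} (d : Tup j) → d ⊑ᵐ 𝒟 → R z (d ++ x) c′
          realizes-over {z} 𝒟 𝒟⁺ z⊑ 𝒟⊆ {c′} c′⊑ real x t t⊑ x-ns d d⊑ = go₁ (independent 𝒟 𝒟⁺ 𝒟⊆ (range x) (bounded-range x))
            where
            zd⊑ : (z ++ d) ⊑ᵐ 𝒟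
            zd⊑ = ++-⊑ {X = set 𝒟} z⊑ d⊑

            -- The copy `f · c′` is independent of `x`, so `x` may be replaced by a sample `x₀` in
            -- `𝒟`, where the hypothesis on `c′` applies.
            over-x : ∀ f → (∀ {x} → x ∈ set 𝒟 → f · x ≈ x) → ∀ {k} (s : Tup k) → s ⊑ᵐ 𝒟 →
                     NonSplit (λ i → f · c′ i) s (set 𝒟 ∪ range x) → R z (d ++ x) (λ i → f · c′ i)
            over-x f fix s s⊑ q =
              let (x₀ , x₀⊑ , h , u , v) = s-saturated 𝒟 x (s ++ (z ++ d)) (++-⊑ {X = set 𝒟} s⊑ zd⊑)
                  (g , u′ , v′ , w′) = ns q (x₀ ++ (z ++ d)) (x ++ (z ++ d))
                    (++-⊑ {X = set 𝒟 ∪ range x} (inj₁ ∘ x₀⊑) (inj₁ ∘ zd⊑)) (++-⊑ {X = set 𝒟 ∪ range x} (inj₂ ∘ ⊑-range) (inj₁ ∘ zd⊑))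
                    (h , maps-++ˡ h u , maps-++ h v (maps-++ʳ h {s} {s} u))
                  zd = maps-++ʳ g {x₀} {x} v′
              in R-maps (g ∘ₐ f) (maps-∘ g f (maps-++ˡ g zd) (fix ∘ z⊑))
                   (maps-++ (g ∘ₐ f) (maps-∘ g f (maps-++ʳ g {z} {z} zd) (fix ∘ d⊑)) (maps-∘ g f (maps-++ˡ g v′) (fix ∘ x₀⊑)))
                   (maps-∘ g f w′ (maps-img f)) (real (d ++ x₀) (++-⊑ {X = set 𝒟} d⊑ x₀⊑))

            -- A sample `c₀` of `c′` in `𝒟` is the bridge: the type of `x` over `𝒟⁺` identifies `c₀`
            -- with `c′`, and its type over the copy of `𝒟⁺` identifies `c₀` with `f · c′`.
            back : ∀ f → (∀ {x} → x ∈ set 𝒟 → f · x ≈ x) → ∀ {k} (t′ : Tup k) → t′ ⊑ᵐ 𝒟 →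
                   NonSplit x t′ (set (f ·ᵐ 𝒟⁺)) → R z (d ++ x) (λ i → f · c′ i) → R z (d ++ x) c′
            back f fix t′ t′⊑ x-ns′ r =
              let (c₀ , c₀⊑ , h , u , v) = s-saturated 𝒟 c′ ((t ++ t′) ++ (z ++ d))
                                             (++-⊑ {X = set 𝒟} (++-⊑ {X = set 𝒟} t⊑ t′⊑) zd⊑)
                  uzd = maps-++ʳ h {t ++ t′} {t ++ t′} u
                  ut = maps-++ˡ h {t ++ t′} {t ++ t′} u
                  (g₁ , _ , v₁ , w₁) = ns x-ns (c₀ ++ (z ++ d)) (c′ ++ (z ++ d))
                    (++-⊑ {X = set 𝒟⁺} (𝒟⊆ ∘ c₀⊑) (𝒟⊆ ∘ zd⊑)) (++-⊑ {X = set 𝒟⁺} c′⊑ (𝒟⊆ ∘ zd⊑))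
                    (h , maps-++ˡ h ut , maps-++ h v uzd)
                  (g₂ , _ , v₂ , w₂) = ns x-ns′ (c₀ ++ (z ++ d)) ((λ i → f · c′ i) ++ (z ++ d))
                    (++-⊑ {X = set (f ·ᵐ 𝒟⁺)} (⊆f ∘ c₀⊑) (⊆f ∘ zd⊑))
                    (++-⊑ {X = set (f ·ᵐ 𝒟⁺)} (∈-·ᵐ f 𝒟⁺ ∘ c′⊑) (⊆f ∘ zd⊑))
                    (f ∘ₐ h , maps-∘ f h (fix ∘ t′⊑) (maps-++ʳ h {t} {t} ut)
                            , maps-++ (f ∘ₐ h) (maps-∘ f h (maps-img f) v) (maps-∘ f h (fix ∘ zd⊑) uzd))
                  zd₁ = maps-++ʳ g₁ {c₀} {c′} v₁
                  zd₂ = maps-++ʳ g₂ {c₀} {λ i → f · c′ i} v₂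
                  g = g₁ ∘ₐ inv g₂
                  zd₁₂ = maps-∘ g₁ (inv g₂) zd₁ (maps-inv g₂ zd₂)
              in R-maps g (maps-++ˡ g zd₁₂) (maps-++ g (maps-++ʳ g {z} {z} zd₁₂) (maps-∘ g₁ (inv g₂) w₁ (maps-inv g₂ w₂)))
                   (maps-∘ g₁ (inv g₂) (maps-++ˡ g₁ v₁) (maps-inv g₂ (maps-++ˡ g₂ v₂))) r
              where
              ⊆f : 𝒟 ⊆ᵐ f ·ᵐ 𝒟⁺
              ⊆f p = (_ , 𝒟⊆ p) , fix p

            go₁ : ∃[ f ] IndependentCopy 𝒟 𝒟⁺ (range x) f → R z (d ++ x) c′
            go₁ (f , fix , free) =
              let (_ , s , s⊑ , q) = free c′ c′⊑
                  (_ , t′ , t′⊑ , q′) = symmetric 𝒟 (f ·ᵐ 𝒟⁺) (λ p → (_ , 𝒟⊆ p) , fix p) x λ b b⊑ →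
                    let (k , s , s⊑ , p) = free (λ i → inv f · b i) (∈-·ᵐ⁻ f 𝒟⁺ ∘ b⊑)
                    in k , s , s⊑ , nonsplit-≈ (λ i → ·-inv f (b i)) p
              in back f fix t′ t′⊑ q′ (over-x f fix s s⊑ q)

      -- The rank of c over 𝒟 is the number of moves player II needs when
      -- starting from a suitable finite subset of 𝒟.
      RankLt : ℕ → CModel → ∀ {n} → Tup n → Set ℓ
      RankLt zero    𝒟 c = Lift ℓ ⊥
      RankLt (suc m) 𝒟 c = ∃[ k ] Σ[ s ∈ Tup k ] s ⊑ᵐ 𝒟 × IIWinsIn m (model 𝒟) c s

      range-⊆ : ∀ {k l} {s : Tup k} {t : Tup l} → s ⊑ range {S = dom} t → range {S = dom} s ⊆ range t
      range-⊆ p (i , e) = let (j , e′) = p i in j , trans e′ e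

      -- Transport of the game of (AIV), and invariance of the rank

      module _ {n k} (S : Scheme k n) {z z′ : Tup k} (𝒟 𝒟′ : CModel) (z⊑ : z ⊑ᵐ 𝒟) (z′⊑ : z′ ⊑ᵐ 𝒟′)
               {c c′ : Tup n} (real : c ⊨ S at z over 𝒟) (real′ : c′ ⊨ S at z′ over 𝒟′)
               {l} {s s′ : Tup l} (s⊑ : s ⊑ᵐ 𝒟) (s′⊑ : s′ ⊑ᵐ 𝒟′) (h : Aut) (hz : Maps h z z′) (hs : Maps h s s′)
               (μ : Move (model 𝒟′) c′ s′) where
        private
          module S = Scheme S
          module μ = Move μ

        -- The move μ played over 𝒟 instead of 𝒟′: a is the copy of the finite
        -- set chosen together with a base of the new tuple over 𝒟′.
        record Pulled : Set (lsuc ℓ) where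
          field
            {j}    : ℕ
            S₁     : Scheme j n
            z₁⊑    : Scheme.s S₁ ⊑ᵐ 𝒟′
            real₁′ : μ.a⁺ ⊨ S₁ at Scheme.s S₁ over 𝒟′
            s⁺⊑z₁  : μ.s⁺ ⊑ range {S = dom} (Scheme.s S₁)
            move   : Move (model 𝒟) c s
            a      : Tup j
            a⊑     : a ⊑ᵐ 𝒟
            g      : Aut
            ga     : Maps g a (Scheme.s S₁)
            a⊑s⁺   : a ⊑ range {S = dom} (Move.s⁺ move)
            real₁  : Move.a⁺ move ⊨ S₁ at a over 𝒟

        opaque
          -- The new tuple of the move is replaced by a realization over `𝒟` of its own scheme at a
          -- copy `a` of its base. It agrees with `c` over `s` and not over `a`, because `c` and
          -- `c′` realize the common scheme `S`.
          pull : Pulled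
          pull = go (local-character μ.a⁺ 𝒟′)
            where
            module _ {j} (b : Tup j) (b⊑ : b ⊑ᵐ 𝒟′) (a⁺-ns : NonSplit μ.a⁺ b (set 𝒟′)) where
              v : Tup (μ.k⁺ + j)
              v = μ.s⁺ ++ b
              v⊑ : v ⊑ᵐ 𝒟′
              v⊑ = ++-⊑ {X = set 𝒟′} μ.s⁺⊑𝒜 b⊑
              S₁ : Scheme (μ.k⁺ + j) n
              S₁ = record { 𝒟 = 𝒟′ ; s = v ; s⊑𝒟 = v⊑ ; c = μ.a⁺ ; c-ns = nonsplit-++ μ.s⁺⊑𝒜 a⁺-ns }
              module S₁ = Scheme S₁

              found : ∃[ a ] a ⊑ᵐ 𝒟 × a ∼[ z ++ s ] (λ i → inv h · v i)
              -- Sampling over `z ++ s` makes the later `g` carry `z` to `z′` and `s` to `s′`.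
              found = s-saturated 𝒟 (λ i → inv h · v i) (z ++ s) (++-⊑ {X = set 𝒟} z⊑ s⊑)
              a : Tup (μ.k⁺ + j)
              a = proj₁ found
              a⊑ : a ⊑ᵐ 𝒟
              a⊑ = proj₁ (proj₂ found)
              g₀ : Aut
              g₀ = proj₁ (proj₂ (proj₂ found))
              g₀-fix : Fixes g₀ (z ++ s)
              g₀-fix = proj₁ (proj₂ (proj₂ (proj₂ found)))
              g : Aut
              g = h ∘ₐ g₀
              ga : Maps g a v
              ga = maps-∘ h g₀ (λ i → ·-inv h (v i)) (proj₂ (proj₂ (proj₂ (proj₂ found))))
              gz : Maps g z z′
              gz = maps-∘ h g₀ hz (maps-++ˡ g₀ g₀-fix)
              gs : Maps g s s′
              gs = maps-∘ h g₀ hs (maps-++ʳ g₀ {z} {z} g₀-fix)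

              new : Σ[ e ∈ Tup n ] (∀ {m} (x : Tup m) → x ⊑ᵐ 𝒟 → S₁.R a x e)
              new = S₁.extend (inv g) (maps-inv g ga) (set 𝒟) (small-≲ (countable 𝒟) δ.uncountable)
              c₁ : Tup n
              c₁ = proj₁ new

              a⁺→c₁ : ∃[ f ] Maps f v a × Maps f s′ s × Maps f μ.a⁺ c₁
              a⁺→c₁ = S₁.R-unique (inv g) (maps-inv g ga) (maps-inv g gs) (S₁.R-self s′⊑) (proj₂ new s s⊑)

              same : c₁ ∼[ s ] c
              same =
                let (f , _ , fs , fa) = a⁺→c₁
                    (q , qs , qa) = type⇒∼ μ.same
                    (h′ , _ , hs′ , hc) = S.R-unique h hz hs (real s s⊑) (real′ s′ s′⊑)
                in inv h′ ∘ₐ q ∘ₐ inv f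
                 , maps-∘ (inv h′) (q ∘ₐ inv f) (maps-inv h′ hs′) (maps-∘ q (inv f) qs (maps-inv f fs))
                 , maps-∘ (inv h′) (q ∘ₐ inv f) (maps-inv h′ hc) (maps-∘ q (inv f) qa (maps-inv f fa))

              s⊑a : s ⊑ range {S = dom} a
              s⊑a i with μ.extends i
              ... | p , e = p ↑ˡ j , Automorphism.injective g
                (trans (ga (p ↑ˡ j)) (trans (++-↑ˡ μ.s⁺ b p) (trans e (sym (gs i)))))

              different : ¬ SameType c₁ c (range a)
              different same-a =
                let (f , fv , _ , fa) = a⁺→c₁
                    (q , qa , qc) = type⇒∼ same-a
                    (h′ , _ , ha′ , hc) = S.R-unique g gz ga (real a a⊑) (real′ v v⊑)
                    r = h′ ∘ₐ q ∘ₐ f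
                    rv = maps-∘ h′ (q ∘ₐ f) ha′ (maps-∘ q f qa fv)
                    rc = maps-∘ h′ (q ∘ₐ f) hc (maps-∘ q f qc fa)
                in μ.different (∼⇒type (r , maps-++ˡ r {μ.s⁺} {μ.s⁺} rv , rc))

              pulled : Pulled
              pulled = record
                { S₁ = S₁ ; z₁⊑ = v⊑ ; real₁′ = λ d d⊑ → S₁.R-self d⊑ ; s⁺⊑z₁ = λ i → i ↑ˡ j , ++-↑ˡ μ.s⁺ b i
                ; move = record { a⁺ = c₁ ; s⁺ = a ; s⁺⊑𝒜 = a⊑ ; same = ∼⇒type same ; extends = s⊑a ; different = different }
                ; a = a ; a⊑ = a⊑ ; g = g ; ga = ga ; a⊑s⁺ = ⊑-range ; real₁ = proj₂ new }

            go : ∃[ j ] Σ[ b ∈ Tup j ] b ⊑ᵐ 𝒟′ × NonSplit μ.a⁺ b (set 𝒟′) → Pulled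
            go (_ , b , b⊑ , a⁺-ns) = pulled b b⊑ a⁺-ns

      opaque
        -- The strategy over `𝒟` is copied: a move over `𝒟′` is pulled to `𝒟`, answered there, and
        -- the answer returns by s-saturation of `𝒟′`. The new tuples again realize a common scheme,
        -- which keeps the induction going.
        wins-transfer : ∀ m {n k} (S : Scheme k n) {z z′ : Tup k} (𝒟 𝒟′ : CModel) → z ⊑ᵐ 𝒟 → z′ ⊑ᵐ 𝒟′ →
                        ∀ {c c′ : Tup n} → c ⊨ S at z over 𝒟 → c′ ⊨ S at z′ over 𝒟′ →
                        ∀ {l} {s s′ : Tup l} → s ⊑ᵐ 𝒟 → s′ ⊑ᵐ 𝒟′ → ∀ h → Maps h z z′ → Maps h s s′ →
                        IIWinsIn m (model 𝒟) c s → IIWinsIn m (model 𝒟′) c′ s′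
        wins-transfer zero S 𝒟 𝒟′ z⊑ z′⊑ real real′ s⊑ s′⊑ h hz hs w μ =
          w (Pulled.move (pull S 𝒟 𝒟′ z⊑ z′⊑ real real′ s⊑ s′⊑ h hz hs μ))
        wins-transfer (suc m) S 𝒟 𝒟′ z⊑ z′⊑ real real′ s⊑ s′⊑ h hz hs w μ =
          respond (pull S 𝒟 𝒟′ z⊑ z′⊑ real real′ s⊑ s′⊑ h hz hs μ)
          where
          module μ = Move μ
          respond : Pulled S 𝒟 𝒟′ z⊑ z′⊑ real real′ s⊑ s′⊑ h hz hs μ →
                    ∃[ k ] Σ[ t ∈ Tup k ] t ⊑ᵐ 𝒟′ × μ.s⁺ ⊑ range {S = dom} t × IIWinsIn m (model 𝒟′) μ.a⁺ t
          respond P =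
            let (l , t , t⊑ , s⁺⊑t , wins) = w P.move
                (t′ , t′⊑ , f , fz , ft) = s-saturated 𝒟′ (λ i → P.g · t i) (Scheme.s P.S₁) P.z₁⊑
            in l , t′ , t′⊑ , (λ i → covered t t′ f s⁺⊑t fz ft (P.s⁺⊑z₁ i))
               , wins-transfer m P.S₁ 𝒟 𝒟′ P.a⊑ P.z₁⊑ P.real₁ P.real₁′ t⊑ t′⊑ (inv f ∘ₐ P.g)
                   (maps-∘ (inv f) P.g (maps-inv f fz) P.ga) (maps-∘ (inv f) P.g (maps-inv f ft) (maps-img P.g)) wins
            where
            module P = Pulled P
            covered : ∀ {l} (t t′ : Tup l) f → Move.s⁺ P.move ⊑ range {S = dom} t → Fixes f (Scheme.s P.S₁) →
                      Maps f t′ (λ i → P.g · t i) → ∀ {x} → x ∈ range {S = dom} (Scheme.s P.S₁) → x ∈ range {S = dom} t′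
            covered t t′ f p fz ft (q , e) =
              let (r , e′) = range-⊆ {s = P.a} {t} (λ i → range-⊆ {s = Move.s⁺ P.move} {t} p (P.a⊑s⁺ i)) (q , refl)
              in r , trans (Automorphism.injective f (trans (ft r) (trans (·-cong P.g e′) (trans (P.ga q) (sym (fz q)))))) e

        rank-transfer : ∀ m {n k} (S : Scheme k n) {z z′ : Tup k} (𝒟 𝒟′ : CModel) → z ⊑ᵐ 𝒟 → z′ ⊑ᵐ 𝒟′ →
                        ∀ {c c′ : Tup n} → c ⊨ S at z over 𝒟 → c′ ⊨ S at z′ over 𝒟′ → ∀ h → Maps h z z′ →
                        RankLt m 𝒟 c → RankLt m 𝒟′ c′
        rank-transfer (suc m) S {z} {z′} 𝒟 𝒟′ z⊑ z′⊑ real real′ h hz (l , s , s⊑ , w) =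
          let (s′ , s′⊑ , f , fz , fs) = s-saturated 𝒟′ (λ i → h · s i) z′ z′⊑
          in l , s′ , s′⊑ , wins-transfer m S 𝒟 𝒟′ z⊑ z′⊑ real real′ s⊑ s′⊑ (inv f ∘ₐ h)
               (maps-∘ (inv f) h (maps-inv f fz) hz) (maps-∘ (inv f) h (maps-inv f fs) (maps-img h)) w

        -- Both `c` and its image realize the scheme read off `c` over `𝒟`, so no strategy has to be
        -- mapped directly.
        rank-maps : ∀ m {n} {c c′ : Tup n} (𝒟 𝒟′ : CModel) g → Maps g c c′ → (∀ {x} → x ∈ set 𝒟 → g · x ∈ set 𝒟′) →
                    (∀ {x} → x ∈ set 𝒟′ → inv g · x ∈ set 𝒟) → RankLt m 𝒟 c → RankLt m 𝒟′ c′
        rank-maps m {n} {c} {c′} 𝒟 𝒟′ g gc to from = go (local-character c 𝒟)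
          where
          go : ∃[ k ] Σ[ s ∈ Tup k ] s ⊑ᵐ 𝒟 × NonSplit c s (set 𝒟) → RankLt m 𝒟 c → RankLt m 𝒟′ c′
          go (k , s , s⊑ , c-ns) = rank-transfer m S 𝒟 𝒟′ s⊑ (to ∘ s⊑) (λ d d⊑ → S.R-self d⊑)
            (λ d d⊑ → S.R-maps g (maps-img g) (λ i → ·-inv g (d i)) gc (S.R-self (from ∘ d⊑))) g (maps-img g)
            where
            S : Scheme k n
            S = record { 𝒟 = 𝒟 ; s = s ; s⊑𝒟 = s⊑ ; c = c ; c-ns = c-ns }
            module S = Scheme S

        -- (AIV) is applied to `c` over the preimage of each model, starting from the empty tuple;
        -- the bound is therefore common to all conjugates. The successor appears because
        -- `RankLt (suc m)` stands for `m` moves.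
        rank-bound : ∀ {n} (c : Tup n) → ∃[ m ] (∀ g 𝒟 → RankLt m 𝒟 (λ i → g · c i))
        rank-bound c =
          let (m , w) = AIV c
          in suc m , λ g 𝒟 → rank-maps (suc m) (inv g ·ᵐ 𝒟) 𝒟 g (maps-img g)
               (λ p → Subset.resp (set 𝒟) (inv-· (inv g) (inv-· g refl)) (∈-·ᵐ⁻ (inv g) 𝒟 p))
               (∈-·ᵐ (inv g) 𝒟) (0 , [] , (λ ()) , w (model (inv g ·ᵐ 𝒟)) (countable (inv g ·ᵐ 𝒟)) [] (λ ()))

      -- Morley sequences, and the increase of rank at their limits

      bounded-cmodel : ∀ (𝒟 : CModel) → Bounded (set 𝒟)
      bounded-cmodel 𝒟 = small-≲ (countable 𝒟) δ.uncountable

      module MorleySequence {l k} (U : Scheme l k) where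
        open Scheme U

        el : CModel → Tup k
        el ℰ = proj₁ (extend idₐ maps-id (set ℰ) (bounded-cmodel ℰ))

        el-real : ∀ ℰ → el ℰ ⊨ U at s over ℰ
        el-real ℰ = proj₂ (extend idₐ maps-id (set ℰ) (bounded-cmodel ℰ))

        private
          next : ∀ ℰ → Σ[ ℰ′ ∈ CModel ] (set ℰ ∪ range (el ℰ)) ⊆ set ℰ′
          next ℰ = cmodel (set ℰ ∪ range (el ℰ)) (countable-∪ {set ℰ} {range (el ℰ)} (countable ℰ) (countable-range (el ℰ)))

        stage : ℕ → CModel
        stage zero    = 𝒟
        stage (suc i) = proj₁ (next (stage i))

        A : ℕ → Tup k
        A i = el (stage i)

        A-real : ∀ i → A i ⊨ U at s over stage i
        A-real i = el-real (stage i)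

        A⊑ : ∀ i → A i ⊑ᵐ stage (suc i)
        A⊑ i j = proj₂ (next (stage i)) (inj₂ (⊑-range j))

        open Chain stage (λ i p → proj₂ (next (stage i)) (inj₁ p)) public

      -- Let A₀ be the parameter of S, and let t be a base of its type over 𝒜.
      -- Either all conjugates of A₀ over t define the same global type, or the
      -- type defined by the last element of a Morley sequence (Aᵢ) of A₀ over 𝒜
      -- is a limit of the types defined by the Aᵢ, so that it has higher rank.
      module _ {k n} (S : Scheme k n) (𝒜 : CModel) {l} (t : Tup l) (t⊑ : t ⊑ᵐ 𝒜)
               (base : NonSplit (Scheme.s S) t (set 𝒜)) (m : ℕ) (high : ¬ RankLt m (Scheme.𝒟 S) (Scheme.c S)) where
        private
          module S = Scheme S
          open S using (R; _≅_)

        Rigid : Set ℓ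
        Rigid = ∀ {z z′} → S.s ∼[ t ] z → S.s ∼[ t ] z′ → z ≅ z′

        -- Two automorphisms occur: `g′` is known to fix `t`, while `g` controls the image of `c`;
        -- they agree on the base of `S`.
        record HigherRank : Set (lsuc ℓ) where
          field
            g′ g : Aut
            fix  : Fixes g′ t
            same : ∀ i → g · S.s i ≈ g′ · S.s i
            ℰ    : CModel
            𝒜⊆ℰ  : 𝒜 ⊆ᵐ ℰ
            higher : ¬ RankLt (suc m) ℰ (λ i → g · S.c i)

        private
          U : Scheme l k
          U = record { 𝒟 = 𝒜 ; s = t ; s⊑𝒟 = t⊑ ; c = S.s ; c-ns = base }
          module U = Scheme U
          open MorleySequence U

          conjugate : ∀ {j} {x : Tup j} {e} → U.R t x e → S.s ∼[ t ] e
          conjugate (_ , _ , g , u , _ , w) = g , u , w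

          opaque
            -- Consecutive terms of the sequence have the same type over `t` as any `z` and `B` with
            -- `B` realizing `U` over `z`. So one coincidence makes `z` and `z′` agree with a common
            -- `B`.
            rigid : ∀ i → A i ≅ A (suc i) → Rigid
            rigid i p {z} {z′} q q′ =
              let (B , r) = U.realize idₐ maps-id (z ++ z′)
              in S.≅-trans (to-B q (U.R-++ˡ r)) (S.≅-sym (to-B q′ (U.R-++ʳ r)))
              where
              to-B : ∀ {z B} → S.s ∼[ t ] z → U.R t z B → z ≅ B
              to-B q r =
                let (h , ht , hz) = ∼-trans (∼-sym (conjugate (A-real i [] (λ ())))) q
                    (h′ , _ , u , v) = U.R-unique h ht hz (A-real (suc i) (A i) (A⊑ i)) r
                in S.≅-maps h′ u v p

          module _ (split : ∀ i → ¬ A i ≅ A (suc i)) where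
            A∞ : Tup k
            A∞ = el limit

            A∞-real : A∞ ⊨ U at t over limit
            A∞-real = el-real limit

            at : ∀ {e} → S.s ∼[ t ] e → ∀ X → Bounded X → Σ[ c ∈ Tup n ] (∀ {j} (x : Tup j) → x ⊑ X → R e x c)
            at (g , _ , p) X b = S.extend g p X b

            A∼ : ∀ i → S.s ∼[ t ] A i
            A∼ i = conjugate (A-real i [] (λ ()))

            c : ℕ → Tup n
            c i = proj₁ (at (A∼ i) (set limit) (bounded-cmodel limit))

            c-real : ∀ i → c i ⊨ S at A i over limit
            c-real i = proj₂ (at (A∼ i) (set limit) (bounded-cmodel limit))

            new : Σ[ c ∈ Tup n ] (∀ {j} (x : Tup j) → x ⊑ set limit → R A∞ x c)
            new = at (conjugate (A∞-real [] (λ ()))) (set limit) (bounded-cmodel limit)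

            c∞ : Tup n
            c∞ = proj₁ new

            -- `A i` and `A∞` have the same type over `stage i`, hence so do the realizations of `S`
            -- at them.
            c∼c∞ : ∀ i {j} (x : Tup j) → x ⊑ᵐ stage i → c i ∼[ x ] c∞
            c∼c∞ i x x⊑ =
              let (h , _ , hx , hA) = U.R-unique idₐ maps-id maps-id (A-real i x x⊑) (A∞-real x (⊆-limit i ∘ x⊑))
                  (h′ , _ , u , v) = S.R-unique h hA hx (c-real i x (⊆-limit i ∘ x⊑)) (proj₂ new x (⊆-limit i ∘ x⊑))
              in h′ , u , v

            Distinct : ℕ → Set ℓ
            Distinct i = ¬ SameType (c i) c∞ (set limit) ⊎ ¬ SameType (c (suc i)) c∞ (set limit)

            -- If both had the type of `c∞`, then the limit, being s-saturated and containing `A i`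
            -- and `A (suc i)`, would show that these two define the same type.
            distinct : ∀ i → Distinct i
            distinct i = cases em em
              where
              A⊑limit : ∀ i → A i ⊑ᵐ limit
              A⊑limit i = ⊆-limit (suc i) ∘ A⊑ i
              agree : SameType (c i) c∞ (set limit) → SameType (c (suc i)) c∞ (set limit) → A i ≅ A (suc i)
              agree p q x =
                let (x₀ , x₀⊑ , h , hA , hx) = s-saturated limit x (A i ++ A (suc i)) (++-⊑ {X = set limit} (A⊑limit i) (A⊑limit (suc i)))
                    y = x₀ ++ A (suc i)
                    (f , fy , fc) = ∼-trans (galois⇒∼ (q y (++-⊑ {X = set limit} x₀⊑ (A⊑limit (suc i)))))
                                            (∼-sym (galois⇒∼ (p y (++-⊑ {X = set limit} x₀⊑ (A⊑limit (suc i))))))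
                in (λ j → h · c i j)
                   , S.R-maps h (maps-++ˡ h hA) hx (maps-img h) (c-real i x₀ x₀⊑)
                   , S.R-maps (h ∘ₐ f) (maps-∘ h f (maps-++ʳ h {A i} {A i} hA) (maps-++ʳ f {x₀} {x₀} fy))
                       (maps-∘ h f hx (maps-++ˡ f fy)) (maps-∘ h f (maps-img h) fc) (c-real (suc i) x₀ x₀⊑)
              cases : Dec (SameType (c i) c∞ (set limit)) → Dec (SameType (c (suc i)) c∞ (set limit)) →
                      Distinct i
              cases (no p)  _       = inj₁ p
              cases (yes _) (no q)  = inj₂ q
              cases (yes p) (yes q) = ⊥-elim (split i (agree p q))

            SepAt : ℕ → Set ℓ
            SepAt i = ∃[ j ] Σ[ x ∈ Tup j ] x ⊑ᵐ limit × ¬ (c i ∼[ x ] c∞)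

            separate : ∀ i → ¬ SameType (c i) c∞ (set limit) → SepAt i
            separate i p = by-contradiction λ none → p λ x x⊑ → ∼⇒galois (by-contradiction λ q → none (_ , x , x⊑ , q))

            c-high : ∀ i → ¬ RankLt m limit (c i)
            c-high i r =
              let (h , _ , hA) = ∼-sym (A∼ i)
              in high (rank-transfer m S limit S.𝒟 (⊆-limit (suc i) ∘ A⊑ i) S.s⊑𝒟 (c-real i) (λ d d⊑ → S.R-self d⊑) h hA r)

            -- Player I replaces `c∞` by `c i`, which agrees with it on `x` but not on the limit. A
            -- win in `m` moves would leave a win from `c i` in fewer, against `c-high`.
            play : ∀ {j} (x : Tup j) → x ⊑ᵐ limit → IIWinsIn m (model limit) c∞ x → ∀ i → x ⊑ᵐ stage i → SepAt i → ⊥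
            play x x⊑ w i x⊑i (_ , y , y⊑ , p) = finish m ≡.refl w
              where
              μ : Move (model limit) c∞ x
              μ = record
                { a⁺ = c i ; s⁺ = x ++ y ; s⁺⊑𝒜 = ++-⊑ {X = set limit} x⊑ y⊑ ; same = ∼⇒type (c∼c∞ i x x⊑i)
                ; extends = λ r → r ↑ˡ _ , ++-↑ˡ x y r
                ; different = λ q → let (g , u , v) = type⇒∼ q in p (g , maps-++ʳ g {x} {x} u , v) }
              finish : ∀ m′ → m ≡ m′ → IIWinsIn m′ (model limit) c∞ x → ⊥
              finish zero     e w = w μ
              finish (suc m′) e w =
                let (j , u , u⊑ , _ , w′) = w μ
                in c-high i (≡.subst (λ m → RankLt m limit (c i)) (≡.sym e) (j , u , u⊑ , w′))

            higher-rank : HigherRank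
            higher-rank =
              let (g′ , g′t , g′s) = conjugate (A∞-real [] (λ ()))
                  (_ , _ , g , gs , _ , gc) = proj₂ new [] (λ ())
              in record
                { g′ = g′ ; g = g ; fix = g′t ; same = λ i → trans (gs i) (sym (g′s i))
                ; ℰ = limit ; 𝒜⊆ℰ = ⊆-limit 0 ; higher = λ r → refute (rank-maps (suc m) limit limit idₐ gc id id r) }
              where
              refute : ¬ RankLt (suc m) limit c∞
              refute (_ , x , x⊑ , w) = let (i , x⊑i) = common x⊑ in cases i x⊑i (distinct i)
                where
                cases : ∀ i → x ⊑ᵐ stage i → Distinct i → ⊥
                cases i x⊑i (inj₁ p) = play x x⊑ w i x⊑i (separate i p)
                cases i x⊑i (inj₂ p) = play x x⊑ w (suc i) (mono (ℕ.n≤1+n i) ∘ x⊑i) (separate (suc i) p)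

        opaque
          raise : Rigid ⊎ HigherRank
          raise = cases em
            where
            cases : Dec (∃[ i ] A i ≅ A (suc i)) → Rigid ⊎ HigherRank
            cases (yes (i , p)) = inj₁ (rigid i p)
            cases (no ¬p)       = inj₂ (higher-rank λ i p → ¬p (i , p))

      -- Choices of extremal rank

      least : ∀ {p} (P : ℕ → Set p) → ∃ P → ∃[ m ] P m × (∀ {j} → j ℕ.< m → ¬ P j)
      least P (n , p) = go n p (<-wellFounded n)
        where
        go : ∀ n → P n → Acc ℕ._<_ n → ∃[ m ] P m × (∀ {j} → j ℕ.< m → ¬ P j)
        go n p (acc r) with em {P = ∃[ j ] j ℕ.< n × P j}
        ... | yes (j , j<n , q) = go j q (r j<n)
        ... | no ¬q             = n , p , λ {j} j<n q → ¬q (j , j<n , q)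

      -- An abstract stand-in for the stabilizer of a global type: a group of automorphisms that
      -- contains the pointwise stabilizer of a finite tuple.
      record Supported : Set (lsuc ℓ) where
        field
          H      : Aut → Set ℓ
          H-≈    : ∀ {g f} → (∀ x → g · x ≈ f · x) → H g → H f
          H-∘    : ∀ {g f} → H g → H f → H (g ∘ₐ f)
          H-inv  : ∀ {g} → H g → H (inv g)
          {j}    : ℕ
          w      : Tup j
          H-supp : ∀ {g} → Fixes g w → H g

        -- The stabilizer of `h · w` is the conjugate by `h` of the stabilizer of `w`.
        H-fix : ∀ {g h} → H h → Fixes g (λ i → h · w i) → H g
        H-fix {g} {h} p q = H-≈ {along h (conj h g) h} (λ x → trans (·-inv h _) (·-cong g (·-inv h x)))
          (H-∘ {h} {conj h g ∘ₐ inv h} p (H-∘ {conj h g} {inv h} (H-supp {conj h g} (maps-conj h g (maps-img h) (maps-img h) q)) (H-inv {h} p)))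

        ContainsBase : CModel → Set ℓ
        ContainsBase 𝒟 = ∃[ h ] H h × (λ i → h · w i) ⊑ᵐ 𝒟

      -- Among the pairs (c′, 𝒟) with c′ conjugate to c under H, one of maximal
      -- rank gives a scheme with few conjugates under H.
      module InvariantScheme (HH : Supported) {n} (c : Tup n) where
        open Supported HH

        private
          Bound : ℕ → Set (lsuc ℓ)
          Bound m = ∀ 𝒟 h → H h → ContainsBase 𝒟 → RankLt m 𝒟 (λ i → h · c i)

          record NotBound (m : ℕ) : Set (lsuc ℓ) where
            field
              𝒟 : CModel
              h : Aut
              Hh : H h
              has : ContainsBase 𝒟
              high : ¬ RankLt m 𝒟 (λ i → h · c i)

          not-bound : ∀ {m} → ¬ Bound m → NotBound m
          not-bound p = by-contradiction λ none → p λ 𝒟 h Hh has → by-contradiction λ high →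
            none (record { 𝒟 = 𝒟 ; h = h ; Hh = Hh ; has = has ; high = high })

        -- The base of `S` includes an `H`-conjugate of `w`, so that its stabilizer lies in `H`.
        -- Having few conjugates takes the form `rigid`: over a finite part `t` of any model with
        -- such a conjugate, all copies of the base define one type.
        record Result : Set (lsuc ℓ) where
          field
            {k}   : ℕ
            S     : Scheme k n
            c≈    : ∀ i → Scheme.c S i ≡ c i
            base  : Aut
            H-base : H base
            base⊑ : (λ i → base · w i) ⊑ range {S = dom} (Scheme.s S)
            rigid : ∀ 𝒜 → ContainsBase 𝒜 →
                    ∃[ l ] Σ[ t ∈ Tup l ] t ⊑ᵐ 𝒜 × NonSplit (Scheme.s S) t (set 𝒜) × (∀ {g} → Fixes g t → H g) ×
                    (∀ {z z′} → Scheme.s S ∼[ t ] z → Scheme.s S ∼[ t ] z′ → Scheme._≅_ S z z′)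

          H-s : ∀ {g} → Fixes g (Scheme.s S) → H g
          H-s {g} p = H-fix {g} {base} H-base (λ i → fixes-range g p (base⊑ i))

        private
          module Maximal {m} (bound : Bound (suc m)) (nb : NotBound m) where
            open NotBound nb
            -- Moved back by `h`, the extremal pair consists of `c` itself and a model.
            𝒟* : CModel
            𝒟* = inv h ·ᵐ 𝒟
            high* : ¬ RankLt m 𝒟* c
            high* r = high (rank-maps m 𝒟* 𝒟 h (maps-img h)
              (λ p → Subset.resp (set 𝒟) (inv-· (inv h) (inv-· h refl)) (∈-·ᵐ⁻ (inv h) 𝒟 p)) (∈-·ᵐ (inv h) 𝒟) r)

            b : Aut
            b = inv h ∘ₐ proj₁ has
            Hb : H b
            Hb = H-∘ {inv h} {proj₁ has} (H-inv {h} Hh) (proj₁ (proj₂ has))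
            w′ : Tup j
            w′ i = b · w i
            w′⊑ : w′ ⊑ᵐ 𝒟*
            w′⊑ i = ∈-·ᵐ (inv h) 𝒟 (proj₂ (proj₂ has) i)

            result : ∀ {k} (s : Tup k) → s ⊑ᵐ 𝒟* → NonSplit c s (set 𝒟*) → Result
            result s s⊑ c-ns = record
              { S = S ; c≈ = λ _ → ≡.refl ; base = b ; H-base = Hb ; base⊑ = λ i → i ↑ˡ _ , ++-↑ˡ w′ s i
              ; rigid = λ 𝒜 (h″ , Hh″ , ⊑𝒜) → rigid 𝒜 h″ Hh″ ⊑𝒜 (local-character S.s 𝒜) }
              where
              S : Scheme _ n
              S = record { 𝒟 = 𝒟* ; s = w′ ++ s ; s⊑𝒟 = ++-⊑ {X = set 𝒟*} w′⊑ s⊑ ; c = c ; c-ns = nonsplit-++ w′⊑ c-ns }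
              module S = Scheme S
              rigid : ∀ 𝒜 h″ → H h″ → (λ i → h″ · w i) ⊑ᵐ 𝒜 →
                      ∃[ l ] Σ[ t ∈ Tup l ] t ⊑ᵐ 𝒜 × NonSplit S.s t (set 𝒜) →
                      ∃[ l ] Σ[ t ∈ Tup l ] t ⊑ᵐ 𝒜 × NonSplit S.s t (set 𝒜) × (∀ {g} → Fixes g t → H g) ×
                      (∀ {z z′} → S.s ∼[ t ] z → S.s ∼[ t ] z′ → z S.≅ z′)
              rigid 𝒜 h″ Hh″ ⊑𝒜 (l , t₀ , t₀⊑ , ns₀) = _ , t , t⊑ , t-ns , H-t , cases (raise S 𝒜 t t⊑ t-ns m high*)
                where
                w″ : Tup j
                w″ i = h″ · w i
                t : Tup (j + l)
                t = w″ ++ t₀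
                t⊑ : t ⊑ᵐ 𝒜
                t⊑ = ++-⊑ {X = set 𝒜} ⊑𝒜 t₀⊑
                t-ns : NonSplit S.s t (set 𝒜)
                t-ns = nonsplit-++ ⊑𝒜 ns₀
                H-t : ∀ {g} → Fixes g t → H g
                H-t {g} p = H-fix {g} {h″} Hh″ (maps-++ˡ g p)
                cases : Rigid S 𝒜 t t⊑ t-ns m high* ⊎ HigherRank S 𝒜 t t⊑ t-ns m high* → Rigid S 𝒜 t t⊑ t-ns m high*
                cases (inj₁ r) = r
                -- The pair of higher rank is among those compared: `g′` fixes `t` and lies in `H`,
                -- and `g` agrees with it on the conjugate of `w` in the base, so `g` lies in `H`
                -- too.
                cases (inj₂ r) = ⊥-elim (R.higher (bound R.ℰ R.g Hg (h″ , Hh″ , λ i → R.𝒜⊆ℰ (⊑𝒜 i))))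
                  where
                  module R = HigherRank r
                  Hg : H R.g
                  Hg = H-≈ {R.g′ ∘ₐ (inv R.g′ ∘ₐ R.g)} (λ x → ·-inv R.g′ _)
                    (H-∘ {R.g′} {inv R.g′ ∘ₐ R.g} (H-t {R.g′} R.fix) (H-fix {inv R.g′ ∘ₐ R.g} {b} Hb (maps-++ˡ (inv R.g′ ∘ₐ R.g) {w′} {w′} {s} {s}
                      (λ i → inv-· R.g′ (sym (R.same i))))))

        opaque
          invariant-scheme : Result
          invariant-scheme = go (least Bound (m₀ , λ 𝒟 h _ _ → proj₂ (rank-bound c) h 𝒟))
            where
            m₀ : ℕ
            m₀ = proj₁ (rank-bound c)
            go : ∃[ m ] Bound m × (∀ {j} → j ℕ.< m → ¬ Bound j) → Result
            -- A bound of zero fails because there is at least one pair: `c` with a model containing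
            -- `w`.
            go (zero , bound , _) =
              let (𝒟 , w⊑) = cmodel (range w) (countable-range w)
                  H-id = H-supp {idₐ} maps-id
              in ⊥-elim (lower (bound 𝒟 idₐ H-id (idₐ , H-id , λ i → w⊑ (⊑-range i))))
            go (suc m , bound , min) =
              let nb = not-bound (min ℕ.≤-refl)
                  (_ , s , s⊑ , c-ns) = local-character c (Maximal.𝒟* {m} bound nb)
              in Maximal.result bound nb s s⊑ c-ns

      -- The required member E minimizes the rank of the tuples that are equivalent to
      -- some tuple of a model.  Then every other member of the family identifies tuples
      -- of the same type over a model that meets their class modulo E.
      module MinimalRelation {i k₀ n} (s₀ : Tup k₀) (c : Tup n) {I : Set i} (E : I → Tup n → Tup n → Set ℓ)
               (E-sym   : ∀ f {x y} → E f x y → E f y x)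
               (E-trans : ∀ f {x y z} → E f x y → E f y z → E f x z)
               (E-maps  : ∀ f g {x x′ y y′} → Fixes g s₀ → Maps g x x′ → Maps g y y′ → E f x y → E f x′ y′)
               (E-∩     : ∀ f f′ → ∃[ f″ ] (∀ {x y} → E f″ x y → E f x y × E f′ x y)) where
        private
          record Member (f : I) (𝒟 : CModel) (h : Aut) : Set ℓ where
            field
              h-s₀ : Fixes h s₀
              s₀⊑  : s₀ ⊑ᵐ 𝒟
              h₀   : Aut
              h₀-s₀ : Fixes h₀ s₀
              c₀⊑  : (λ i → h₀ · c i) ⊑ᵐ 𝒟
              eq   : E f (λ i → h₀ · c i) (λ i → h · c i)

          Bound : I → ℕ → Set (lsuc ℓ)
          Bound f m = ∀ 𝒟 h → Member f 𝒟 h → RankLt m 𝒟 (λ i → h · c i)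

        Controls : I → Set (i ⊔ lsuc ℓ)
        Controls f = ∀ f′ (𝒜 : CModel) → s₀ ⊑ᵐ 𝒜 → ∀ {c₀ c₁ c₂} → c₀ ⊑ᵐ 𝒜 → c ∼[ s₀ ] c₀ → c ∼[ s₀ ] c₁ →
          E f c₀ c₁ → (∀ {l} (t : Tup l) → t ⊑ᵐ 𝒜 → c₁ ∼[ t ] c₂) → E f′ c₁ c₂

        private
          module _ (f : I) (m : ℕ) (bound : Bound f (suc m)) (min : ∀ f → ¬ Bound f m) where

            record NotBound (f : I) : Set (lsuc ℓ) where
              field
                𝒟 : CModel
                h : Aut
                mem : Member f 𝒟 h
                high : ¬ RankLt m 𝒟 (λ i → h · c i)

            not-bound : ∀ f → NotBound f
            not-bound f = by-contradiction λ none → min f λ 𝒟 h mem → by-contradiction λ high →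
              none (record { 𝒟 = 𝒟 ; h = h ; mem = mem ; high = high })

            module _ (f′ : I) (𝒜 : CModel) (s₀⊑ : s₀ ⊑ᵐ 𝒜) {c₀ c₁ c₂ : Tup n} (c₀⊑ : c₀ ⊑ᵐ 𝒜)
                     (c∼c₀ : c ∼[ s₀ ] c₀) (c∼c₁ : c ∼[ s₀ ] c₁) (eq : E f c₀ c₁)
                     (same : ∀ {l} (t : Tup l) → t ⊑ᵐ 𝒜 → c₁ ∼[ t ] c₂) where
              -- Minimality of the bound is applied to a relation finer than both `f` and `f′`. It
              -- too has a pair of rank at least `m`, which is then moved so that its tuple in the
              -- model becomes `c₁`.
              f∩ : I
              f∩ = proj₁ (E-∩ f f′)
              open NotBound (not-bound f∩)
              module mem = Member mem
              h₁ : Aut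
              h₁ = proj₁ c∼c₁
              g : Aut
              g = h₁ ∘ₐ inv mem.h₀
              g-s₀ : Fixes g s₀
              g-s₀ = maps-∘ h₁ (inv mem.h₀) (proj₁ (proj₂ c∼c₁)) (maps-inv mem.h₀ mem.h₀-s₀)
              g-c : Maps g (λ i → mem.h₀ · c i) c₁
              g-c = maps-∘ h₁ (inv mem.h₀) (proj₂ (proj₂ c∼c₁)) (maps-inv mem.h₀ (maps-img mem.h₀))
              𝒟* : CModel
              𝒟* = g ·ᵐ 𝒟
              c* : Tup n
              c* i = g · h · c i
              high* : ¬ RankLt m 𝒟* c*
              high* r = high (rank-maps m 𝒟* 𝒟 (inv g) (maps-inv g (maps-img g)) (∈-·ᵐ⁻ g 𝒟)
                (λ {x} p → Subset.resp (set 𝒟*) (sym (inv-· (inv g) (inv-· g refl))) (∈-·ᵐ g 𝒟 p)) r)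
              eq* : E f∩ c₁ c*
              eq* = E-maps f∩ g g-s₀ g-c (maps-img g) mem.eq
              ∈𝒟* : ∀ {k} {x x′ : Tup k} → Maps g x x′ → x ⊑ᵐ 𝒟 → x′ ⊑ᵐ 𝒟*
              ∈𝒟* p q i = Subset.resp (set 𝒟*) (p i) (∈-·ᵐ g 𝒟 (q i))

              conclude : ∀ {k} (s : Tup k) → s ⊑ᵐ 𝒟* → NonSplit c* s (set 𝒟*) → E f′ c₁ c₂
              conclude s s⊑ c-ns = go (local-character S.s 𝒜)
                where
                u : Tup (n + k₀)
                u = c₁ ++ s₀
                u⊑ : u ⊑ᵐ 𝒟*
                u⊑ = ++-⊑ {X = set 𝒟*} (∈𝒟* g-c mem.c₀⊑) (∈𝒟* g-s₀ mem.s₀⊑)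
                S : Scheme _ n
                S = record { 𝒟 = 𝒟* ; s = u ++ s ; s⊑𝒟 = ++-⊑ {X = set 𝒟*} u⊑ s⊑ ; c = c* ; c-ns = nonsplit-++ u⊑ c-ns }
                module S = Scheme S

                go : ∃[ l ] Σ[ t ∈ Tup l ] t ⊑ᵐ 𝒜 × NonSplit S.s t (set 𝒜) → E f′ c₁ c₂
                go (l , t₀ , t₀⊑ , ns₀) = cases (raise S 𝒜 t t⊑ t-ns m high*)
                  where
                  t : Tup ((n + k₀) + l)
                  t = (c₀ ++ s₀) ++ t₀
                  t⊑ : t ⊑ᵐ 𝒜
                  t⊑ = ++-⊑ {X = set 𝒜} (++-⊑ {X = set 𝒜} c₀⊑ s₀⊑) t₀⊑
                  t-ns : NonSplit S.s t (set 𝒜)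
                  t-ns = nonsplit-++ (++-⊑ {X = set 𝒜} c₀⊑ s₀⊑) ns₀
                  t-c₀ : ∀ f → Fixes f t → Fixes f c₀
                  t-c₀ f p = maps-++ˡ f {c₀} {c₀} (maps-++ˡ f {c₀ ++ s₀} {c₀ ++ s₀} p)
                  t-s₀ : ∀ f → Fixes f t → Fixes f s₀
                  t-s₀ f p = maps-++ʳ f {c₀} {c₀} (maps-++ˡ f {c₀ ++ s₀} {c₀ ++ s₀} p)
                  S-c₁ : ∀ f {f′ : Aut} → Maps f S.s (λ i → f′ · S.s i) → Maps f c₁ (λ i → f′ · c₁ i)
                  S-c₁ f {f′} p i = trans (·-cong f (sym (at i))) (trans (p _) (·-cong f′ (at i)))
                    where
                    at : ∀ i → S.s ((i ↑ˡ k₀) ↑ˡ _) ≈ c₁ i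
                    at i = trans (++-↑ˡ u s _) (++-↑ˡ c₁ s₀ i)
                  S-s₀ : ∀ f {f′ : Aut} → Maps f S.s (λ i → f′ · S.s i) → Fixes f′ s₀ → Fixes f s₀
                  S-s₀ f {f′} p q i = trans (·-cong f (sym (at i))) (trans (p _) (trans (·-cong f′ (at i)) (q i)))
                    where
                    at : ∀ i → S.s ((n ↑ʳ i) ↑ˡ _) ≈ s₀ i
                    at i = trans (++-↑ˡ u s _) (++-↑ʳ c₁ s₀ i)
                  E∩⇒ : ∀ {x y} → E f∩ x y → E f x y × E f′ x y
                  E∩⇒ = proj₂ (E-∩ f f′)

                  cases : Rigid S 𝒜 t t⊑ t-ns m high* ⊎ HigherRank S 𝒜 t t⊑ t-ns m high* → E f′ c₁ c₂
                  -- One `e` realizes the scheme at the base and at its image under `g₂`. The bases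
                  -- contain `c₁` and `c₂` respectively, so `e` is related to both by `E f′`.
                  cases (inj₁ rigid) =
                    let (g₂ , g₂t , g₂c) = same t t⊑
                        (e , (_ , _ , p , pS , _ , pc) , (_ , _ , q , qS , _ , qc)) =
                          rigid {S.s} {λ i → g₂ · S.s i} (idₐ , maps-id , maps-id) (g₂ , g₂t , maps-img g₂) []
                        e₁ = E-maps f′ p (S-s₀ p {idₐ} pS maps-id) (S-c₁ p {idₐ} pS) pc (proj₂ (E∩⇒ eq*))
                        e₂ = E-maps f′ q (S-s₀ q {g₂} qS (t-s₀ g₂ g₂t)) (maps-≈ʳ q g₂c (S-c₁ q {g₂} qS)) qc (proj₂ (E∩⇒ eq*))
                    in E-trans f′ e₁ (E-sym f′ e₂)
                  -- The new tuple is related by `E f` to `c₀` in `𝒜`: apply `g′`, which fixes `c₀`,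
                  -- to the relation of `c₀` and `c₁`, and `g` to that of `c₁` and `c*`. Its rank
                  -- contradicts the bound for `f`.
                  cases (inj₂ r) = ⊥-elim (R.higher (rank-maps (suc m) R.ℰ R.ℰ idₐ (λ i → refl) id id
                    (bound R.ℰ (R.g ∘ₐ (g ∘ₐ h)) (record
                      { h-s₀ = maps-∘ R.g (g ∘ₐ h) g′-s₀ (maps-∘ g h g-s₀ mem.h-s₀)
                      ; s₀⊑ = R.𝒜⊆ℰ ∘ s₀⊑ ; h₀ = proj₁ c∼c₀ ; h₀-s₀ = proj₁ (proj₂ c∼c₀)
                      ; c₀⊑ = λ i → R.𝒜⊆ℰ (Subset.resp (set 𝒜) (sym (proj₂ (proj₂ c∼c₀) i)) (c₀⊑ i))
                      ; eq = E-maps f idₐ maps-id (λ i → sym (proj₂ (proj₂ c∼c₀) i)) (λ i → refl)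
                               (E-trans f (E-maps f R.g′ (t-s₀ R.g′ R.fix) (t-c₀ R.g′ R.fix) (maps-img R.g′) eq)
                                          (E-maps f R.g g′-s₀ (S-c₁ R.g {R.g′} R.same) (maps-img R.g) (proj₁ (E∩⇒ eq*))))
                      }))))
                    where
                    module R = HigherRank r
                    g′-s₀ : Fixes R.g s₀
                    g′-s₀ = S-s₀ R.g {R.g′} R.same (t-s₀ R.g′ R.fix)

            controls : Controls f
            controls f′ 𝒜 s₀⊑ c₀⊑ p q eq same =
              let (_ , s , s⊑ , c-ns) = local-character (c* f′ 𝒜 s₀⊑ c₀⊑ p q eq same) (𝒟* f′ 𝒜 s₀⊑ c₀⊑ p q eq same)
              in conclude f′ 𝒜 s₀⊑ c₀⊑ p q eq same s s⊑ c-ns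

        opaque
          minimal-relation : I → ∃[ f ] Controls f
          minimal-relation f₀ = go (least (λ m → ∃[ f ] Bound f m) (m₀ , f₀ , λ 𝒟 h _ → proj₂ (rank-bound c) h 𝒟))
            where
            m₀ : ℕ
            m₀ = proj₁ (rank-bound c)
            go : ∃[ m ] (∃[ f ] Bound f m) × (∀ {j} → j ℕ.< m → ¬ (∃[ f ] Bound f j)) → ∃[ f ] Controls f
            go (suc m , (f , bound) , min) = f , controls f m bound (λ f b → min ℕ.≤-refl (f , b))
            go (zero , (f , bound) , _) = f , λ f′ 𝒜 s₀⊑ c₀⊑ (h₀ , p , p′) (h , q , q′) eq _ → ⊥-elim (lower
              (bound 𝒜 h (record
                { h-s₀ = q ; s₀⊑ = s₀⊑ ; h₀ = h₀ ; h₀-s₀ = p ; c₀⊑ = λ i → Subset.resp (set 𝒜) (sym (p′ i)) (c₀⊑ i)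
                ; eq = E-maps f idₐ maps-id (λ i → sym (p′ i)) (λ i → sym (q′ i)) eq })))

      -- Types over models and bounded invariant relations

      infix 4 _∼_over_
      _∼_over_ : ∀ {n} → Tup n → Tup n → CModel → Set ℓ
      x ∼ y over 𝒜 = ∀ {l} (t : Tup l) → t ⊑ᵐ 𝒜 → x ∼[ t ] y

      module Lascar (HH : Supported) where
        open Supported HH

        -- A nonsplitting extension of the type of c over 𝒜 to the set X of representatives
        -- ties c and every tuple of the same type over 𝒜 to the same representative.
        opaque
          type⇒lascar : ∀ {m} (E : Tup m → Tup m → Set ℓ) → (∀ {x y} → E x y → E y x) → (∀ {x y z} → E x y → E y z → E x z) →
                        (∀ g {x x′ y y′} → H g → Maps g x x′ → Maps g y y′ → E x y → E x′ y′) →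
                        ∀ X → Bounded X → (∀ x → ∃[ y ] y ⊑ X × E x y) →
                        ∀ 𝒜 → ContainsBase 𝒜 → ∀ {c c′} → c ∼ c′ over 𝒜 → E c c′
          type⇒lascar {m} E E-sym E-trans E-maps X X-bdd reps 𝒜 (h , Hh , ⊑𝒜) {c} {c′} same = go (local-character c 𝒜)
            where
            go : ∃[ k ] Σ[ s ∈ Tup k ] s ⊑ᵐ 𝒜 × NonSplit c s (set 𝒜) → E c c′
            go (k , s , s⊑ , c-ns) =
              let (c* , real) = S.extend idₐ maps-id X X-bdd
                  (y , y⊑ , eq) = reps c*
                  (d , d⊑ , g , gs , gd , gc) = real y y⊑
                  (q , qs , qc) = same (S.s ++ d) (++-⊑ {X = set 𝒜} S.s⊑𝒟 d⊑)
                  eq′ = E-maps (inv g) (H-inv {g} (H-t g gs)) (maps-inv g gc) (maps-inv g gd) eq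
              in E-trans eq′ (E-sym (E-maps q (H-t q (maps-++ˡ q qs)) qc (maps-++ʳ q {S.s} {S.s} qs) eq′))
              where
              S : Scheme (j + k) m
              S = record { 𝒟 = 𝒜 ; s = (λ i → h · w i) ++ s ; s⊑𝒟 = ++-⊑ {X = set 𝒜} ⊑𝒜 s⊑ ; c = c ; c-ns = nonsplit-++ ⊑𝒜 c-ns }
              module S = Scheme S
              H-t : ∀ g → Fixes g S.s → H g
              H-t g p = H-fix {g} {h} Hh (maps-++ˡ g p)

      -- The stabilizer of a global type, and uniqueness of generic tuples

      module Stabilizer {k n} (P : Scheme k n) where
        open Scheme P using (_≅_; ≅-maps; ≅-trans; ≅-sym) renaming (R to PR; s to w; R-unique to PR-unique; R-maps to PR-maps; realize to P-realize; extend to P-extend; R-++ˡ to PR-++ˡ; R-++ʳ to PR-++ʳ)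

        record H (g : Aut) : Set ℓ where
          constructor fixing
          field fixed : (λ i → g · w i) ≅ w
        open H public

        ≅-refl : ∀ {z} g → Maps g w z → z ≅ z
        ≅-refl g p x = let (e , r) = P-realize g p x in e , r , r

        HH : Supported
        HH = record
          { H      = H
          ; H-≈    = λ e (fixing p) → fixing (≅-maps idₐ (λ i → e (w i)) maps-id p)
          ; H-∘    = λ {g} {f} (fixing p) (fixing q) → fixing (≅-trans (≅-maps g (maps-img g) (maps-img g) q) p)
          ; H-inv  = λ {g} (fixing p) → fixing (≅-sym (≅-maps (inv g) (λ i → inv-· g refl) (maps-img (inv g)) p))
          ; w      = w
          ; H-supp = λ {g} p → fixing (≅-maps idₐ (λ i → sym (p i)) maps-id (≅-refl idₐ maps-id))
          }
        open Supported HH public hiding (H; w; j)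

        -- A common realization at `g · w` and at `w` is inserted between `g · e` and `e′`; the two
        -- corrections fix `g · w` and `w`, so they stay in `H`.
        H-real : ∀ g → H g → ∀ {m} {x x′ : Tup m} {e e′} → Maps g x x′ → PR w x e → PR w x′ e′ →
                 ∃[ h ] H h × Maps h x x′ × Maps h e e′
        H-real g Hg {x′ = x′} gx r r′ =
          let (e₂ , u , v) = fixed Hg x′
              (h₁ , h₁w , h₁x , h₁e) = PR-unique idₐ maps-id maps-id (PR-maps g (maps-img g) gx (maps-img g) r) u
              (h₂ , h₂w , h₂x , h₂e) = PR-unique idₐ maps-id maps-id v r′
          in h₂ ∘ₐ (h₁ ∘ₐ g)
             , H-∘ {h₂} {h₁ ∘ₐ g} (H-supp {h₂} h₂w) (H-∘ {h₁} {g} (H-fix {h₁} {g} Hg h₁w) Hg)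
             , maps-∘ h₂ (h₁ ∘ₐ g) h₂x (maps-∘ h₁ g h₁x gx)
             , maps-∘ h₂ (h₁ ∘ₐ g) h₂e (maps-∘ h₁ g h₁e (maps-img g))

        -- Conjugacy under `H` plays the part of equality of types over the canonical base, which is
        -- not yet present here.
        Generic : Tup n → Set (lsuc ℓ)
        Generic d = ∀ 𝒟 → ∃[ e ] ∃[ g ] e ⊨ P at w over 𝒟 × H g × Maps g e d

        module Unique {m} (c : Tup m) (w-in-c : ∀ g → Fixes g c → Fixes g w) where
          open InvariantScheme.Result (InvariantScheme.invariant-scheme HH c) using (S; c≈; base; H-base; base⊑; rigid; H-s)
          private module S = Scheme S

          𝒜 : CModel
          𝒜 = S.𝒟

          private
            ⊑𝒜 : (λ i → base · w i) ⊑ᵐ 𝒜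
            ⊑𝒜 i = let (p , e) = base⊑ i in Subset.resp (set 𝒜) e (S.s⊑𝒟 p)

          𝒜-base : ContainsBase 𝒜
          𝒜-base = base , H-base , ⊑𝒜

          open MorleySequence S using (limit; stage; A; A-real; A⊑; common; mono; ⊆-limit) public

          private
            opaque
              -- A copy `B` of the base of `S`, taken over `x ++ y`, does not distinguish `x` from
              -- `y`; nor does a realization of `S` at `B`. By rigidity the latter can be chosen to
              -- realize `S` at its own base as well.
              inseparable : ∀ 𝒜′ → ContainsBase 𝒜′ → ∀ {j} {x y : Tup j} → x ∼ y over 𝒜′ → ∀ {c₁} → S.R S.s (x ++ y) c₁ →
                            ∃[ h ] H h × Maps h x y × Fixes h c₁
              inseparable 𝒜′ has {x = x} {y} same {c₁} r = go (rigid 𝒜′ has)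
                where
                go : ∃[ l ] Σ[ t ∈ Tup l ] t ⊑ᵐ 𝒜′ × NonSplit S.s t (set 𝒜′) × (∀ {g} → Fixes g t → H g) ×
                     (∀ {z z′} → S.s ∼[ t ] z → S.s ∼[ t ] z′ → z S.≅ z′) → ∃[ h ] H h × Maps h x y × Fixes h c₁
                go (l , t , t⊑ , t-ns , H-t , rig) =
                  case U.realize idₐ maps-id (x ++ y) of λ { (B , r-B@(_ , _ , q , qt , _ , qs)) →
                  case same t t⊑ of λ { (h , ht , hxy) →
                  case U.R-unique h ht hxy (U.R-++ˡ r-B) (U.R-++ʳ r-B) of λ { (h′ , _ , h′xy , h′B) →
                  case rig (idₐ , maps-id , maps-id) (q , qt , qs) (x ++ y) of λ { (c₂ , r₂ , r₂′) →
                  case S.R-unique h′ h′B h′xy (S.R-++ˡ r₂′) (S.R-++ʳ r₂′) of λ { (h″ , h″B , h″xy , h″c) →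
                  case S.R-unique idₐ maps-id maps-id r₂ r of λ { (k , ks , kxy , kc) →
                    along k h″ k
                    , H-∘ {k} {h″ ∘ₐ inv k} (H-s {k} ks) (H-∘ {h″} {inv k} (fixes-base q (H-t {q} qt) qs h″ h″B) (H-inv {k} (H-s {k} ks)))
                    , maps-along k h″ k (maps-++ˡ k kxy) h″xy (maps-++ʳ k {x} {x} kxy)
                    , maps-along k h″ k kc h″c kc } } } } } }
                  where
                  fixes-base : ∀ q → H q → ∀ {B} → Maps q S.s B → ∀ h → Fixes h B → H h
                  fixes-base q Hq qs h hB = H-fix {h} {q ∘ₐ base} (H-∘ {q} {base} Hq H-base) λ i →
                    let (p , e) = base⊑ i in
                    trans (·-cong h (trans (·-cong q (sym e)) (qs p))) (trans (hB p) (trans (sym (qs p)) (·-cong q e)))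
                  U : Scheme l (InvariantScheme.Result.k (InvariantScheme.invariant-scheme HH c))
                  U = record { 𝒟 = 𝒜′ ; s = t ; s⊑𝒟 = t⊑ ; c = S.s ; c-ns = t-ns }
                  module U = Scheme U

          opaque
            c∼A : ∀ i → c ∼ A i over 𝒜
            c∼A i t t⊑ =
              let (g , _ , gt , gc) = S.R-unique idₐ maps-id maps-id (S.R-self t⊑) (A-real i t (mono {0} {i} ℕ.z≤n ∘ t⊑))
              in g , gt , maps-≈ˡ g (λ j → reflexive (≡.sym (c≈ j))) gc

          private opaque
            -- The comparison passes through `e′`, which realizes the global type over both `𝒜` and
            -- `g · 𝒜`: it has the type of `e` over the former and that of `d` over the latter.
            related : ∀ {d e : Tup n} → Generic d → e ⊨ P at w over 𝒜 →
                      ∀ i → S.R S.s d (A i) → S.R S.s e (A i) → ∃[ h ] H h × Maps h d e × Fixes h (A i)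
            related {d} {e} gen real-e i r-d r-e =
              case gen 𝒜 of λ { (e₁ , g , real₁ , Hg , gd) →
              case P-extend idₐ maps-id (set 𝒜 ∪ set (g ·ᵐ 𝒜))
                     (bounded-∪ {set 𝒜} {set (g ·ᵐ 𝒜)} (bounded-cmodel 𝒜) (bounded-cmodel (g ·ᵐ 𝒜))) of λ { (e′ , real′) →
              case S.realize idₐ maps-id ((e′ ++ e) ++ (e′ ++ d)) of λ { (c₁ , r₁) →
              case inseparable 𝒜 𝒜-base (same-e e′ (λ t t⊑ → real′ t (inj₁ ∘ t⊑))) (S.R-++ˡ {x = e′ ++ e} {e′ ++ d} r₁) of λ { (h₁ , Hh₁ , h₁e , h₁c) →
              case inseparable (g ·ᵐ 𝒜) (g ∘ₐ base , H-∘ {g} {base} Hg H-base , λ i → ∈-·ᵐ g 𝒜 (⊑𝒜 i))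
                     (same-d e₁ e′ g Hg gd real₁ (λ t t⊑ → real′ t (inj₂ ∘ t⊑))) (S.R-++ʳ {x = e′ ++ e} {e′ ++ d} r₁) of λ { (h₂ , Hh₂ , h₂d , h₂c) →
              case S.R-unique idₐ maps-id maps-id r-d (S.R-++ʳ {x = e′} {d} (S.R-++ʳ {x = e′ ++ e} {e′ ++ d} r₁)) of λ { (k₁ , k₁s , k₁d , k₁c) →
              case S.R-unique idₐ maps-id maps-id r-e (S.R-++ʳ {x = e′} {e} (S.R-++ˡ {x = e′ ++ e} {e′ ++ d} r₁)) of λ { (k₂ , k₂s , k₂e , k₂c) →
                along (inv k₁) (h₁ ∘ₐ inv h₂) (inv k₂)
                , H-∘ {inv k₂} {(h₁ ∘ₐ inv h₂) ∘ₐ inv (inv k₁)} (H-inv {k₂} (H-s {k₂} k₂s))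
                    (H-∘ {h₁ ∘ₐ inv h₂} {inv (inv k₁)} (H-∘ {h₁} {inv h₂} Hh₁ (H-inv {h₂} Hh₂)) (H-inv {inv k₁} (H-inv {k₁} (H-s {k₁} k₁s))))
                , maps-along (inv k₁) (h₁ ∘ₐ inv h₂) (inv k₂) (maps-inv k₁ k₁d) (maps-∘ h₁ (inv h₂) h₁e (maps-inv h₂ h₂d)) (maps-inv k₂ k₂e)
                , maps-along (inv k₁) (h₁ ∘ₐ inv h₂) (inv k₂) (maps-inv k₁ k₁c) (maps-∘ h₁ (inv h₂) h₁c (maps-inv h₂ h₂c)) (maps-inv k₂ k₂c)
                } } } } } } }
              where
              same-e : ∀ e′ → e′ ⊨ P at w over 𝒜 → e′ ∼ e over 𝒜
              same-e e′ real′ t t⊑ =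
                let (f , _ , ft , fe′) = PR-unique idₐ maps-id maps-id (real′ t t⊑) (real-e t t⊑) in f , ft , fe′
              same-d : ∀ e₁ e′ g → H g → Maps g e₁ d → e₁ ⊨ P at w over 𝒜 → e′ ⊨ P at w over (g ·ᵐ 𝒜) → e′ ∼ d over (g ·ᵐ 𝒜)
              same-d e₁ e′ g Hg gd real₁ real′ t t⊑ =
                let (h , _ , ht , he) = H-real g Hg {x = λ i → inv g · t i} (λ i → ·-inv g (t i))
                                          (real₁ (λ i → inv g · t i) (∈-·ᵐ⁻ g 𝒜 ∘ t⊑)) (real′ t t⊑)
                in g ∘ₐ inv h , maps-∘ g (inv h) (λ i → ·-inv g (t i)) (maps-inv h ht) , maps-∘ g (inv h) gd (maps-inv h he)

          opaque
            -- For late `i` the term `A i` is chosen after finite bases of `d` and `e`, so by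
            -- symmetry it realizes `S` over each of them and `related` applies. The Lascar
            -- hypothesis moves `c` to `A i` over `d`; for `e` this is done by `H`.
            unique : ∀ {d} → Generic d → (∀ c′ → c′ ⊑ᵐ limit → c ∼ c′ over 𝒜 → ∃[ h ] Maps h c c′ × Fixes h d) →
                     ∀ {e} → PR w c e → ∃[ h ] Fixes h c × Maps h d e
            unique {d} gen lascar {e₀} r₀ = go (local-character d limit) (local-character e limit)
              where
              X : Subset dom
              X = set limit ∪ range c
              ext : Σ[ e ∈ Tup n ] (∀ {j} (x : Tup j) → x ⊑ X → PR w x e)
              ext = P-extend idₐ maps-id X (bounded-∪ {set limit} {range c} (bounded-cmodel limit) (bounded-range c))
              e : Tup n
              e = proj₁ ext
              over : ∀ {x : Tup n} {l} (t : Tup l) → NonSplit x t (set limit) → ∀ i → t ⊑ᵐ stage i → S.R S.s x (A i)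
              over {x} t x-ns i t⊑ = S.R-++ʳ {x = []} {x′ = x}
                (realizes-over S (stage i) (stage (suc i)) (mono {0} {i} ℕ.z≤n ∘ S.s⊑𝒟) (mono (ℕ.n≤1+n i)) (A⊑ i) (A-real i) x t t⊑
                  (nonsplit-⊆ (⊆-limit (suc i)) x-ns) [] (λ ()))
              go : ∃[ k ] Σ[ s ∈ Tup k ] s ⊑ᵐ limit × NonSplit d s (set limit) →
                   ∃[ k ] Σ[ s ∈ Tup k ] s ⊑ᵐ limit × NonSplit e s (set limit) → ∃[ h ] Fixes h c × Maps h d e₀
              go (_ , t , t⊑ , d-ns) (_ , t′ , t′⊑ , e-ns) =
                case common {x = t ++ t′} (++-⊑ {X = set limit} t⊑ t′⊑) of λ { (i , tt⊑) →
                case related gen (λ x x⊑ → proj₂ ext x (λ j → inj₁ (⊆-limit 0 (x⊑ j)))) i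
                      (over t d-ns i (++-⊑ˡ {x = t} {t′} {X = set (stage i)} tt⊑))
                      (over t′ e-ns i (++-⊑ʳ {x = t} {t′} {X = set (stage i)} tt⊑)) of λ { (h₃ , Hh₃ , h₃d , h₃A) →
                case lascar (A i) (A⊑limit i) (c∼A i) of λ { (h₄ , h₄c , h₄d) →
                case H-real h₄ (H-c i h₄ h₄c) h₄c (proj₂ ext c (inj₂ ∘ ⊑-range)) (proj₂ ext (A i) (inj₁ ∘ A⊑limit i)) of λ { (h₅ , _ , h₅c , h₅e) →
                case PR-unique idₐ maps-id maps-id (proj₂ ext c (inj₂ ∘ ⊑-range)) r₀ of λ { (k , _ , kc , ke) →
                  k ∘ₐ (inv h₅ ∘ₐ (h₃ ∘ₐ h₄))
                  , maps-∘ k (inv h₅ ∘ₐ (h₃ ∘ₐ h₄)) kc (maps-∘ (inv h₅) (h₃ ∘ₐ h₄) (maps-inv h₅ h₅c) (maps-∘ h₃ h₄ h₃A h₄c))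
                  , maps-∘ k (inv h₅ ∘ₐ (h₃ ∘ₐ h₄)) ke (maps-∘ (inv h₅) (h₃ ∘ₐ h₄) (maps-inv h₅ h₅e) (maps-∘ h₃ h₄ h₃d h₄d))
                  } } } } }
                where
                A⊑limit : ∀ i → A i ⊑ᵐ limit
                A⊑limit i j = ⊆-limit (suc i) (A⊑ i j)
                H-c : ∀ i h → Maps h c (A i) → H h
                H-c i h p =
                  -- `q` also takes `c` to `A i`, but over a conjugate of `w` in `𝒜`, so it lies in
                  -- `H`; the remaining factor of `h` fixes `c` and hence `w`.
                  let (q , qw , qc) = c∼A i (λ j → base · w j) ⊑𝒜
                  in H-≈ {q ∘ₐ (inv q ∘ₐ h)} {h} (λ x → ·-inv q _)
                       (H-∘ {q} {inv q ∘ₐ h} (H-fix {q} {base} H-base qw)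
                         (H-supp {inv q ∘ₐ h} (w-in-c (inv q ∘ₐ h) (maps-∘ (inv q) h (maps-inv q qc) p))))

    open InMonster

    module _ (𝕄′ : SuperMonster 𝕄) where
      open SuperMonster 𝕄′ using (M′; ι; ι-strong; larger) renaming (homogeneous to homogeneous′)
      private
        module M′ = Structure M′

      -- Transfer between the monster and the supermonster

      module InSupermonster where
        open import Data.Vec.Functional using ([])
        open FUR fur using (large; noFin)
        open Homogeneous homogeneous
        open Types M δ hiding (Set⊂)
        open Injection using () renaming (to to ⟨_⟩)

        j : Carrier → M′.Carrier
        j = Embedding.to ι

        M′∈K : K M′
        M′∈K = proj₂ (strong⇒K ι-strong)

        κ′ : Setoid ℓ ℓ
        κ′ = M′.dom

        private
          module δ-small = Small δ δ.uncountable

        -- Since 𝒦 has arbitrarily large members, M has at least the size of every bounded set.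
        bounded-≲M : ∀ (X : Setoid ℓ ℓ) → X ≺ δ → X ≲ dom
        bounded-≲M X b with large X
        ... | A , A∈K , f with ls=ω A∈K (image (Injection.to f))
        ... | Y , closed , X⊆Y , strong , le =
          record { to = Embedding.to (proj₁ emb) ; cong = Embedding.cong (proj₁ emb) ; injective = Embedding.injective (proj₁ emb) }
          ⊙ X≲Y
          where
          module A = Structure A
          im : Subset A.dom
          im = image (Injection.to f)
          im≲X : ⟪ im ⟫ ≲ X
          im≲X = record
            { to        = λ (_ , x , _) → x
            ; cong      = λ { {_ , _ , p} {_ , _ , q} e → Injection.injective f (A.trans p (A.trans e (A.sym q))) }
            ; injective = λ { {_ , _ , p} {_ , _ , q} e → A.trans (A.sym p) (A.trans (Injection.cong f e) q) }
            }
          Y-small : ⟪ Y ⟫ ≺ δ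
          Y-small = δ-small.small-≲ (⊎ₛ-≲ (toReps X ⊙ im≲X) ⊙ le) (δ-small.small-+ℕ (δ-small.small-≲ (fromReps X) b))
          emb : Σ[ e ∈ Embedding (substructure A Y closed) M ] Strong e
          emb = universal (proj₁ (strong⇒K strong)) Y-small
          X≲Y : X ≲ ⟪ Y ⟫
          X≲Y = record { to = λ x → Injection.to f x , X⊆Y (x , A.refl) ; cong = Injection.cong f ; injective = Injection.injective f }

        bounded⇒small′ : ∀ (X : Setoid ℓ ℓ) → X ≺ δ → X ≺ κ′
        bounded⇒small′ X b = proj₁ larger ⊙ bounded-≲M X b , λ k → proj₂ larger (bounded-≲M X b ⊙ k)

        opaque
          ℕ≺κ′ : setoid ℕ ≺ κ′
          ℕ≺κ′ =
            let (f , h) = bounded⇒small′ (setoid (Lift ℓ ℕ)) (δ-small.small-≲ lift↣ δ.uncountable)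
            in f ⊙ lower↣ , λ k → h (lower↣ ⊙ k)

          -- `δ` is a strong limit, so a countable set has fewer than `δ` predicates, and `M` is at
          -- least as large as every bounded set.
          predicates-small : ∀ {Z : Set} → Z ↣ ℕ → setoid (Lift ℓ Z → Bool) ≺ κ′
          predicates-small {Z} f =
            let (g , h) = bounded⇒small′ (Lift ℓ Z →-setoid Bool) (δ.strong-limit (Lift ℓ Z) (δ-small.small-≲ (f ⊙ lift↣) δ.uncountable))
            in g ⊙ to→ , λ k → h (to→ ⊙ k)
            where
            to→ : setoid (Lift ℓ Z → Bool) ≲ (Lift ℓ Z →-setoid Bool)
            to→ = record { to = id ; cong = λ { ≡.refl _ → ≡.refl } ; injective = fe }

        module A′ = Tuples M′
        module D′ = Models 𝒦 ls=ω M′ M′∈K κ′ ℕ≺κ′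
        module H′ = D′.Homogeneous homogeneous′
        open Small κ′ ℕ≺κ′

        jX : Subset dom → Subset M′.dom
        jX X = image {I = ∃ (_∈ X)} (j ∘ proj₁)

        record Moved (𝒟 : CModel) (𝒩 : D′.CModel) : Set (lsuc ℓ) where
          field
            f     : A′.Aut
            fix   : ∀ {x} → x ∈ set 𝒟 → f A′.· j x M′.≈ j x
            k     : Embedding (Model.structure (D′.model 𝒩)) M
            k-strong : Strong k
            f≈jk  : ∀ x → f A′.· proj₁ x M′.≈ j (Embedding.to k x)

        opaque
          -- Universality embeds `𝒩` in `M` but may displace `𝒟`; the displacement extends to an
          -- automorphism of `M`, which is undone. Homogeneity of `M′` extends the corrected
          -- embedding.
          move : ∀ 𝒟 𝒩 → (∀ {x} → x ∈ set 𝒟 → j x ∈ D′.set 𝒩) → Moved 𝒟 𝒩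
          move 𝒟 𝒩 i = record
            { f = f ; fix = λ {x} p → M′.trans (f≈ (j x , i p)) (Embedding.cong ι (trans (·-cong (inv g) (sym (ge≈ p))) (inv-· g refl)))
            ; k = k ; k-strong = ∘-closed (aut-strong (inv g)) (proj₂ h) ; f≈jk = f≈ }
            where
            h : Σ[ h ∈ Embedding (Model.structure (D′.model 𝒩)) M ] Strong h
            h = universal (proj₁ (strong⇒K (IsModel.strong (D′.isModel 𝒩))))
                  (δ-small.small-≲ (D′.countable 𝒩) δ.uncountable)
            𝒟s : Structure L
            𝒟s = Model.structure (model 𝒟)
            e : Σ[ e ∈ Embedding 𝒟s (Model.structure (D′.model 𝒩)) ] Strong e × (∀ x → proj₁ (Embedding.to e x) ≡ j (proj₁ x))
            e = D′.corestrict (ι ∘ₑ inclusion M (set 𝒟) (IsModel.closed (isModel 𝒟))) (∘-closed ι-strong (IsModel.strong (isModel 𝒟)))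
                  (D′.isModel 𝒩) (λ (x , p) → i p)
            ext : Σ[ g ∈ Aut ] ∀ x → g · proj₁ x ≈ Embedding.to (proj₁ h) (Embedding.to (proj₁ e) x)
            ext = extend-strong (model 𝒟) (proj₁ h ∘ₑ proj₁ e) (∘-closed (proj₂ h) (proj₁ (proj₂ e)))
            g : Aut
            g = proj₁ ext
            ge≈ : ∀ {x} (p : x ∈ set 𝒟) → g · x ≈ Embedding.to (proj₁ h) (j x , i p)
            ge≈ p = trans (proj₂ ext (_ , p)) (Embedding.cong (proj₁ h) (M′.reflexive (proj₂ (proj₂ e) (_ , p))))
            k : Embedding (Model.structure (D′.model 𝒩)) M
            k = Automorphism.embedding (inv g) ∘ₑ proj₁ h
            ext′ : Σ[ f ∈ A′.Aut ] ∀ x → f A′.· proj₁ x M′.≈ j (Embedding.to k x)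
            ext′ = H′.extend-strong (D′.model 𝒩) (ι ∘ₑ k) (∘-closed ι-strong (∘-closed (aut-strong (inv g)) (proj₂ h)))
            f : A′.Aut
            f = proj₁ ext′
            f≈ : ∀ x → f A′.· proj₁ x M′.≈ j (Embedding.to k x)
            f≈ = proj₂ ext′

        jX-countable : ∀ (𝒟 : CModel) → D′.Countable⊂ (jX (set 𝒟))
        jX-countable 𝒟 = countable 𝒟 ⊙ record
          { to        = λ (_ , x , _) → x
          ; cong      = λ { {_ , _ , p} {_ , _ , q} e → Embedding.injective ι (M′.trans p (M′.trans e (M′.sym q))) }
          ; injective = λ { {_ , _ , p} {_ , _ , q} e → M′.trans (M′.sym p) (M′.trans (Embedding.cong ι e) q) }
          }

        cmodel-⊇ : ∀ {n} (x : Tup n) → Σ[ 𝒟 ∈ CModel ] x ⊑ᵐ 𝒟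
        cmodel-⊇ x = let (𝒟 , h) = cmodel (range x) (countable-range x) in 𝒟 , λ i → h (⊑-range i)

        opaque
          lift-maps : ∀ {n} {x y : Tup n} g → Maps g x y → ∃[ f ] A′.Maps f (j ∘ x) (j ∘ y)
          lift-maps {x = x} {y} g p = go (cmodel-⊇ x)
            where
            go : Σ[ 𝒟 ∈ CModel ] x ⊑ᵐ 𝒟 → ∃[ f ] A′.Maps f (j ∘ x) (j ∘ y)
            go (𝒟 , x⊑) = go′ (D′.cmodel (jX (set 𝒟)) (jX-countable 𝒟))
              where
              go′ : Σ[ 𝒩 ∈ D′.CModel ] jX (set 𝒟) ⊆ D′.set 𝒩 → ∃[ f ] A′.Maps f (j ∘ x) (j ∘ y)
              go′ (𝒩 , i) = proj₁ ext , λ l → M′.trans (proj₂ ext (j (x l) , i ((_ , x⊑ l) , M′.refl)))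
                  (Embedding.cong ι (trans (·-cong g (Embedding.injective ι (M′.trans (M′.sym (m.f≈jk _)) (m.fix (x⊑ l))))) (p l)))
                where
                m : Moved 𝒟 𝒩
                m = move 𝒟 𝒩 (λ p → i ((_ , p) , M′.refl))
                module m = Moved m
                ext : Σ[ f ∈ A′.Aut ] ∀ x → f A′.· proj₁ x M′.≈ j (g · Embedding.to m.k x)
                ext = H′.extend-strong (D′.model 𝒩) (ι ∘ₑ (Automorphism.embedding g ∘ₑ m.k))
                        (∘-closed ι-strong (∘-closed (aut-strong g) m.k-strong))

        opaque
          -- The image of a model around `x` under `f` may leave `M`; a countable model containing
          -- it is moved back into `M` over a model containing `y`.
          unlift-maps : ∀ {n} {x y : Tup n} f → A′.Maps f (j ∘ x) (j ∘ y) → ∃[ g ] Maps g x y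
          unlift-maps {x = x} {y} f p = go (cmodel-⊇ x) (cmodel-⊇ y)
            where
            go : Σ[ 𝒟 ∈ CModel ] x ⊑ᵐ 𝒟 → Σ[ 𝒟 ∈ CModel ] y ⊑ᵐ 𝒟 → ∃[ g ] Maps g x y
            go (𝒟 , x⊑) (𝒟y , y⊑) = go′ (D′.cmodel (A′fj ∪ jX (set 𝒟y)) (D′.countable-∪ {A′fj} {jX (set 𝒟y)}
                                          (jX-countable 𝒟 ⊙ D′.aut-image-≲ f (jX (set 𝒟))) (jX-countable 𝒟y)))
              where
              A′fj : Subset M′.dom
              A′fj = D′.aut-image f (jX (set 𝒟))
              go′ : Σ[ 𝒩 ∈ D′.CModel ] (A′fj ∪ jX (set 𝒟y)) ⊆ D′.set 𝒩 → ∃[ g ] Maps g x y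
              go′ (𝒩 , i) = proj₁ ext , λ l → trans (proj₂ ext (x l , x⊑ l))
                  (trans (Embedding.cong m.k (M′.trans (M′.reflexive (proj₂ (proj₂ e) (x l , x⊑ l))) (p l)))
                         (Embedding.injective ι (M′.trans (M′.sym (m.f≈jk (j (y l) , i (inj₂ ((_ , y⊑ l) , M′.refl))))) (m.fix (y⊑ l)))))
                where
                m : Moved 𝒟y 𝒩
                m = move 𝒟y 𝒩 (λ p → i (inj₂ ((_ , p) , M′.refl)))
                module m = Moved m
                e : Σ[ e ∈ Embedding (Model.structure (model 𝒟)) (Model.structure (D′.model 𝒩)) ]
                      Strong e × (∀ x → proj₁ (Embedding.to e x) ≡ f A′.· j (proj₁ x))
                e = D′.corestrict (Automorphism.embedding f ∘ₑ (ι ∘ₑ inclusion M (set 𝒟) (IsModel.closed (isModel 𝒟))))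
                      (∘-closed (D′.aut-strong f) (∘-closed ι-strong (IsModel.strong (isModel 𝒟))))
                      (D′.isModel 𝒩) (λ (x , p) → i (inj₁ ((_ , (_ , p) , M′.refl) , M′.refl)))
                ext : Σ[ g ∈ Aut ] ∀ x → g · proj₁ x ≈ Embedding.to m.k (Embedding.to (proj₁ e) x)
                ext = extend-strong (model 𝒟) (m.k ∘ₑ proj₁ e) (∘-closed m.k-strong (proj₁ (proj₂ e)))

        -- Reduces a question about a countable model and a tuple of `M′` to one about `M`, where
        -- the axioms of a FUR-class are available.
        record Transfer (𝒟 : CModel) (𝒜 : D′.CModel) {n} (x : A′.Tup n) : Set (lsuc ℓ) where
          field
            f    : A′.Aut
            fix  : ∀ {x} → x ∈ set 𝒟 → f A′.· j x M′.≈ j x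
            𝒜₀   : CModel
            into : ∀ {y} → y ∈ D′.set 𝒜 → ∃[ z ] z ∈ set 𝒜₀ × f A′.· y M′.≈ j z
            onto : ∀ {z} → z ∈ set 𝒜₀ → ∃[ y ] y ∈ D′.set 𝒜 × f A′.· y M′.≈ j z
            x₀   : Tup n
            fx   : A′.Maps f x (j ∘ x₀)

        opaque
          transfer : ∀ 𝒟 𝒜 {n} (x : A′.Tup n) → Transfer 𝒟 𝒜 x
          transfer 𝒟 𝒜 x = go (D′.cmodel (jX (set 𝒟) ∪ (D′.set 𝒜 ∪ range x))
              (D′.countable-∪ {jX (set 𝒟)} {D′.set 𝒜 ∪ range x} (jX-countable 𝒟)
                (D′.countable-∪ {D′.set 𝒜} {range x} (D′.countable 𝒜) (D′.countable-range x))))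
            where
            go : Σ[ 𝒩 ∈ D′.CModel ] (jX (set 𝒟) ∪ (D′.set 𝒜 ∪ range x)) ⊆ D′.set 𝒩 → Transfer 𝒟 𝒜 x
            go (𝒩 , i) = record
              { f = m.f ; fix = m.fix
              ; 𝒜₀ = record
                { set = image (Embedding.to e₀) ; isModel = image-isModel e₀ (∘-closed m.k-strong (proj₁ (proj₂ e)))
                ; countable = D′.countable 𝒜 ⊙ record
                  { to        = λ (_ , x , _) → x
                  ; cong      = λ { {_ , _ , p} {_ , _ , q} e → Embedding.injective e₀ (trans p (trans e (sym q))) }
                  ; injective = λ { {_ , _ , p} {_ , _ , q} e → trans (sym p) (trans (Embedding.cong e₀ e) q) }
                  } }
              ; into = λ p → Embedding.to e₀ (_ , p) , ((_ , p) , refl) , f≈ p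
              ; onto = λ { ((y , p) , e) → y , p , M′.trans (f≈ p) (Embedding.cong ι e) }
              ; x₀ = λ l → Embedding.to m.k (x l , i (inj₂ (inj₂ (A′.⊑-range l))))
              ; fx = λ l → m.f≈jk _ }
              where
              m : Moved 𝒟 𝒩
              m = move 𝒟 𝒩 (λ p → i (inj₁ ((_ , p) , M′.refl)))
              module m = Moved m
              e : Σ[ e ∈ Embedding (Model.structure (D′.model 𝒜)) (Model.structure (D′.model 𝒩)) ]
                    Strong e × (∀ x → proj₁ (Embedding.to e x) ≡ proj₁ x)
              e = D′.corestrict (inclusion M′ (D′.set 𝒜) (IsModel.closed (D′.isModel 𝒜))) (IsModel.strong (D′.isModel 𝒜))
                    (D′.isModel 𝒩) (λ (_ , p) → i (inj₂ (inj₁ p)))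
              e₀ : Embedding (Model.structure (D′.model 𝒜)) M
              e₀ = m.k ∘ₑ proj₁ e
              f≈ : ∀ {y} (p : y ∈ D′.set 𝒜) → m.f A′.· y M′.≈ j (Embedding.to e₀ (y , p))
              f≈ {y} p = M′.trans (A′.·-cong m.f (M′.sym (M′.reflexive (proj₂ (proj₂ e) (y , p))))) (m.f≈jk (Embedding.to (proj₁ e) (y , p)))

          move-tuple : ∀ 𝒟 {n} (x : A′.Tup n) → ∃[ f ] (∀ {x} → x ∈ set 𝒟 → f A′.· j x M′.≈ j x) × ∃[ x₀ ] A′.Maps f x (j ∘ x₀)
          move-tuple 𝒟 x =
            let t = transfer 𝒟 (proj₁ (D′.cmodel (range x) (D′.countable-range x))) x
            in Transfer.f t , Transfer.fix t , Transfer.x₀ t , Transfer.fx t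

        ⊑-choose : ∀ {𝒟 𝒜 n} {x : A′.Tup n} (t : Transfer 𝒟 𝒜 x) {m} (b : A′.Tup m) → b D′.⊑ᵐ 𝒜 →
                   ∃[ b₀ ] b₀ ⊑ᵐ Transfer.𝒜₀ t × A′.Maps (Transfer.f t) b (j ∘ b₀)
        ⊑-choose t b p = (λ i → proj₁ (Transfer.into t (p i))) , (λ i → proj₁ (proj₂ (Transfer.into t (p i))))
                       , (λ i → proj₂ (proj₂ (Transfer.into t (p i))))

        maps-j++ : ∀ {m n} (g : A′.Aut) {x y : Tup m} {x′ y′ : Tup n} → A′.Maps g (j ∘ x) (j ∘ y) → A′.Maps g (j ∘ x′) (j ∘ y′) →
                   A′.Maps g (j ∘ (x ++ x′)) (j ∘ (y ++ y′))
        maps-j++ {m} g p q i with splitAt m i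
        ... | inj₁ l = p l
        ... | inj₂ l = q l

        maps-j++ˡ : ∀ {m n} (g : A′.Aut) {x y : Tup m} {x′ y′ : Tup n} → A′.Maps g (j ∘ (x ++ x′)) (j ∘ (y ++ y′)) → A′.Maps g (j ∘ x) (j ∘ y)
        maps-j++ˡ g {x} {y} {x′} {y′} p i =
          M′.trans (A′.·-cong g (Embedding.cong ι (sym (++-↑ˡ x x′ i)))) (M′.trans (p _) (Embedding.cong ι (++-↑ˡ y y′ i)))

        maps-j++ʳ : ∀ {m n} (g : A′.Aut) {x y : Tup m} {x′ y′ : Tup n} → A′.Maps g (j ∘ (x ++ x′)) (j ∘ (y ++ y′)) → A′.Maps g (j ∘ x′) (j ∘ y′)
        maps-j++ʳ g {x} {y} {x′} {y′} p i =
          M′.trans (A′.·-cong g (Embedding.cong ι (sym (++-↑ʳ x x′ i)))) (M′.trans (p _) (Embedding.cong ι (++-↑ʳ y y′ i)))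

        anyModel : CModel
        anyModel = proj₁ (cmodel (range []) (countable-range []))

        opaque
          local-character-countable : ∀ (𝒜 : D′.CModel) {n} (x : A′.Tup n) →
                                      ∃[ k ] Σ[ s ∈ A′.Tup k ] s D′.⊑ᵐ 𝒜 × A′.NonSplit x s (D′.set 𝒜)
          local-character-countable 𝒜 x = go (transfer anyModel 𝒜 x)
            where
            go : Transfer anyModel 𝒜 x → ∃[ k ] Σ[ s ∈ A′.Tup k ] s D′.⊑ᵐ 𝒜 × A′.NonSplit x s (D′.set 𝒜)
            go t = go′ (local-character T.x₀ T.𝒜₀)
              where
              module T = Transfer t
              go′ : ∃[ k ] Σ[ s ∈ Tup k ] s ⊑ᵐ T.𝒜₀ × NonSplit T.x₀ s (set T.𝒜₀) →
                    ∃[ k ] Σ[ s ∈ A′.Tup k ] s D′.⊑ᵐ 𝒜 × A′.NonSplit x s (D′.set 𝒜)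
              go′ (k , s₀ , s₀⊑ , ns₀) = k , s , (λ i → proj₁ (proj₂ (T.onto (s₀⊑ i)))) , A′.nonsplit nsp
                where
                s : A′.Tup k
                s i = proj₁ (T.onto (s₀⊑ i))
                fs : A′.Maps T.f s (j ∘ s₀)
                fs i = proj₂ (proj₂ (T.onto (s₀⊑ i)))
                nsp : ∀ {m} (b d : A′.Tup m) → b ⊑ D′.set 𝒜 → d ⊑ D′.set 𝒜 → b A′.∼[ s ] d →
                      ∃[ g ] A′.Fixes g s × A′.Maps g b d × A′.Fixes g x
                nsp b d b⊑ d⊑ (g , gs , gb) =
                  case ⊑-choose t b b⊑ of λ { (b₀ , b₀⊑ , fb) →
                  case ⊑-choose t d d⊑ of λ { (d₀ , d₀⊑ , fd) →
                  case unlift-maps {x = s₀ ++ b₀} {s₀ ++ d₀} (A′.along T.f g T.f)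
                         (maps-j++ (A′.along T.f g T.f) {s₀} {s₀} {b₀} {d₀}
                           (A′.maps-along T.f g T.f fs gs fs) (A′.maps-along T.f g T.f fb gb fd)) of λ { (g₀ , p₀) →
                  case ns ns₀ b₀ d₀ b₀⊑ d₀⊑ (g₀ , maps-++ˡ g₀ p₀ , maps-++ʳ g₀ {s₀} {s₀} p₀) of λ { (g₁ , u , v , w) →
                  case lift-maps {x = (s₀ ++ b₀) ++ T.x₀} {(s₀ ++ d₀) ++ T.x₀} g₁ (maps-++ g₁ (maps-++ g₁ u v) w) of λ { (h , q) →
                    let sb = maps-j++ˡ h {s₀ ++ b₀} {s₀ ++ d₀} q in
                    A′.conj T.f h , A′.maps-conj T.f h fs fs (maps-j++ˡ h {s₀} {s₀} sb)
                    , A′.maps-conj T.f h fb fd (maps-j++ʳ h {s₀} {s₀} sb)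
                    , A′.maps-conj T.f h T.fx T.fx (maps-j++ʳ h {s₀ ++ b₀} {s₀ ++ d₀} q) } } } } }

        tuples↣list : ∀ {a} {X : Set a} → Σ[ k ∈ ℕ ] Vector X k ↣ List X
        tuples↣list {X = X} = mk↣ (λ (_ , f) → tabulate f) inj
          where
          inj : ∀ {u v : Σ[ k ∈ ℕ ] Vector X k} → tabulate (proj₂ u) ≡ tabulate (proj₂ v) → u ≡ v
          inj {k , f} {k′ , f′} e with ≡.trans (≡.sym (length-tabulate f)) (≡.trans (≡.cong length e) (length-tabulate f′))
          ... | ≡.refl = ≡.cong (k ,_) (Injection.injective (tabulate↣ k) e)

        fin-pairs : ∀ {a} {X : Set a} (n : X → ℕ) → Σ[ x ∈ X ] Fin (n x) ↣ X × ℕ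
        fin-pairs {X = X} n = mk↣ (λ (x , i) → x , toℕ i) inj
          where
          inj : ∀ {u v : Σ[ x ∈ X ] Fin (n x)} → (proj₁ u , toℕ (proj₂ u)) ≡ (proj₁ v , toℕ (proj₂ v)) → u ≡ v
          inj {x , i} {y , k} e with ≡.cong proj₁ e
          ... | ≡.refl = ≡.cong (x ,_) (toℕ-injective (≡.cong proj₂ e))

        module _ {Y : Subset M′.dom} (Y-model : IsModel 𝒦 M′ Y) {n} (x : A′.Tup n) where
          private
            Base : Set ℓ
            Base = ∃[ k ] Σ[ s ∈ A′.Tup k ] s ⊑ Y × A′.NonSplit x s Y

            record Splitting {k} (s : A′.Tup k) : Set ℓ where
              field
                m   : ℕ
                b d : A′.Tup m
                b⊑  : b ⊑ Y
                d⊑  : d ⊑ Y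
                b∼d : b A′.∼[ s ] d
                bad : ¬ (∃[ g ] A′.Fixes g s × A′.Maps g b d × A′.Fixes g x)

            -- If every finite subset of Y fails to be a base, then so does every
            -- finite subset of some countable model inside Y.
            module _ (none : ¬ Base) where
              splitting : ∀ {k} (s : A′.Tup k) → s ⊑ Y → Splitting s
              splitting s s⊑ = by-contradiction λ no-split → none (_ , s , s⊑ , A′.nonsplit λ b d b⊑ d⊑ p →
                by-contradiction λ bad → no-split (record { b = b ; d = d ; b⊑ = b⊑ ; d⊑ = d⊑ ; b∼d = p ; bad = bad }))

              module Next (𝒜 : D′.CModel) (⊆Y : D′.set 𝒜 ⊆ Y) where
                -- Only tuples of representatives are considered: they are countably many, so their
                -- splittings can all be added in one step.
                Q : Set ℓ
                Q = Σ[ k ∈ ℕ ] Vector (Reps ⟪ D′.set 𝒜 ⟫) k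
                tuple : (q : Q) → A′.Tup (proj₁ q)
                tuple (_ , u) i = proj₁ (proj₁ (u i))
                W : (q : Q) → Splitting (tuple q)
                W q = splitting (tuple q) (λ i → ⊆Y (proj₂ (proj₁ (proj₂ q i))))
                Z : Set ℓ
                Z = Σ[ q ∈ Q ] Fin (Splitting.m (W q) + Splitting.m (W q))
                el : Z → M′.Carrier
                el (q , i) = (Splitting.b (W q) ++ Splitting.d (W q)) i
                X : Subset M′.dom
                X = image el
                Q-countable : Q ↣ ℕ
                Q-countable = infinite-list ≲-refl ⊙ List-↣ (D′.countable 𝒜 ⊙ fromReps ⟪ D′.set 𝒜 ⟫) ⊙ tuples↣list
                X-countable : D′.Countable⊂ X
                X-countable = ℕ×ℕ↣ℕ ⊙ ×-↣ Q-countable ≲-refl ⊙ fin-pairs (λ q → Splitting.m (W q) + Splitting.m (W q)) ⊙ cover-≲ X el id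
                X⊆Y : X ⊆ Y
                X⊆Y ((q , i) , e) = Subset.resp Y e (A′.++-⊑ {X = Y} (Splitting.b⊑ (W q)) (Splitting.d⊑ (W q)) i)
                opaque
                 next : Σ[ ℬ ∈ D′.CModel ] (D′.set 𝒜 ∪ X) ⊆ D′.set ℬ × D′.set ℬ ⊆ Y
                 next = D′.cmodel-in Y-model (D′.set 𝒜 ∪ X) (D′.countable-∪ {D′.set 𝒜} {X} (D′.countable 𝒜) X-countable)
                          (λ { (inj₁ p) → ⊆Y p ; (inj₂ p) → X⊆Y p })

              start : Σ[ 𝒜 ∈ D′.CModel ] range [] ⊆ D′.set 𝒜 × D′.set 𝒜 ⊆ Y
              start = D′.cmodel-in Y-model (range []) (D′.countable-range []) (λ { (() , _) })

              stage : ℕ → Σ[ 𝒜 ∈ D′.CModel ] D′.set 𝒜 ⊆ Y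
              stage zero    = proj₁ start , proj₂ (proj₂ start)
              stage (suc i) = proj₁ (Next.next (proj₁ (stage i)) (proj₂ (stage i))) , proj₂ (proj₂ (Next.next (proj₁ (stage i)) (proj₂ (stage i))))

              increasing : ∀ i → proj₁ (stage i) D′.⊆ᵐ proj₁ (stage (suc i))
              increasing i p = proj₁ (proj₂ (Next.next (proj₁ (stage i)) (proj₂ (stage i)))) (inj₁ p)

              open D′.Chain (proj₁ ∘ stage) increasing

              absurd : ⊥
              absurd = go (local-character-countable limit x)
                where
                go : ∃[ k ] Σ[ s ∈ A′.Tup k ] s D′.⊑ᵐ limit × A′.NonSplit x s (D′.set limit) → ⊥
                go (k , s , s⊑ , s-ns) = go′ (common s⊑)
                  where
                  go′ : ∃[ i ] s D′.⊑ᵐ proj₁ (stage i) → ⊥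
                  go′ (i , s⊑i) = W.bad (finish (A′.ns s-ns W.b W.d b⊑ d⊑ (proj₁ W.b∼d , s∼ (proj₁ W.b∼d) (proj₁ (proj₂ W.b∼d)) , proj₂ (proj₂ W.b∼d))))
                    where
                    module N = Next (proj₁ (stage i)) (proj₂ (stage i))
                    q : N.Q
                    q = k , λ l → Injection.to (toReps ⟪ D′.set (proj₁ (stage i)) ⟫) (s l , s⊑i l)
                    module W = Splitting (N.W q)
                    s≈ : ∀ l → s l M′.≈ N.tuple q l
                    s≈ l = rep-≈ ⟪ D′.set (proj₁ (stage i)) ⟫ (s l , s⊑i l)
                    s∼ : ∀ g → A′.Fixes g (N.tuple q) → A′.Fixes g s
                    s∼ g p = A′.maps-≈ˡ g s≈ (A′.maps-≈ʳ g (λ l → M′.sym (s≈ l)) p)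
                    bd⊑ : (W.b ++ W.d) D′.⊑ᵐ limit
                    bd⊑ l = ⊆-limit (suc i) (proj₁ (proj₂ N.next) (inj₂ ((q , l) , M′.refl)))
                    b⊑ : W.b D′.⊑ᵐ limit
                    b⊑ = A′.++-⊑ˡ {x = W.b} {W.d} {D′.set limit} bd⊑
                    d⊑ : W.d D′.⊑ᵐ limit
                    d⊑ = A′.++-⊑ʳ {x = W.b} {W.d} {D′.set limit} bd⊑
                    finish : ∃[ g ] A′.Fixes g s × A′.Maps g W.b W.d × A′.Fixes g x → ∃[ g ] A′.Fixes g (N.tuple q) × A′.Maps g W.b W.d × A′.Fixes g x
                    finish (g , u , v , w) = g , A′.maps-≈ˡ g (λ l → M′.sym (s≈ l)) (A′.maps-≈ʳ g s≈ u) , v , w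

          opaque
            local-character′ : Base
            local-character′ = by-contradiction absurd

        element : Carrier
        element = pick em
          where
          pick : Dec Carrier → Carrier
          pick (yes x) = x
          pick (no ¬x) = ⊥-elim (noFin M∈K 0 (record { to = ⊥-elim ∘ ¬x ; cong = λ {x} → ⊥-elim (¬x x) ; injective = λ {x} → ⊥-elim (¬x x) }))

        opaque
          -- A single countable model realizes every type over `∅`, by s-saturation. Hence tuples of
          -- numbers code all these types.
          enumeration : Σ[ a ∈ (ℕ → Carrier) ] (∀ {n} (x : A′.Tup n) → Σ[ u ∈ Vector ℕ n ] ∃[ g ] A′.Maps g x (j ∘ a ∘ u))
          enumeration = a , λ x → go x (move-tuple anyModel x)
            where
            pick : ∀ n → Dec (∃[ p ] ⟨ countable anyModel ⟩ p ≡ n) → Carrier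
            pick n (yes ((x , _) , _)) = x
            pick n (no _)              = element
            pick-≈ : ∀ {x} (p : x ∈ set anyModel) d → pick (⟨ countable anyModel ⟩ (x , p)) d ≈ x
            pick-≈ p (yes (q , e)) = Injection.injective (countable anyModel) e
            pick-≈ p (no ¬q)       = ⊥-elim (¬q (_ , ≡.refl))
            a : ℕ → Carrier
            a n = pick n em
            go : ∀ {n} (x : A′.Tup n) → ∃[ f ] (∀ {x} → x ∈ set anyModel → f A′.· j x M′.≈ j x) × ∃[ x₀ ] A′.Maps f x (j ∘ x₀) →
                 Σ[ u ∈ Vector ℕ n ] ∃[ g ] A′.Maps g x (j ∘ a ∘ u)
            go x (f , _ , x₀ , fx) =
              let (b , b⊑ , g , _ , gb) = s-saturated anyModel x₀ [] (λ ())
                  (h , hb) = lift-maps g gb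
              in (λ i → ⟨ countable anyModel ⟩ (b i , b⊑ i)) , A′.inv h A′.∘ₐ f
                 , A′.maps-∘ (A′.inv h) f (A′.maps-≈ʳ (A′.inv h) (λ i → Embedding.cong ι (sym (pick-≈ (b⊑ i) em))) (A′.maps-inv h hb)) fx

        code : ∀ {n} → List ℕ → A′.Tup n
        code l i = j (proj₁ enumeration (nth 0 l (toℕ i)))

        opaque
          encode : ∀ {n} (x : A′.Tup n) → ∃[ l ] ∃[ g ] A′.Maps g x (code l)
          encode x =
            let (u , g , gx) = proj₂ enumeration x
            in tabulate u , g , A′.maps-≈ʳ g (λ i → M′.reflexive (≡.cong (j ∘ proj₁ enumeration) (≡.sym (nth-tabulate 0 u i)))) gx

        -- A type over a submodel Y of M′ is determined by a base and the types
        -- over ∅ realized together with the base: there are few types over Y.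
        module Code {Y : Subset M′.dom} (Y-model : IsModel 𝒦 M′ Y) (Y-small : ⟪ Y ⟫ ≺ κ′) where
          private
            U : Set ℓ
            U = Σ[ k ∈ ℕ ] Vector (Reps ⟪ Y ⟫) k

            tuple : (u : U) → A′.Tup (proj₁ u)
            tuple (_ , v) i = proj₁ (proj₁ (v i))

            Related : ∀ {n} (u : U) (x : A′.Tup n) (m : ℕ) (l l′ : List ℕ) → Set ℓ
            Related u x m l l′ = Σ[ t ∈ A′.Tup m ] t ⊑ Y ×
              (∃[ g ] A′.Maps g (tuple u ++ t) (code l)) × (∃[ g ] A′.Maps g ((tuple u ++ t) ++ x) (code l′))

            Θ : Set ℓ
            Θ = Lift ℓ (ℕ × List ℕ × List ℕ) → Bool

            θ : ∀ {n} → U → A′.Tup n → Θ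
            θ u x (lift (m , l , l′)) = truth (Related u x m l l′)

            base : ∀ {n} (x : A′.Tup n) → Σ[ u ∈ U ] A′.NonSplit x (tuple u) Y
            base x =
              let (k , s , s⊑ , x-ns) = local-character′ Y-model x
                  u = k , λ i → ⟨ toReps ⟪ Y ⟫ ⟩ (s i , s⊑ i)
                  s≈ = λ i → rep-≈ ⟪ Y ⟫ (s i , s⊑ i)
              in u , A′.nonsplit λ b d b⊑ d⊑ (g , gu , gb) →
                   let (g′ , p , q , r) = A′.ns x-ns b d b⊑ d⊑ (g , A′.maps-≈ˡ g s≈ (A′.maps-≈ʳ g (λ i → M′.sym (s≈ i)) gu) , gb)
                   in g′ , A′.maps-≈ˡ g′ (λ i → M′.sym (s≈ i)) (A′.maps-≈ʳ g′ s≈ p) , q , r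

          Types : Set ℓ
          Types = U × Θ

          opaque
            types-small : setoid Types ≺ κ′
            types-small = small-× (small-≲ tuples↣list (small-List (small-≲ (fromReps ⟪ Y ⟫) Y-small)))
              (predicates-small (ℕ×ℕ↣ℕ ⊙ ×-↣ ≲-refl (ℕ×ℕ↣ℕ ⊙ ×-↣ list list)))
              where
              list : List ℕ ↣ ℕ
              list = infinite-list ≲-refl

            typeOf : ∀ {n} → A′.Tup n → Types
            typeOf x = proj₁ (base x) , θ (proj₁ (base x)) x

            -- Equal codes give a common base `u` and, for each `t`, a tuple `t′` in `Y` related to
            -- `y` as `t` is to `x`. As `y` does not split over `u`, `t′` may be exchanged for `t`.
            typeOf-∼ : ∀ {n} {x y : A′.Tup n} → typeOf x ≡ typeOf y → ∀ {k} (t : A′.Tup k) → t ⊑ Y → x A′.∼[ t ] y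
            typeOf-∼ {x = x} {y} e {k} t t⊑ =
              go (proj₁ (base x)) (proj₁ (base y)) (≡.cong proj₁ e) (≡.cong proj₂ e) (proj₂ (base y)) (encode (tuple ux ++ t)) (encode ((tuple ux ++ t) ++ x))
              where
              ux : U
              ux = proj₁ (base x)
              go : ∀ u u′ → u ≡ u′ → θ u x ≡ θ u′ y → A′.NonSplit y (tuple u′) Y →
                   ∃[ l ] ∃[ g ] A′.Maps g (tuple u ++ t) (code l) → ∃[ l ] ∃[ g ] A′.Maps g ((tuple u ++ t) ++ x) (code l) → x A′.∼[ t ] y
              go u .u ≡.refl θ≡ y-ns (l , g , gl) (l′ , g′ , gl′)
                with truth-elim {P = Related u y k l l′} (≡.trans (≡.sym (≡.cong-app θ≡ (lift (k , l , l′))))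
                       (truth-intro {P = Related u x k l l′} (t , t⊑ , (g , gl) , (g′ , gl′))))
              ... | t′ , t′⊑ , (h , hl) , (h′ , hl′)
                with A′.ns y-ns t′ t t′⊑ t⊑ (A′.inv g A′.∘ₐ h
                       , A′.maps-++ˡ (A′.inv g A′.∘ₐ h) (A′.maps-∘ (A′.inv g) h (A′.maps-inv g gl) hl)
                       , A′.maps-++ʳ (A′.inv g A′.∘ₐ h) {tuple u} {tuple u} (A′.maps-∘ (A′.inv g) h (A′.maps-inv g gl) hl))
              ... | f , fu , ft , fy = f′ , maps-t , A′.maps-∘ f (A′.inv h′ A′.∘ₐ g′) fy (A′.maps-++ʳ (A′.inv h′ A′.∘ₐ g′) {tuple u ++ t} {tuple u ++ t′} utx)
                where
                f′ : A′.Aut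
                f′ = f A′.∘ₐ (A′.inv h′ A′.∘ₐ g′)
                utx : A′.Maps (A′.inv h′ A′.∘ₐ g′) ((tuple u ++ t) ++ x) ((tuple u ++ t′) ++ y)
                utx = A′.maps-∘ (A′.inv h′) g′ (A′.maps-inv h′ hl′) gl′
                maps-t : A′.Fixes f′ t
                maps-t = A′.maps-∘ f (A′.inv h′ A′.∘ₐ g′) ft
                  (A′.maps-++ʳ (A′.inv h′ A′.∘ₐ g′) {tuple u} {tuple u} (A′.maps-++ˡ (A′.inv h′ A′.∘ₐ g′) {tuple u ++ t} {tuple u ++ t′} utx))

      open InSupermonster

      -- Lascar types in the supermonster, and their lifting property

      module LascarTypes {k₀ : ℕ} (s₀ : Vector ∣ M ∣ k₀) where
        open import Data.Vec.Functional using ([])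
        open import Data.Unit.Polymorphic.Base using (⊤; tt)
        open Small κ′ ℕ≺κ′
        open Types M′ κ′ using (InvariantBoundedEquivalence; AutomorphismOver)

        private
          s′ : A′.Tup k₀
          s′ = j ∘ s₀

        Λ : ℕ → Set (lsuc ℓ)
        Λ = InvariantBoundedEquivalence (range s′)

        module Λ {m} (R : Λ m) where
          open InvariantBoundedEquivalence R public using (E; few-classes; ≋⇒E)
          open IsEquivalence (InvariantBoundedEquivalence.isEquivalence R) public using () renaming (sym to Λ-sym; trans to Λ-trans)

          maps : ∀ f {x x′ y y′} → A′.Fixes f s′ → A′.Maps f x x′ → A′.Maps f y y′ → E x y → E x′ y′
          maps f fs fx fy e = Λ-trans (Λ-sym (≋⇒E fx))
            (Λ-trans (InvariantBoundedEquivalence.invariant R (record { auto = f ; fixes = A′.fixes-range f fs }) e) (≋⇒E fy))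

          classes : Setoid ℓ ℓ
          classes = record { isEquivalence = InvariantBoundedEquivalence.isEquivalence R }

        mkΛ : ∀ {m} (E : A′.Tup m → A′.Tup m → Set ℓ) → IsEquivalence E → (∀ {x y} → _≋_ M′.dom x y → E x y) →
              (∀ f {x x′ y y′} → A′.Fixes f s′ → A′.Maps f x x′ → A′.Maps f y y′ → E x y → E x′ y′) →
              ∀ {z} {Z : Set z} → setoid Z ≺ κ′ → (F : A′.Tup m → Z) → (∀ {x y} → F x ≡ F y → E x y) → Λ m
        mkΛ E eq ≋⇒E inv small F h = record
          { E = E ; isEquivalence = eq ; ≋⇒E = ≋⇒E
          ; invariant = λ f → inv (AutomorphismOver.auto f) (λ i → AutomorphismOver.fixes f (i , M′.refl)) (λ _ → M′.refl) (λ _ → M′.refl)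
          ; few-classes = small-≲ (invariant-≲ {S = record { isEquivalence = eq }} F h) small }

        trivial : ∀ {m} → Λ m
        trivial = mkΛ (λ _ _ → ⊤) (record { refl = tt ; sym = λ _ → tt ; trans = λ _ _ → tt }) (λ _ → tt) (λ _ _ _ _ _ → tt)
          (small-≲ (mk↣ (λ (_ : ⊤ {ℓ}) → 0) (λ _ → ≡.refl)) ℕ≺κ′) (λ _ → tt) (λ _ → tt)

        opaque
          intersection : ∀ {m} (E E′ : Λ m) → Σ[ E″ ∈ Λ m ] (∀ {x y} → Λ.E E″ x y → Λ.E E x y × Λ.E E′ x y)
          intersection E E′ = mkΛ (λ x y → E.E x y × E′.E x y)
              (record { refl = E.≋⇒E (λ _ → M′.refl) , E′.≋⇒E (λ _ → M′.refl)
                      ; sym = λ (p , q) → E.Λ-sym p , E′.Λ-sym q ; trans = λ (p , q) (p′ , q′) → E.Λ-trans p p′ , E′.Λ-trans q q′ })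
              (λ e → E.≋⇒E e , E′.≋⇒E e) (λ f fs fx fy (p , q) → E.maps f fs fx fy p , E′.maps f fs fx fy q)
              (small-× (small-≲ (fromReps E.classes) E.few-classes) (small-≲ (fromReps E′.classes) E′.few-classes))
              (λ x → Injection.to (toReps E.classes) x , Injection.to (toReps E′.classes) x)
              (λ e → Injection.injective (toReps E.classes) (≡.cong proj₁ e) , Injection.injective (toReps E′.classes) (≡.cong proj₂ e))
            , id
            where
            module E = Λ E
            module E′ = Λ E′

        record Lt {m} (x y : A′.Tup m) : Set (lsuc ℓ) where
          constructor lascar
          field related : (E : Λ m) → Λ.E E x y
        open Lt public

        -- The truth value brings equality of Lascar types down to level ℓ.
        record Ltℓ {m} (x y : A′.Tup m) : Set ℓ where
          constructor lascarℓ
          field holds : truth (Lt x y) ≡ true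

        Lt⇒ℓ : ∀ {m} {x y : A′.Tup m} → Lt x y → Ltℓ x y
        Lt⇒ℓ p = lascarℓ (truth-intro p)

        ℓ⇒Lt : ∀ {m} {x y : A′.Tup m} → Ltℓ x y → Lt x y
        ℓ⇒Lt (lascarℓ e) = truth-elim e

        Lt-sym : ∀ {m} {x y : A′.Tup m} → Lt x y → Lt y x
        Lt-sym p = lascar λ E → Λ.Λ-sym E (related p E)

        Lt-trans : ∀ {m} {x y z : A′.Tup m} → Lt x y → Lt y z → Lt x z
        Lt-trans p q = lascar λ E → Λ.Λ-trans E (related p E) (related q E)

        Lt-≋ : ∀ {m} {x y : A′.Tup m} → (∀ i → x i M′.≈ y i) → Lt x y
        Lt-≋ p = lascar λ E → Λ.≋⇒E E p

        Lt-maps : ∀ {m} f {x x′ y y′ : A′.Tup m} → A′.Fixes f s′ → A′.Maps f x x′ → A′.Maps f y y′ → Lt x y → Lt x′ y′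
        Lt-maps f fs fx fy p = lascar λ E → Λ.maps E f fs fx fy (related p E)

        s₀-model : Σ[ 𝒟 ∈ CModel ] s₀ ⊑ᵐ 𝒟
        s₀-model = cmodel-⊇ s₀

        module Orbit {m} (c : Tup m) where

          τ : A′.Tup m → Set ℓ
          τ u = ∃[ f ] A′.Fixes f s′ × A′.Maps f (j ∘ c) u

          τ-maps : ∀ {u v} f → A′.Fixes f s′ → A′.Maps f u v → τ u → τ v
          τ-maps f fs fu (g , gs , gu) = f A′.∘ₐ g , A′.maps-∘ f g fs gs , A′.maps-∘ f g fu gu

          private
            -- The relations are pulled back to `M`, where the rank argument takes place; lifting
            -- automorphisms to `M′` keeps them invariant.
            Eʲ : Λ m → Tup m → Tup m → Set ℓ
            Eʲ E x y = Λ.E E (j ∘ x) (j ∘ y)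

            Eʲ-maps : ∀ (E : Λ m) g {x x′ y y′ : Tup m} → Fixes g s₀ → Maps g x x′ → Maps g y y′ → Eʲ E x y → Eʲ E x′ y′
            Eʲ-maps E g {x} {x′} {y} {y′} gs gx gy e =
              let (f , p) = lift-maps {x = (s₀ ++ x) ++ y} {(s₀ ++ x′) ++ y′} g (maps-++ g (maps-++ g gs gx) gy)
                  sx = maps-j++ˡ f {s₀ ++ x} {s₀ ++ x′} p
              in Λ.maps E f (maps-j++ˡ f {s₀} {s₀} sx) (maps-j++ʳ f {s₀} {s₀} sx) (maps-j++ʳ f {s₀ ++ x} {s₀ ++ x′} p) e

            open MinimalRelation s₀ c {I = Λ m} Eʲ (λ E → Λ.Λ-sym E) (λ E → Λ.Λ-trans E) Eʲ-maps
              (λ E E′ → proj₁ (intersection E E′) , λ p → proj₂ (intersection E E′) p) using (Controls; minimal-relation)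

            E₁ : Λ m
            E₁ = proj₁ (minimal-relation trivial)

            controls : Controls E₁
            controls = proj₂ (minimal-relation trivial)

            module E₁ = Λ E₁

            opaque
              control : ∀ (𝒜 : D′.CModel) → s′ D′.⊑ᵐ 𝒜 → ∀ {c₀ x y} → c₀ D′.⊑ᵐ 𝒜 → τ c₀ → τ x → E₁.E c₀ x →
                        (∀ {l} (t : A′.Tup l) → t D′.⊑ᵐ 𝒜 → x A′.∼[ t ] y) → Lt x y
              control 𝒜 s⊑ {c₀} {x} {y} c₀⊑ τc₀ τx eq same = lascar λ E₂ → go E₂ (transfer (proj₁ s₀-model) 𝒜 (x ++ y))
                where
                go : ∀ (E₂ : Λ m) → Transfer (proj₁ s₀-model) 𝒜 (x ++ y) → Λ.E E₂ x y
                go E₂ t = finish (⊑-choose t c₀ c₀⊑)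
                  where
                  module T = Transfer t
                  fs : A′.Fixes T.f s′
                  fs i = T.fix (proj₂ s₀-model i)
                  x₀ y₀ : Tup m
                  x₀ i = T.x₀ (i ↑ˡ m)
                  y₀ i = T.x₀ (m ↑ʳ i)
                  fx : A′.Maps T.f x (j ∘ x₀)
                  fx = A′.maps-≈ˡ T.f (λ i → M′.sym (A′.++-↑ˡ x y i)) (λ i → T.fx (i ↑ˡ m))
                  fy : A′.Maps T.f y (j ∘ y₀)
                  fy = A′.maps-≈ˡ T.f (λ i → M′.sym (A′.++-↑ʳ x y i)) (λ i → T.fx (m ↑ʳ i))
                  s₀⊑ : s₀ ⊑ᵐ T.𝒜₀
                  s₀⊑ i = let (z , p , e) = T.into (s⊑ i) in
                    Subset.resp (set T.𝒜₀) (Embedding.injective ι (M′.trans (M′.sym e) (fs i))) p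
                  orbit : ∀ {u u₀} → τ u → A′.Maps T.f u (j ∘ u₀) → c ∼[ s₀ ] u₀
                  orbit {u₀ = u₀} (g , gs , gu) fu =
                    let (h , p) = unlift-maps {x = s₀ ++ c} {s₀ ++ u₀} (T.f A′.∘ₐ g)
                          (maps-j++ (T.f A′.∘ₐ g) {s₀} {s₀} {c} {u₀} (A′.maps-∘ T.f g fs gs) (A′.maps-∘ T.f g fu gu))
                    in h , maps-++ˡ h p , maps-++ʳ h {s₀} {s₀} p
                  same₀ : ∀ {l} (t : Tup l) → t ⊑ᵐ T.𝒜₀ → x₀ ∼[ t ] y₀
                  same₀ t t⊑ =
                    let t′ = λ i → proj₁ (T.onto (t⊑ i))
                        ft : A′.Maps T.f t′ (j ∘ t)
                        ft = λ i → proj₂ (proj₂ (T.onto (t⊑ i)))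
                        (g , gt , gx) = same t′ (λ i → proj₁ (proj₂ (T.onto (t⊑ i))))
                        k = A′.along T.f g T.f
                        (h , p) = unlift-maps {x = t ++ x₀} {t ++ y₀} k
                          (maps-j++ k {t} {t} {x₀} {y₀} (A′.maps-along T.f g T.f ft gt ft) (A′.maps-along T.f g T.f fx gx fy))
                    in h , maps-++ˡ h p , maps-++ʳ h {t} {t} p
                  finish : ∃[ b ] b ⊑ᵐ T.𝒜₀ × A′.Maps T.f c₀ (j ∘ b) → Λ.E E₂ x y
                  finish (b , b⊑ , fb) = Λ.maps E₂ (A′.inv T.f) (A′.maps-inv T.f fs) (A′.maps-inv T.f fx) (A′.maps-inv T.f fy)
                    (controls E₂ T.𝒜₀ s₀⊑ b⊑ (orbit τc₀ fb) (orbit τx fx) (E₁.maps T.f fs fb fx eq) same₀)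

            record Representatives {z} {Z : Set z} (F : A′.Tup m → Z) : Set (lsuc ℓ ⊔ z) where
              field
                Y       : Subset M′.dom
                Y-model : IsModel 𝒦 M′ Y
                Y-small : ⟪ Y ⟫ ≺ κ′
                s⊑Y     : s′ ⊑ Y
                found   : ∀ {x} → τ x → ∃[ n ] n ⊑ Y × τ n × F n ≡ F x

            opaque
              representatives : ∀ {z} {Z : Set z} (F : A′.Tup m → Z) → setoid Z ≺ κ′ → Representatives F
              representatives {Z = Z} F Z-small = go (D′.bmodel (X ∪ range s′) (D′.bounded-∪ {X} {range s′} X-small (D′.bounded-range s′)))
                where
                pick′ : ∀ ζ → Dec (∃[ u ] τ u × F u ≡ ζ) → ∃ τ
                pick′ ζ (yes (u , p , _)) = u , p
                pick′ ζ (no _)            = j ∘ c , A′.idₐ , A′.maps-id , A′.maps-id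
                el : Z × Fin m → M′.Carrier
                el (ζ , i) = proj₁ (pick′ ζ em) i
                X : Subset M′.dom
                -- `Z` may live in another universe; the truth value brings membership to level `ℓ`.
                X = record { member = λ x → Lift ℓ (truth (∃[ ζ ] el ζ M′.≈ x) ≡ true)
                           ; resp = λ e (lift p) → let (ζ , q) = truth-elim p in lift (truth-intro (ζ , M′.trans q e)) }
                X-small : ⟪ X ⟫ ≺ κ′
                X-small = small-≲ (cover-≲ X el (truth-elim ∘ lower)) (small-× Z-small (small-≲ (mk↣ toℕ toℕ-injective) ℕ≺κ′))
                go : Σ[ 𝒟 ∈ Model 𝒦 M′ κ′ ] (X ∪ range s′) ⊆ Model.set 𝒟 → Representatives F
                go (𝒟 , i) = record
                  { Y = Model.set 𝒟 ; Y-model = Model.isModel 𝒟 ; Y-small = Model.bounded 𝒟 ; s⊑Y = λ l → i (inj₂ (A′.⊑-range l))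
                  ; found = λ {x} τx → find τx em }
                  where
                  find : ∀ {x} → τ x → Dec (∃[ u ] τ u × F u ≡ F x) → ∃[ n ] n ⊑ Model.set 𝒟 × τ n × F n ≡ F x
                  find {x} τx d = proj₁ (pick′ (F x) em) , (λ l → i (inj₁ (lift (truth-intro ((F x , l) , M′.refl)))))
                                , proj₂ (pick′ (F x) em) , right em
                    where
                    right : ∀ (d : Dec (∃[ u ] τ u × F u ≡ F x)) → F (proj₁ (pick′ (F x) d)) ≡ F x
                    right (yes (_ , _ , e)) = e
                    right (no ¬p)           = ⊥-elim (¬p (x , τx , ≡.refl))

            module R₁ = Representatives (representatives (Injection.to (toReps E₁.classes)) (small-≲ (fromReps E₁.classes) E₁.few-classes))
            module C₁ = Code R₁.Y-model R₁.Y-small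

            opaque
              -- `R₁.Y` meets every `E₁`-class of the orbit, so `control` applies over a countable
              -- part of it that contains a representative of the class of `x`.
              type⇒Lt : ∀ {x y} → τ x → C₁.typeOf x ≡ C₁.typeOf y → Lt x y
              type⇒Lt {x} {y} τx e =
                let (n , n⊑ , τn , e′) = R₁.found τx
                    (𝒜 , i , 𝒜⊆) = D′.cmodel-in R₁.Y-model (range s′ ∪ range n) (D′.countable-∪ {range s′} {range n} (D′.countable-range s′) (D′.countable-range n))
                                     (λ { (inj₁ (l , q)) → Subset.resp R₁.Y q (R₁.s⊑Y l) ; (inj₂ (l , q)) → Subset.resp R₁.Y q (n⊑ l) })
                in control 𝒜 (λ l → i (inj₁ (A′.⊑-range l))) (λ l → i (inj₂ (A′.⊑-range l))) τn τx
                     (Injection.injective (toReps E₁.classes) e′) (λ t t⊑ → C₁.typeOf-∼ e t (𝒜⊆ ∘ t⊑))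

          -- Lascar types in the orbit are now few, being determined by types over `R₁.Y`; a second
          -- model can contain a tuple of each.
          module R₂ = Representatives (representatives C₁.typeOf C₁.types-small)

          module C₂ = Code R₂.Y-model R₂.Y-small

          opaque
            Lt-representative : ∀ {x} → τ x → ∃[ n ] n ⊑ R₂.Y × τ n × Lt n x
            Lt-representative τx = let (n , n⊑ , τn , e) = R₂.found τx in n , n⊑ , τn , type⇒Lt τn e

          s⊑ : s′ ⊑ R₂.Y
          s⊑ = R₂.s⊑Y

        module _ {m₁ m₂} (x₀ : Tup m₁) (z₀ : Tup m₂) where
          private
            open Orbit (x₀ ++ z₀)

            -- The lifting property itself, restricted to one orbit. Once its symmetric form is
            -- shown to have few classes, it is one of the relations that equal Lascar types must
            -- respect.
            Below : A′.Tup m₁ → A′.Tup m₁ → Set ℓ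
            Below x y = ∀ z → τ (x ++ z) → ∃[ z′ ] τ (y ++ z′) × Ltℓ (x ++ z) (y ++ z′)

            below-trans : ∀ {x y z} → Below x y → Below y z → Below x z
            below-trans p q u τu =
              let (v , τv , l) = p u τu
                  (w , τw , l′) = q v τv
              in w , τw , Lt⇒ℓ (Lt-trans (ℓ⇒Lt l) (ℓ⇒Lt l′))

            below-maps : ∀ f {x x′ y y′} → A′.Fixes f s′ → A′.Maps f x x′ → A′.Maps f y y′ → Below x y → Below x′ y′
            below-maps f {x} {x′} {y} {y′} fs fx fy p z τz =
              let z₁ = λ i → A′.inv f A′.· z i
                  (z₂ , τz₂ , l) = p z₁ (τ-maps (A′.inv f) (A′.maps-inv f fs) (A′.maps-++ (A′.inv f) (A′.maps-inv f fx) (A′.maps-img (A′.inv f))) τz)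
                  z₃ = λ i → f A′.· z₂ i
                  fyz = A′.maps-++ f fy (A′.maps-img f {z₂})
              in z₃ , τ-maps f fs fyz τz₂ , Lt⇒ℓ (Lt-maps f fs (A′.maps-++ f fx (λ i → A′.·-inv f (z i))) fyz (ℓ⇒Lt l))

            -- A completion of `x` has the Lascar type of some `n` in `R₂.Y`. An automorphism over
            -- `s′` and `n` that takes `x` to `y` carries the completion along and preserves this
            -- Lascar type.
            below-type : ∀ {x y} → C₂.typeOf x ≡ C₂.typeOf y → Below x y
            below-type {x} {y} e z τz =
              let (n , n⊑ , _ , l) = Lt-representative τz
                  (f , fsn , fx) = C₂.typeOf-∼ e (s′ ++ n) (A′.++-⊑ {X = R₂.Y} s⊑ n⊑)
                  fs = A′.maps-++ˡ f fsn
                  fxz = A′.maps-++ f fx (A′.maps-img f {z})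
              in (λ i → f A′.· z i) , τ-maps f fs fxz τz
                 , Lt⇒ℓ (Lt-trans (Lt-sym l) (Lt-maps f fs (A′.maps-++ʳ f {s′} {s′} fsn) fxz l))

            Λ-lift : Λ m₁
            Λ-lift = mkΛ (λ x y → Below x y × Below y x)
              (record { refl = refl-below , refl-below ; sym = λ (p , q) → q , p
                      ; trans = λ (p , q) (p′ , q′) → below-trans p p′ , below-trans q′ q })
              (λ e → ≋-below e , ≋-below (λ i → M′.sym (e i)))
              (λ f fs fx fy (p , q) → below-maps f fs fx fy p , below-maps f fs fy fx q)
              C₂.types-small C₂.typeOf (λ e → below-type e , below-type (≡.sym e))
              where
              ≋-below : ∀ {x y} → (∀ i → x i M′.≈ y i) → Below x y
              ≋-below {x} {y} e z τz = z , τ-maps A′.idₐ A′.maps-id xz τz , Lt⇒ℓ (Lt-≋ xz)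
                where
                xz : A′.Maps A′.idₐ (x ++ z) (y ++ z)
                xz = A′.maps-++ A′.idₐ {x} {y} {z} {z} e A′.maps-id
              refl-below : ∀ {x} → Below x x
              refl-below = ≋-below (λ _ → M′.refl)

          opaque
            Lt-lift : ∀ {x y : A′.Tup m₁} → Lt x y → ∀ (z : A′.Tup m₂) → τ (x ++ z) → ∃[ z′ ] τ (y ++ z′) × Lt (x ++ z) (y ++ z′)
            Lt-lift {x} {y} p z τz = go (proj₁ {A = Below x y} {B = λ _ → Below y x} both)
              where
              both : Below x y × Below y x
              both = related p Λ-lift
              go : Below x y → ∃[ z′ ] τ (y ++ z′) × Lt (x ++ z) (y ++ z′)
              go b = let (z′ , τz′ , l) = b z τz in z′ , τz′ , ℓ⇒Lt l

      -- The scheme of the global type, and genericity of `a`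

      module GlobalScheme {k₀ : ℕ} (s₀ : Vector ∣ M ∣ k₀) {n : ℕ} (b : Vector ∣ M′ ∣ n) where
        open import Data.Vec.Functional using ([])
        open LascarTypes s₀

        j-++ : ∀ {k l} (x : Tup k) (y : Tup l) i → j ((x ++ y) i) M′.≈ ((j ∘ x) ++ (j ∘ y)) i
        j-++ {k} x y i with splitAt k i
        ... | inj₁ _ = M′.refl
        ... | inj₂ _ = M′.refl

        𝕁 : Subset M′.dom
        𝕁 = image j

        𝕁-model : IsModel 𝒦 M′ 𝕁
        𝕁-model = D′.image-isModel ι ι-strong

        private
          opaque
            base : ∃[ k ] Σ[ w ∈ Tup k ] A′.NonSplit b (j ∘ w) 𝕁
            base =
              let (k , s , s⊑ , b-ns) = local-character′ 𝕁-model b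
                  s≈ = λ i → proj₂ (s⊑ i)
              in k , (λ i → proj₁ (s⊑ i)) , A′.nonsplit λ x y x⊑ y⊑ (g , gs , gx) →
                   let (f , p , q , r) = A′.ns b-ns x y x⊑ y⊑ (g , A′.maps-≈ˡ g (M′.sym ∘ s≈) (A′.maps-≈ʳ g s≈ gs) , gx)
                   in f , A′.maps-≈ˡ f s≈ (A′.maps-≈ʳ f (M′.sym ∘ s≈) p) , q , r

        w : Tup (proj₁ base)
        w = proj₁ (proj₂ base)

        b-ns : A′.NonSplit b (j ∘ w) 𝕁
        b-ns = proj₂ (proj₂ base)

        Real : ∀ {k} → Tup k → Tup n → Set ℓ
        Real s e = ∃[ f ] A′.Fixes f (j ∘ s) × A′.Maps f b (j ∘ e)

        private
          𝒟w : Σ[ 𝒟 ∈ CModel ] w ⊑ᵐ 𝒟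
          𝒟w = cmodel-⊇ w

          opaque
            moved : ∃[ f ] (∀ {x} → x ∈ set (proj₁ 𝒟w) → f A′.· j x M′.≈ j x) × ∃[ e ] A′.Maps f b (j ∘ e)
            moved = move-tuple (proj₁ 𝒟w) b

          f₀ : A′.Aut
          f₀ = proj₁ moved

          e₀ : Tup n
          e₀ = proj₁ (proj₂ (proj₂ moved))

          f₀-fix : ∀ {k} {x : Tup k} → x ⊑ᵐ proj₁ 𝒟w → A′.Fixes f₀ (j ∘ x)
          f₀-fix p i = proj₁ (proj₂ moved) (p i)

          f₀-b : A′.Maps f₀ b (j ∘ e₀)
          f₀-b = proj₂ (proj₂ (proj₂ moved))

          in-𝕁 : ∀ {k} (x : Tup k) → (j ∘ x) ⊑ 𝕁
          in-𝕁 x i = x i , M′.refl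

          b-fix : ∀ {k} {x y : Tup k} f → A′.Fixes f (j ∘ w) → A′.Maps f (j ∘ x) (j ∘ y) →
                  ∃[ g ] A′.Fixes g (j ∘ w) × A′.Maps g (j ∘ x) (j ∘ y) × A′.Fixes g b
          b-fix {x = x} {y} f fw fx = A′.ns b-ns (j ∘ x) (j ∘ y) (in-𝕁 x) (in-𝕁 y) (f , fw , fx)

          opaque
            e₀-ns : NonSplit e₀ w (set (proj₁ 𝒟w))
            e₀-ns = nonsplit go
              where
              go : ∀ {m} (x y : Tup m) → x ⊑ᵐ proj₁ 𝒟w → y ⊑ᵐ proj₁ 𝒟w → x ∼[ w ] y → ∃[ g ] Fixes g w × Maps g x y × Fixes g e₀
              go x y x⊑ y⊑ (g , gw , gx) =
                case lift-maps {x = w ++ x} {w ++ y} g (maps-++ g gw gx) of λ { (f , fwx) →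
                case b-fix {x = x} {y} f (maps-j++ˡ f {w} {w} fwx) (maps-j++ʳ f {w} {w} fwx) of λ { (f′ , fw , fx , fb) →
                case unlift-maps {x = (w ++ x) ++ e₀} {(w ++ y) ++ e₀} (A′.along f₀ f′ f₀)
                       (maps-j++ (A′.along f₀ f′ f₀) {w ++ x} {w ++ y} {e₀} {e₀}
                         (maps-j++ (A′.along f₀ f′ f₀) {w} {w} {x} {y}
                           (A′.maps-along f₀ f′ f₀ (f₀-fix (proj₂ 𝒟w)) fw (f₀-fix (proj₂ 𝒟w)))
                           (A′.maps-along f₀ f′ f₀ (f₀-fix x⊑) fx (f₀-fix y⊑)))
                         (A′.maps-along f₀ f′ f₀ f₀-b fb f₀-b)) of λ { (h , p) →
                  h , maps-++ˡ h (maps-++ˡ h {w ++ x} {w ++ y} p) , maps-++ʳ h {w} {w} (maps-++ˡ h {w ++ x} {w ++ y} p)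
                  , maps-++ʳ h {w ++ x} {w ++ y} p } } }

        P : Scheme (proj₁ base) n
        P = record { 𝒟 = proj₁ 𝒟w ; s = w ; s⊑𝒟 = proj₂ 𝒟w ; c = e₀ ; c-ns = e₀-ns }

        module P = Scheme P

        opaque
          -- The scheme is read off a copy `e₀` of `b` over one countable model; nonsplitting of `b`
          -- over all of `M` shows that it defines the type of `b` over every tuple.
          R⇒real : ∀ {k} {x : Tup k} {e} → P.R w x e → Real (w ++ x) e
          R⇒real {x = x} {e} (d , d⊑ , g , gw , gd , ge) =
            case lift-maps {x = (w ++ d) ++ e₀} {(w ++ x) ++ e} g (maps-++ g (maps-++ g gw gd) ge) of λ { (f , p) →
            go f (maps-j++ˡ f {w} {w} (maps-j++ˡ f {w ++ d} {w ++ x} p)) (maps-j++ʳ f {w} {w} (maps-j++ˡ f {w ++ d} {w ++ x} p))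
                 (maps-j++ʳ f {w ++ d} {w ++ x} p) }
            where
            go : ∀ f → A′.Fixes f (j ∘ w) → A′.Maps f (j ∘ d) (j ∘ x) → A′.Maps f (j ∘ e₀) (j ∘ e) → Real (w ++ x) e
            go f fw fd fe = case b-fix {x = d} {x} f fw fd of λ { (h , hw , hd , hb) →
              A′.along h f₀ f
              , maps-j++ (A′.along h f₀ f) {w} {w} {x} {x}
                  (A′.maps-along h f₀ f hw (f₀-fix (proj₂ 𝒟w)) fw) (A′.maps-along h f₀ f hd (f₀-fix d⊑) fd)
              , A′.maps-along h f₀ f hb f₀-b fe }

          real⇒R : ∀ {k} {x : Tup k} {e} → Real (w ++ x) e → P.R w x e
          real⇒R {x = x} {e} (f , fwx , fb) =
            case P.realize idₐ maps-id x of λ { (e₁ , r) →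
            case R⇒real r of λ { (f₁ , f₁wx , f₁b) →
            case unlift-maps {x = (w ++ x) ++ e₁} {(w ++ x) ++ e} (f A′.∘ₐ A′.inv f₁)
                   (maps-j++ (f A′.∘ₐ A′.inv f₁) {w ++ x} {w ++ x} {e₁} {e} (A′.maps-∘ f (A′.inv f₁) fwx (A′.maps-inv f₁ f₁wx))
                     (A′.maps-∘ f (A′.inv f₁) fb (A′.maps-inv f₁ f₁b))) of λ { (g , p) →
              P.R-maps g (maps-++ˡ g (maps-++ˡ g {w ++ x} {w ++ x} p)) (maps-++ʳ g {w} {w} (maps-++ˡ g {w ++ x} {w ++ x} p))
                (maps-++ʳ g {w ++ x} {w ++ x} p) r } } }

        open Stabilizer P public using (H; fixing; fixed; HH; Generic; H-real; H-∘; H-inv; H-supp; H-≈; H-fix; ContainsBase; module Unique)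

        -- Hypotheses on b: its Lascar type over s₀ is that of a tuple of M, and its
        -- type over M does not Lascar-split over s₀.
        module _ (b-inv : ∀ {k} {x y : Tup k} → Lt (j ∘ x) (j ∘ y) → ∃[ f ] A′.Maps f (j ∘ x) (j ∘ y) × A′.Fixes f b)
                 (a : Tup n) (b-a : Lt b (j ∘ a)) where
          private
            ≋-orbit : ∀ {k l} (x : Tup k) (y : Tup l) → Orbit.τ (x ++ y) ((j ∘ x) ++ (j ∘ y))
            ≋-orbit x y = A′.idₐ , A′.maps-id , j-++ x y

            -- `Lt-lift` yields a tuple of `M′`. It is moved into `M` over a countable model
            -- containing `s₀`, `x`, `y` and `z`, which preserves equality of Lascar types.
            lift-in-M : ∀ {k l} (x y : Tup k) (z : Tup l) → Lt (j ∘ x) (j ∘ y) →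
                        ∃[ z′ ] Lt (j ∘ (x ++ z)) (j ∘ (y ++ z′)) × (x ++ z) ∼[ s₀ ] (y ++ z′)
            lift-in-M {k} {l} x y z p = go (Lt-lift x z p (j ∘ z) (≋-orbit x z)) (cmodel-⊇ ((s₀ ++ x) ++ (y ++ z)))
              where
              go : ∃[ z′ ] Orbit.τ (x ++ z) ((j ∘ y) ++ z′) × Lt ((j ∘ x) ++ (j ∘ z)) ((j ∘ y) ++ z′) →
                   Σ[ 𝒟 ∈ CModel ] ((s₀ ++ x) ++ (y ++ z)) ⊑ᵐ 𝒟 →
                   ∃[ z′ ] Lt (j ∘ (x ++ z)) (j ∘ (y ++ z′)) × (x ++ z) ∼[ s₀ ] (y ++ z′)
              go (z₁ , (f , fs , fxz) , lt) (𝒟 , ⊑𝒟) = go′ (move-tuple 𝒟 z₁)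
                where
                s₀⊑ : s₀ ⊑ᵐ 𝒟
                s₀⊑ = ++-⊑ˡ {x = s₀} {x} {set 𝒟} (++-⊑ˡ {x = s₀ ++ x} {y ++ z} {set 𝒟} ⊑𝒟)
                x⊑ : x ⊑ᵐ 𝒟
                x⊑ = ++-⊑ʳ {x = s₀} {x} {set 𝒟} (++-⊑ˡ {x = s₀ ++ x} {y ++ z} {set 𝒟} ⊑𝒟)
                y⊑ : y ⊑ᵐ 𝒟
                y⊑ = ++-⊑ˡ {x = y} {z} {set 𝒟} (++-⊑ʳ {x = s₀ ++ x} {y ++ z} {set 𝒟} ⊑𝒟)
                z⊑ : z ⊑ᵐ 𝒟
                z⊑ = ++-⊑ʳ {x = y} {z} {set 𝒟} (++-⊑ʳ {x = s₀ ++ x} {y ++ z} {set 𝒟} ⊑𝒟)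
                go′ : ∃[ g ] (∀ {u} → u ∈ set 𝒟 → g A′.· j u M′.≈ j u) × ∃[ z′ ] A′.Maps g z₁ (j ∘ z′) →
                      ∃[ z′ ] Lt (j ∘ (x ++ z)) (j ∘ (y ++ z′)) × (x ++ z) ∼[ s₀ ] (y ++ z′)
                go′ (g , fix , z′ , gz) = z′ , Lt-maps g (fix ∘ s₀⊑) gxz gyz lt , orbit
                  where
                  gxz : A′.Maps g ((j ∘ x) ++ (j ∘ z)) (j ∘ (x ++ z))
                  gxz = A′.maps-≈ʳ g (λ i → M′.sym (j-++ x z i)) (A′.maps-++ g (fix ∘ x⊑) (fix ∘ z⊑))
                  gyz : A′.Maps g ((j ∘ y) ++ z₁) (j ∘ (y ++ z′))
                  gyz = A′.maps-≈ʳ g (λ i → M′.sym (j-++ y z′ i)) (A′.maps-++ g (fix ∘ y⊑) gz)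
                  orbit : (x ++ z) ∼[ s₀ ] (y ++ z′)
                  orbit =
                    let (h , p) = unlift-maps {x = s₀ ++ (x ++ z)} {s₀ ++ (y ++ z′)} (g A′.∘ₐ f)
                          (maps-j++ (g A′.∘ₐ f) {s₀} {s₀} {x ++ z} {y ++ z′} (A′.maps-∘ g f (fix ∘ s₀⊑) fs)
                            (A′.maps-∘ g f gyz fxz))
                    in h , maps-++ˡ h p , maps-++ʳ h {s₀} {s₀} p

            -- Let `x₁` correspond to `x` under the lifting. A realization `e` over all the
            -- parameters does not distinguish `u′ ++ x` from `u ++ x₁`, because `b` does not; so
            -- `e` relates to `x` at `u′ ∘ σ` as it relates to `x₁` at `w`.
            Lt⇒≅ : ∀ {k} (u u′ : Tup k) (σ : Fin (proj₁ base) → Fin k) → (∀ i → u (σ i) ≈ w i) → Lt (j ∘ u′) (j ∘ u) → P._≅_ (u′ ∘ σ) w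
            Lt⇒≅ {k} u u′ σ uσ lt {m} x = go (lift-in-M u′ u x lt)
              where
              go : ∃[ x′ ] Lt (j ∘ (u′ ++ x)) (j ∘ (u ++ x′)) × (u′ ++ x) ∼[ s₀ ] (u ++ x′) → ∃[ e ] P.R (u′ ∘ σ) x e × P.R w x e
              go (x₁ , lt′ , _) =
                case P.realize idₐ maps-id ((u′ ++ x) ++ (u ++ x₁)) of λ { (e , r) →
                case R⇒real r of λ { (f , fwX , fb) →
                case b-inv {x = u′ ++ x} {u ++ x₁} lt′ of λ { (g , gX , gb) →
                case unlift-maps {x = (u′ ++ x) ++ e} {(u ++ x₁) ++ e} (A′.along f g f)
                       (maps-j++ (A′.along f g f) {u′ ++ x} {u ++ x₁} {e} {e}
                         (A′.maps-along f g f (fX f fwX) gX (fX₁ f fwX))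
                         (A′.maps-along f g f fb gb fb)) of λ { (h , p) →
                e , P.R-maps (inv h) (maps-inv h (hw h p)) (maps-inv h (maps-++ʳ h {u′} {u} (maps-++ˡ h {u′ ++ x} {u ++ x₁} p)))
                      (maps-inv h (maps-++ʳ h {u′ ++ x} {u ++ x₁} p)) (P.R-++ʳ {x = u} {x₁} (P.R-++ʳ {x = u′ ++ x} {u ++ x₁} r))
                  , P.R-++ʳ {x = u′} {x} (P.R-++ˡ {x = u′ ++ x} {u ++ x₁} r) } } } }
                where
                fX : ∀ f → A′.Fixes f (j ∘ (w ++ ((u′ ++ x) ++ (u ++ x₁)))) → A′.Fixes f (j ∘ (u′ ++ x))
                fX f p = maps-j++ˡ f {u′ ++ x} {u′ ++ x} (maps-j++ʳ f {w} {w} p)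
                fX₁ : ∀ f → A′.Fixes f (j ∘ (w ++ ((u′ ++ x) ++ (u ++ x₁)))) → A′.Fixes f (j ∘ (u ++ x₁))
                fX₁ f p = maps-j++ʳ f {u′ ++ x} {u′ ++ x} (maps-j++ʳ f {w} {w} p)
                hw : ∀ h {e} → Maps h ((u′ ++ x) ++ e) ((u ++ x₁) ++ e) → Maps h (u′ ∘ σ) w
                hw h p i = trans (maps-++ˡ h {u′} {u} (maps-++ˡ h {u′ ++ x} {u ++ x₁} p) (σ i)) (uσ i)

          opaque
            -- A realization `e` over `𝒟`, `a` and `s₀` has the Lascar type of `a`. Lifting `w`
            -- gives `w₁`, and the automorphism from `e ++ w` to `a ++ w₁` is in `H` because `w₁`
            -- defines the same type as `w`.
            generic : Generic a
            generic 𝒟 = go (P.extend idₐ maps-id (set 𝒟 ∪ range (a ++ s₀)) (bounded-∪ {set 𝒟} {range (a ++ s₀)} (bounded-cmodel 𝒟) (bounded-range (a ++ s₀))))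
              where
              X : Subset dom
              X = set 𝒟 ∪ range (a ++ s₀)
              go : Σ[ e ∈ Tup n ] (∀ {m} (x : Tup m) → x ⊑ X → P.R w x e) → ∃[ e ] ∃[ g ] e ⊨ P at w over 𝒟 × H g × Maps g e a
              go (e , real) = go′ (R⇒real (real (a ++ s₀) (λ i → inj₂ (⊑-range i))))
                where
                go′ : Real (w ++ (a ++ s₀)) e → ∃[ e ] ∃[ g ] e ⊨ P at w over 𝒟 × H g × Maps g e a
                go′ (f , p , fb) = finish (lift-in-M e a w lt)
                  where
                  as : A′.Fixes f (j ∘ (a ++ s₀))
                  as = maps-j++ʳ f {w} {w} p
                  lt : Lt (j ∘ e) (j ∘ a)
                  lt = Lt-maps f (maps-j++ʳ f {a} {a} as) fb (maps-j++ˡ f {a} {a} as) b-a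
                  finish : ∃[ w₁ ] Lt (j ∘ (e ++ w)) (j ∘ (a ++ w₁)) × (e ++ w) ∼[ s₀ ] (a ++ w₁) →
                           ∃[ e ] ∃[ g ] e ⊨ P at w over 𝒟 × H g × Maps g e a
                  finish (w₁ , lt′ , g , _ , gew) = e , g , (λ d d⊑ → real d (inj₁ ∘ d⊑))
                    , fixing (P.≅-maps idₐ (λ i → trans (++-↑ʳ a w₁ i) (sym (maps-++ʳ g {e} {a} gew i))) maps-id
                        (Lt⇒≅ (e ++ w) (a ++ w₁) (n ↑ʳ_) (++-↑ʳ e w) (Lt-sym lt′)))
                    , maps-++ˡ g gew

      -- The canonical base: existence and uniqueness of free extensions

      module CanonicalBase (ℰ : Imaginaries 𝕄) {n : ℕ} (a : Vector ∣ M ∣ n) (A : Subset dom)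
                           {k : ℕ} (α : Vector ∣ Meq.M^eq ℰ ∣ k) (cb : Global.IsCb 𝕄′ ℰ α a A) where
        open import Data.Vec.Functional using ([])
        open ImaginaryElements ℰ
        open Imaginaries ℰ using (Sort) renaming (countable to sorts-countable)
        open Meq ℰ
        open Global 𝕄′ ℰ using (GlobalType; FixedBy; IsCanonicalBase; 𝕄-in-𝕄′)

        private
          module Mᵉ = Structure M^eq
          module T′ = Types M′ κ′
          module Tᵉ = Types M^eq δ
          module δ-small = Small δ δ.uncountable
          module κ-small = Small κ′ ℕ≺κ′

          b : A′.Tup n
          b = proj₁ cb

          sameLascar : T′.SameLascarType b (j ∘ a) (jX A)
          sameLascar = proj₁ (proj₂ cb)

          free : b T′.↓[ jX A ] 𝕄-in-𝕄′
          free = proj₁ (proj₂ (proj₂ cb))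

          p : GlobalType n
          p = proj₁ (proj₂ (proj₂ (proj₂ cb)))

          realized : GlobalType.RealizedBy p b
          realized = proj₁ (proj₂ (proj₂ (proj₂ (proj₂ cb))))

          canonical : IsCanonicalBase α p
          canonical = proj₂ (proj₂ (proj₂ (proj₂ (proj₂ cb))))

          s : A′.Tup (proj₁ free)
          s = proj₁ (proj₂ free)

          s⊑A : s ⊑ jX A
          s⊑A = proj₁ (proj₂ (proj₂ free))

          s₀ : Tup (proj₁ free)
          s₀ i = proj₁ (proj₁ (s⊑A i))

          s₀≈s : ∀ i → j (s₀ i) M′.≈ s i
          s₀≈s i = proj₂ (s⊑A i)

        open LascarTypes s₀
        open GlobalScheme s₀ b

        private
          opaque
            b-a : Lt b (j ∘ a)
            b-a = lascar λ E → sameLascar (j ∘ s₀) (λ i → proj₁ (s⊑A i) , M′.refl) E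

            -- A relation over a finite tuple from `s` is invariant over `j ∘ s₀` as well, the two
            -- tuples being equal up to `≈`.
            Lt⇒lascar : ∀ {m} {x y : A′.Tup m} → Lt x y → T′.SameLascarType x y (range s)
            Lt⇒lascar q t t⊑ E = related q (record
              { E = I.E ; isEquivalence = I.isEquivalence ; ≋⇒E = I.≋⇒E ; few-classes = I.few-classes
              ; invariant = λ f → I.invariant (record { auto = T′.AutomorphismOver.auto f ; fixes = λ {x} (i , e) →
                  let (l , e′) = t⊑ i in T′.AutomorphismOver.fixes f (l , M′.trans (s₀≈s l) (M′.trans e′ e)) }) })
              where module I = T′.InvariantBoundedEquivalence E

            AM : Subset M′.dom
            AM = jX A ∪ 𝕄-in-𝕄′

            AM-bounded : T′.Bounded AM
            AM-bounded = D′.bounded-∪ {jX A} {𝕄-in-𝕄′} (κ-small.small-≲ A≲ larger) (κ-small.small-≲ M≲ larger)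
              where
              A≲ : ⟪ jX A ⟫ ≲ dom
              A≲ = record
                { to        = λ (_ , (x , _) , _) → x
                ; cong      = λ { {_ , _ , p} {_ , _ , q} e → Embedding.injective ι (M′.trans p (M′.trans e (M′.sym q))) }
                ; injective = λ { {_ , _ , p} {_ , _ , q} e → M′.trans (M′.sym p) (M′.trans (Embedding.cong ι e) q) }
                }
              M≲ : ⟪ 𝕄-in-𝕄′ ⟫ ≲ dom
              M≲ = record
                { to        = λ (_ , x , _) → x
                ; cong      = λ { {_ , _ , p} {_ , _ , q} e → Embedding.injective ι (M′.trans p (M′.trans e (M′.sym q))) }
                ; injective = λ { {_ , _ , p} {_ , _ , q} e → M′.trans (M′.sym p) (M′.trans (Embedding.cong ι e) q) }
                }

            -- Freeness is used with the parameter set itself as the larger set. It concerns another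
            -- realization `b′` of the type of `b`, whose automorphism is conjugated to one that
            -- fixes `b`.
            b-inv : ∀ {l} {x y : Tup l} → Lt (j ∘ x) (j ∘ y) → ∃[ f ] A′.Maps f (j ∘ x) (j ∘ y) × A′.Fixes f b
            b-inv {x = x} {y} q = go (proj₂ (proj₂ (proj₂ free)) AM AM-bounded id)
              where
              in-M : ∀ {l} (x : Tup l) → (j ∘ x) ⊑ AM
              in-M x i = inj₂ (x i , M′.refl)
              go : Σ[ b′ ∈ A′.Tup n ] T′.SameType b′ b AM × ¬ T′.LascarSplits b′ AM (range s) → ∃[ f ] A′.Maps f (j ∘ x) (j ∘ y) × A′.Fixes f b
              go (b′ , same , ns) = finish em
                where
                finish : Dec (T′.SameType (b′ ++ (j ∘ x)) (b′ ++ (j ∘ y)) (range s)) → ∃[ f ] A′.Maps f (j ∘ x) (j ∘ y) × A′.Fixes f b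
                finish (no ¬st) = ⊥-elim (ns (_ , j ∘ x , j ∘ y , in-M x , in-M y , Lt⇒lascar q , ¬st))
                finish (yes st) =
                  let (f , _ , fb) = A′.type⇒∼ st
                      (g , gxy , gb) = A′.galois⇒∼ (same ((j ∘ x) ++ (j ∘ y)) (A′.++-⊑ {X = AM} (in-M x) (in-M y)))
                  in A′.along g f g
                     , A′.maps-along g f g (A′.maps-++ˡ g gxy) (A′.maps-++ʳ f {b′} {b′} fb) (A′.maps-++ʳ g {j ∘ x} {j ∘ x} gxy)
                     , A′.maps-along g f g gb (A′.maps-++ˡ f fb) gb

          a-generic : Generic a
          a-generic = generic b-inv a b-a

          opaque
            p⇒real : ∀ {l} (t : Tup l) {e} → GlobalType.p p t e → Real t e
            p⇒real t {e} pe =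
              let (e₁ , pe₁ , st) = realized t
                  (f , ft , fb) = A′.galois⇒∼ st
                  (e₂ , orbit) = GlobalType.galois p t
                  (g , gt , ge) = ∼-trans (galois⇒∼ {δ} (Equivalence.to (orbit e₁) pe₁)) (∼-sym (galois⇒∼ {δ} (Equivalence.to (orbit e) pe)))
                  (h , q) = lift-maps {x = t ++ e₁} {t ++ e} g (maps-++ g gt ge)
              in h A′.∘ₐ f , A′.maps-∘ h f (maps-j++ˡ h {t} {t} q) ft , A′.maps-∘ h f (maps-j++ʳ h {t} {t} q) fb

            real⇒p : ∀ {l} (t : Tup l) {e} → Real t e → GlobalType.p p t e
            real⇒p t {e} (f , ft , fb) =
              let (e₁ , pe₁ , st) = realized t
                  (f₁ , f₁t , f₁b) = A′.galois⇒∼ st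
                  (e₂ , orbit) = GlobalType.galois p t
                  (g , q) = unlift-maps {x = t ++ e} {t ++ e₁} (f₁ A′.∘ₐ A′.inv f)
                              (maps-j++ (f₁ A′.∘ₐ A′.inv f) {t} {t} {e} {e₁} (A′.maps-∘ f₁ (A′.inv f) f₁t (A′.maps-inv f ft))
                                (A′.maps-∘ f₁ (A′.inv f) f₁b (A′.maps-inv f fb)))
              in Equivalence.from (orbit e) (∼⇒galois {δ} (∼-trans (g , maps-++ˡ g q , maps-++ʳ g {t} {t} q)
                                                             (galois⇒∼ {δ} (Equivalence.to (orbit e₁) pe₁))))

            real-∼ : ∀ {l} {t : Tup l} {e e′} → Real t e → Real t e′ → e ∼[ t ] e′
            real-∼ {t = t} {e} {e′} (f , ft , fb) (f′ , ft′ , fb′) =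
              let (g , q) = unlift-maps {x = t ++ e} {t ++ e′} (f′ A′.∘ₐ A′.inv f)
                              (maps-j++ (f′ A′.∘ₐ A′.inv f) {t} {t} {e} {e′} (A′.maps-∘ f′ (A′.inv f) ft′ (A′.maps-inv f ft))
                                (A′.maps-∘ f′ (A′.inv f) fb′ (A′.maps-inv f fb)))
              in g , maps-++ˡ g q , maps-++ʳ g {t} {t} q

            -- Take a realization `e` over the preimages of `w` and `x`. Its image realizes the
            -- scheme at `g · w`, by transport, and the global type over `w` and `x`, because `f`
            -- fixes `p`.
            fixed⇒H : ∀ (f : Aᵉ.Aut) g → (∀ x → f Aᵉ.· real x Mᵉ.≈ real (g · x)) → FixedBy p f → H g
            fixed⇒H f g spec fixed = fixing go
              where
              go : ∀ {m} (x : Tup m) → ∃[ e ] P.R (λ i → g · w i) x e × P.R w x e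
              go {m} x =
                case P.realize idₐ maps-id ((λ i → inv g · w i) ++ y) of λ { (e , r) →
                (λ i → g · e i)
                , P.R-maps g (maps-img g) (λ i → ·-inv g (x i)) (maps-img g) (P.R-++ʳ {x = λ i → inv g · w i} {y} r)
                , real⇒R (p⇒real (w ++ x)
                    (fixed ((λ i → inv g · w i) ++ y) (w ++ x)
                      (λ i → Mᵉ.trans (spec _) (real-cong (maps-++ g (λ i → ·-inv g (w i)) (λ i → ·-inv g (x i)) i)))
                      e (λ i → g · e i) (λ i → spec (e i))
                      (real⇒p ((λ i → inv g · w i) ++ y) (real-++ʳ {t = w} {(λ i → inv g · w i) ++ y} (R⇒real r))))) }
                where
                y : Tup m
                y i = inv g · x i
                real-++ʳ : ∀ {l m} {t : Tup l} {u : Tup m} {e} → Real (t ++ u) e → Real u e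
                real-++ʳ {t = t} {u} (f , ft , fb) = f , maps-j++ʳ f {t} {t} {u} {u} ft , fb

            H⇒fixed : ∀ (f : Aᵉ.Aut) g → (∀ x → f Aᵉ.· real x Mᵉ.≈ real (g · x)) → H g → FixedBy p f
            H⇒fixed f g spec Hg s t fst c d fcd pc =
              case P.realize idₐ maps-id s of λ { (e , r) →
              case fixed Hg t of λ { (e₂ , u , v) →
              case real-∼ (p⇒real s pc) (restrict-real′ (R⇒real r)) of λ { (h₁ , h₁s , h₁c) →
              case P.R-unique idₐ maps-id maps-id (P.R-maps g (maps-img g) gs (maps-img g) r) u of λ { (h₂ , _ , h₂t , h₂e) →
              real⇒p t (move-real t (restrict-real′ (R⇒real v)) (inv (h₂ ∘ₐ g ∘ₐ h₁ ∘ₐ inv g))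
                (maps-inv (h₂ ∘ₐ g ∘ₐ h₁ ∘ₐ inv g) (maps-∘ h₂ (g ∘ₐ h₁ ∘ₐ inv g) h₂t (maps-∘ g (h₁ ∘ₐ inv g) gs (maps-∘ h₁ (inv g) h₁s (maps-inv g gs)))))
                (maps-inv (h₂ ∘ₐ g ∘ₐ h₁ ∘ₐ inv g) (maps-∘ h₂ (g ∘ₐ h₁ ∘ₐ inv g) h₂e (maps-∘ g (h₁ ∘ₐ inv g) (maps-img g) (maps-∘ h₁ (inv g) h₁c (maps-inv g gc)))))) } } } }
              where
              gs : Maps g s t
              gs i = real-injective (Mᵉ.trans (Mᵉ.sym (spec (s i))) (fst i))
              gc : Maps g c d
              gc i = real-injective (Mᵉ.trans (Mᵉ.sym (spec (c i))) (fcd i))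
              restrict-real′ : ∀ {l} {t : Tup l} {e} → Real (w ++ t) e → Real t e
              restrict-real′ {t = t} (f , ft , fb) = f , maps-j++ʳ f {w} {w} {t} {t} ft , fb
              move-real : ∀ {l} (t : Tup l) {e e′} → Real t e → ∀ g → Fixes g t → Maps g e e′ → Real t e′
              move-real t {e} {e′} (f , ft , fb) g gt ge =
                let (h , q) = lift-maps {x = t ++ e} {t ++ e′} g (maps-++ g gt ge)
                in h A′.∘ₐ f , A′.maps-∘ h f (maps-j++ˡ h {t} {t} q) ft , A′.maps-∘ h f (maps-j++ʳ h {t} {t} q) fb

            α-fixed⇒H : ∀ (f : Aᵉ.Aut) → Aᵉ.Fixes f α → H (restrict f)
            α-fixed⇒H f q = fixed⇒H f (restrict f) (restrict-real f) (Equivalence.from (canonical f) q)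

            H⇒α-fixed : ∀ g → H g → Aᵉ.Fixes (g ᵉ) α
            H⇒α-fixed g q = Equivalence.to (canonical (g ᵉ)) (H⇒fixed (g ᵉ) g (λ _ → Mᵉ.refl) q)

          module Representatives (C : Subset ≈ᵉ-setoid) where
            private
              u : Reps ⟪ C ⟫ → Element
              u z = proj₁ (proj₁ z)

              Z : Set ℓ
              Z = Σ[ z ∈ Reps ⟪ C ⟫ ] Fin (proj₁ (sortOf (u z)))

              elZ : Z → Carrier
              elZ (z , i) = valueOf (u z) i

            X : Subset dom
            X = image elZ

            X-bounded : Tᵉ.Bounded C → ⟪ X ⟫ ≺ δ
            X-bounded C-bdd = δ-small.small-≲ (fin-pairs (λ z → proj₁ (sortOf (u z))) ⊙ cover-≲ X elZ id)
              (δ-small.small-× (δ-small.small-≲ (fromReps ⟪ C ⟫) C-bdd) δ.uncountable)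

            record Represented {m} (y : Aᵉ.Tup m) : Set ℓ where
              field
                y~  : Aᵉ.Tup m
                y≈  : ∀ i → y i Mᵉ.≈ y~ i
                ⌊⌋⊑ : ⌊ y~ ⌋ ⊑ X

            represent : ∀ {m} (y : Aᵉ.Tup m) → y ⊑ C → Represented y
            represent y y⊑ = record
              { y~  = λ i → u (z i)
              ; y≈  = λ i → rep-≈ ⟪ C ⟫ (y i , y⊑ i)
              ; ⌊⌋⊑ = flat-⊑ _ (values (λ i → u (z i))) {X} (λ i l → (z i , l) , refl) }
              where
              z : ∀ i → Reps ⟪ C ⟫
              z i = Injection.to (toReps ⟪ C ⟫) (y i , y⊑ i)

          fixes-≈ : ∀ {m} {y y~ : Aᵉ.Tup m} f → (∀ i → y i Mᵉ.≈ y~ i) → Aᵉ.Fixes f y~ → Aᵉ.Fixes f y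
          fixes-≈ f e q = Aᵉ.maps-≈ˡ f e (Aᵉ.maps-≈ʳ f (Mᵉ.sym ∘ e) q)

          real-maps : ∀ {m} g {x y : Tup m} → Maps g x y → Aᵉ.Maps (g ᵉ) (real ∘ x) (real ∘ y)
          real-maps g q i = real-cong (q i)

          over-α : ∀ g → H g → ∀ {l} {t : Aᵉ.Tup l} → t ⊑ range {S = ≈ᵉ-setoid} α → Aᵉ.Fixes (g ᵉ) t
          over-α g Hg t⊑ i = Aᵉ.fixes-range {s = α} (g ᵉ) (H⇒α-fixed g Hg) (t⊑ i)

          -- Genericity makes some realization an `H`-conjugate of `a`, and `H` fixes `α`.
          realizes⇒type : ∀ {e} → P.R w [] e → Tᵉ.SameType (real ∘ a) (real ∘ e) (range α)
          realizes⇒type {e} r t t⊑ =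
            let (e₁ , g , real₁ , Hg , ga) = a-generic anyModel
                (h , hw , _ , he) = P.R-unique idₐ maps-id maps-id (real₁ [] (λ ())) r
                f = h ∘ₐ inv g
                Hf = H-∘ {h} {inv g} (H-supp {h} hw) (H-inv {g} Hg)
            in Aᵉ.∼⇒galois (f ᵉ , over-α f Hf t⊑ , real-maps f (maps-∘ h (inv g) he (maps-inv g ga)))

          module _ {m : ℕ} where
            private
              Z : Set
              Z = List (∃ Sort) × List ℕ

              Z↣ℕ : Z ↣ ℕ
              Z↣ℕ = ℕ×ℕ↣ℕ ⊙ ×-↣ (infinite-list ≲-refl ⊙ List-↣ sorts-countable) (infinite-list ≲-refl)

              codeOf : (sh : Shape m) → Values sh → List ℕ
              codeOf sh v = proj₁ (encode (j ∘ (w ++ flat sh v)))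

              F : Aᵉ.Tup m → Z
              F y = tabulate (shape y) , codeOf (shape y) (values y)

            Conj : Aᵉ.Tup m → Aᵉ.Tup m → Set ℓ
            Conj y y′ = ∃[ f ] Aᵉ.Fixes f α × Aᵉ.Maps f y y′

            conj-equivalence : IsEquivalence Conj
            conj-equivalence = record
              { refl  = Aᵉ.idₐ , Aᵉ.maps-id , Aᵉ.maps-id
              ; sym   = Aᵉ.∼-sym {s = α}
              ; trans = Aᵉ.∼-trans {s = α}
              }

            private
              F-conj : ∀ {y y′} → F y ≡ F y′ → Conj y y′
              F-conj {y} {y′} e = go (shape y) (shape y′) (values y) (values y′)
                  (Injection.injective (tabulate↣ m) (≡.cong proj₁ e)) (≡.cong proj₂ e) (el-values y) (el-values y′)
                where
                go : ∀ sh sh′ v v′ → sh ≡ sh′ → codeOf sh v ≡ codeOf sh′ v′ → (∀ i → el sh v i ≡ y i) → (∀ i → el sh′ v′ i ≡ y′ i) → Conj y y′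
                go sh .sh v v′ ≡.refl c≡ ey ey′ =
                  let (l , f , q) = encode (j ∘ (w ++ flat sh v))
                      (l′ , f′ , q′) = encode (j ∘ (w ++ flat sh v′))
                      (g , r) = unlift-maps {x = w ++ flat sh v} {w ++ flat sh v′} (A′.inv f′ A′.∘ₐ f)
                        (A′.maps-∘ (A′.inv f′) f (A′.maps-inv f′ q′)
                          (A′.maps-≈ʳ f (λ i → M′.reflexive (≡.cong (λ l → code l i) c≡)) q))
                  in g ᵉ , H⇒α-fixed g (H-supp {g} (maps-++ˡ g r))
                     , Aᵉ.maps-≈ˡ (g ᵉ) (λ i → Mᵉ.reflexive (≡.sym (ey i)))
                         (Aᵉ.maps-≈ʳ (g ᵉ) (λ i → Mᵉ.reflexive (ey′ i)) (flat-maps sh v v′ g (maps-++ʳ g {w} {w} r)))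

            -- The sorts, together with the type over `∅` of `w` and real representatives, determine
            -- a class, because automorphisms fixing `w` fix `α`. So the classes are countably many,
            -- and equal Lascar types over `α` imply conjugacy over `α`.
            conjugacy : Tᵉ.InvariantBoundedEquivalence (range α) m
            conjugacy = record
              { E = Conj
              ; isEquivalence = conj-equivalence
              ; ≋⇒E = λ e → Aᵉ.idₐ , Aᵉ.maps-id , e
              ; invariant = λ f (g , gα , gxy) →
                  let h = Tᵉ.AutomorphismOver.auto f
                      hα = λ i → Tᵉ.AutomorphismOver.fixes f (i , Mᵉ.refl)
                  in Aᵉ.along h g h , Aᵉ.maps-along h g h hα gα hα , Aᵉ.maps-along h g h (Aᵉ.maps-img h) gxy (Aᵉ.maps-img h)
              ; few-classes = δ-small.small-≲ (Z↣ℕ ⊙ invariant-≲ F F-conj) δ.uncountable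
              }

          -- Tuples of `D` with the same Lascar type over `α` are conjugate over `α`; the
          -- restriction of that automorphism to `M` lies in `H`, so `H-real` can correct it to fix
          -- `e`.
          not-splitting : ∀ (D : Subset ≈ᵉ-setoid) {e} → (∀ {m} (x : Tup m) → x ⊑ Representatives.X D → P.R w x e) →
                          ¬ Tᵉ.LascarSplits (real ∘ e) D (range α)
          not-splitting D {e} real-e (m , y , y′ , y⊑ , y′⊑ , sameL , ¬st) = ¬st (Aᵉ.∼⇒type (go (sameL α (Aᵉ.⊑-range {x = α}) conjugacy)))
            where
            open Representatives D
            module Y = Represented (represent y y⊑)
            module Y′ = Represented (represent y′ y′⊑)
            go : Conj y y′ → ((real ∘ e) ++ y) Aᵉ.∼[ α ] ((real ∘ e) ++ y′)
            go (f , fα , fy) =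
              case P.realize idₐ maps-id (v′ ++ ⌊ Y′.y~ ⌋) of λ { (e′ , r) →
              case H-real g Hg (maps-img g) (real-e ⌊ Y.y~ ⌋ Y.⌊⌋⊑) (P.R-++ˡ {x = v′} {⌊ Y′.y~ ⌋} r) of λ { (h₁ , Hh₁ , h₁y , h₁e) →
              case P.R-unique idₐ maps-id maps-id (P.R-++ʳ {x = v′} {⌊ Y′.y~ ⌋} r) (real-e ⌊ Y′.y~ ⌋ Y′.⌊⌋⊑) of λ { (h₂ , h₂w , h₂y , h₂e) →
                (h₂ ∘ₐ h₁) ᵉ
                , H⇒α-fixed (h₂ ∘ₐ h₁) (H-∘ {h₂} {h₁} (H-supp {h₂} h₂w) Hh₁)
                , Aᵉ.maps-++ ((h₂ ∘ₐ h₁) ᵉ) (real-maps (h₂ ∘ₐ h₁) (maps-∘ h₂ h₁ h₂e h₁e))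
                    (λ i → Mᵉ.trans (Aᵉ.·-cong ((h₂ ∘ₐ h₁) ᵉ) (Y.y≈ i)) (Mᵉ.trans (act-∘ h₂ h₁ (Y.y~ i))
                      (Mᵉ.trans (Aᵉ.·-cong (h₂ ᵉ) (Mᵉ.trans (agrees h₁ h₁y i) (to-y′ i)))
                        (Mᵉ.trans (fixes-⌊⌋ Y′.y~ h₂ h₂y i) (Mᵉ.sym (Y′.y≈ i)))))) } } }
              where
              g : Aut
              g = restrict f
              Hg : H g
              Hg = α-fixed⇒H f fα
              -- `f` carries the chosen representatives of `y` to representatives of `y′` other than
              -- the chosen ones, perhaps; hence the intermediate realization over both.
              v′ : Tup (size (shape Y.y~))
              v′ i = g · ⌊ Y.y~ ⌋ i
              act-∘ : ∀ h h′ u → (h ∘ₐ h′) ᵉ Aᵉ.· u Mᵉ.≈ h ᵉ Aᵉ.· (h′ ᵉ Aᵉ.· u)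
              act-∘ h h′ (x / E) = class (≋⇒sort E (λ _ → refl))
              agrees : ∀ h → Maps h ⌊ Y.y~ ⌋ v′ → ∀ i → h ᵉ Aᵉ.· Y.y~ i Mᵉ.≈ g ᵉ Aᵉ.· Y.y~ i
              agrees h q i = Mᵉ.trans (Aᵉ.·-cong (h ᵉ) (Mᵉ.reflexive (≡.sym (el-values Y.y~ i))))
                (Mᵉ.trans (class (≋⇒sort (proj₂ (shape Y.y~ i)) (λ l →
                  trans (·-cong h (reflexive (≡.sym (at i l)))) (trans (q (pos (shape Y.y~) i l)) (·-cong g (reflexive (at i l)))))))
                  (Aᵉ.·-cong (g ᵉ) (Mᵉ.reflexive (el-values Y.y~ i))))
                where
                at : ∀ i l → ⌊ Y.y~ ⌋ (pos (shape Y.y~) i l) ≡ values Y.y~ i l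
                at = flat-pos (shape Y.y~) (values Y.y~)
              to-y′ : ∀ i → g ᵉ Aᵉ.· Y.y~ i Mᵉ.≈ Y′.y~ i
              to-y′ i = Mᵉ.trans (Mᵉ.sym (restrict-≈ f (Y.y~ i)))
                (Mᵉ.trans (Aᵉ.·-cong f (Mᵉ.sym (Y.y≈ i))) (Mᵉ.trans (fy i) (Y′.y≈ i)))

          module FreeExtensionsExist (C : Subset ≈ᵉ-setoid) (C-bdd : Tᵉ.Bounded C) (α⊆C : range {S = ≈ᵉ-setoid} α ⊆ C) where
            private
              module C = Representatives C

            opaque
              realization : ∀ D → Tᵉ.Bounded D → Σ[ e ∈ Tup n ] (∀ {m} (x : Tup m) → x ⊑ (C.X ∪ Representatives.X D) → P.R w x e)
              realization D D-bdd = P.extend idₐ maps-id (C.X ∪ Representatives.X D) (bounded-∪ {C.X} {Representatives.X D} (C.X-bounded C-bdd) (Representatives.X-bounded D D-bdd))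

            same-over-C : ∀ {e e′} → (∀ {m} (x : Tup m) → x ⊑ C.X → P.R w x e) → (∀ {m} (x : Tup m) → x ⊑ C.X → P.R w x e′) →
                          Tᵉ.SameType (real ∘ e) (real ∘ e′) (range α ∪ C)
            same-over-C {e} {e′} r r′ y y⊑ =
              let (h , _ , hy , he) = P.R-unique idₐ maps-id maps-id (r ⌊ Y.y~ ⌋ Y.⌊⌋⊑) (r′ ⌊ Y.y~ ⌋ Y.⌊⌋⊑)
              in Aᵉ.∼⇒galois (h ᵉ , fixes-≈ (h ᵉ) Y.y≈ (fixes-⌊⌋ Y.y~ h hy) , real-maps h he)
              where
              in-C : ∀ {u} → u ∈ (range {S = ≈ᵉ-setoid} α ∪ C) → u ∈ C
              in-C (inj₁ q) = α⊆C q
              in-C (inj₂ q) = q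
              module Y = C.Represented (C.represent y (λ i → in-C (y⊑ i)))

            -- Each larger `D` gets its own realization, whose type over `C` is still that of `e`,
            -- since both realize the global type over representatives of `C`.
            free-extension : Σ[ d ∈ Aᵉ.Tup n ] Tᵉ.FreeExtension d C (real ∘ a) (range α)
            free-extension =
              let (e , r) = realization C C-bdd
              in real ∘ e , realizes⇒type (r [] (λ ())) , k , α , Aᵉ.⊑-range {x = α} , λ D D-bdd _ →
                   let (e′ , r′) = realization D D-bdd
                   in real ∘ e′ , same-over-C (λ x x⊑ → r′ x (inj₁ ∘ x⊑)) (λ x x⊑ → r x (inj₁ ∘ x⊑))
                      , not-splitting D (λ x x⊑ → r′ x (inj₂ ∘ x⊑))

          -- A bounded relation over `α` restricts to real tuples as an `H`-invariant relation,
          -- because `H` fixes `α`, and its classes have representatives in a bounded set.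
          type⇒sameLascar : ∀ {l} {s′ : Aᵉ.Tup l} → s′ ⊑ range {S = ≈ᵉ-setoid} α →
                            ∀ 𝒜 → ContainsBase 𝒜 → ∀ {m} {c c′ : Tup m} → c ∼ c′ over 𝒜 →
                            Tᵉ.SameLascarType (real ∘ c) (real ∘ c′) (range s′)
          type⇒sameLascar s⊑α 𝒜 has {m} {c} {c′} same t t⊑ ℰ₀ =
            Lascar.type⇒lascar HH E₀ I.sym I.trans E-maps X X-bdd reps 𝒜 has same
            where
            module E = Tᵉ.InvariantBoundedEquivalence ℰ₀
            module I = IsEquivalence E.isEquivalence
            E₀ : Tup m → Tup m → Set ℓ
            E₀ x y = E.E (real ∘ x) (real ∘ y)
            E-maps : ∀ g {x x′ y y′} → H g → Maps g x x′ → Maps g y y′ → E₀ x y → E₀ x′ y′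
            E-maps g Hg gx gy e = I.trans (I.sym (E.≋⇒E (real-maps g gx))) (I.trans (E.invariant ĝ e) (E.≋⇒E (real-maps g gy)))
              where
              t⊑α : t ⊑ range {S = ≈ᵉ-setoid} α
              t⊑α i = let (l , e) = t⊑ i in Subset.resp (range {S = ≈ᵉ-setoid} α) e (s⊑α l)
              ĝ : Tᵉ.AutomorphismOver (range t)
              ĝ = record { auto = g ᵉ ; fixes = Aᵉ.fixes-range (g ᵉ) (over-α g Hg t⊑α) }
            classes : Setoid ℓ ℓ
            classes = record { Carrier = Tup m ; _≈_ = E₀ ; isEquivalence = record { refl = I.refl ; sym = I.sym ; trans = I.trans } }
            elZ : Σ[ z ∈ Reps classes ] Fin m → Carrier
            elZ (z , i) = proj₁ z i
            X : Subset dom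
            X = image elZ
            X-bdd : ⟪ X ⟫ ≺ δ
            X-bdd = δ-small.small-≲ (fin-pairs (λ _ → m) ⊙ cover-≲ X elZ id)
              (δ-small.small-× (δ-small.small-≲ (fromReps classes) (δ-small.small-≲ real-classes E.few-classes)) δ.uncountable)
              where
              real-classes : classes ≲ record { isEquivalence = E.isEquivalence }
              real-classes = record { to = λ x → real ∘ x ; cong = id ; injective = id }
            reps : ∀ x → ∃[ y ] y ⊑ X × E₀ x y
            reps x = proj₁ z , (λ i → (z , i) , refl) , rep-≈ classes x
              where
              z : Reps classes
              z = Injection.to (toReps classes) x

          module FreeExtensionsConjugate (C : Subset ≈ᵉ-setoid) (C-bdd : Tᵉ.Bounded C) (α⊆C : range {S = ≈ᵉ-setoid} α ⊆ C)
                                           {m} (y : Aᵉ.Tup m) (y⊑C : y ⊑ C) where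
            private
              -- Fixing representatives of `y` fixes `y`; `w` is appended to meet the requirement of
              -- `Unique`.
              c : Tup (size (shape y) + _)
              c = ⌊ y ⌋ ++ w

              module U = Unique c (λ g p → maps-++ʳ g {⌊ y ⌋} {⌊ y ⌋} p)

              X₀ : Subset dom
              X₀ = set U.limit ∪ range c

              elX : Reps ⟪ X₀ ⟫ → Element
              elX z = real (proj₁ (proj₁ z))

              X : Subset ≈ᵉ-setoid
              X = image elX

              ⊑X : ∀ {l} {x : Tup l} → x ⊑ X₀ → (real ∘ x) ⊑ X
              ⊑X {x = x} x⊑ i = let (z , e) = reps-cover X₀ (x⊑ i) in z , real-cong e

              -- Freeness is tested on a set that includes `c` and the Morley sequence, whose terms
              -- are to be exchanged with `c` over `b′`.
              D : Subset ≈ᵉ-setoid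
              D = C ∪ X

              opaque
                D-bdd : Tᵉ.Bounded D
                D-bdd = δ-small.small-≲ (∪-≲ C X) (δ-small.small-⊎ (δ-small.small-≲ (fromReps ⟪ C ⟫) C-bdd)
                  (δ-small.small-≲ (fromReps ⟪ X ⟫) (δ-small.small-≲ (cover-≲ X elX id)
                    (δ-small.small-≲ (fromReps ⟪ X₀ ⟫) (bounded-∪ {set U.limit} {range c} (bounded-cmodel U.limit) (bounded-range c))))))

              ⊆D : (range {S = ≈ᵉ-setoid} α ∪ C) ⊆ D
              ⊆D (inj₁ q) = inj₁ (α⊆C q)
              ⊆D (inj₂ q) = inj₁ q

            opaque
              -- `b′` is the image of `a` under an automorphism fixing `α`, so up to `≈` it is a
              -- real tuple `d′`, and it inherits genericity. That its type does not Lascar split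
              -- gives the remaining hypothesis of `unique`.
              conjugate : ∀ {d} → Tᵉ.FreeExtension d C (real ∘ a) (range α) → ∀ {e} → P.R w c e →
                          ∃[ f ] Aᵉ.Fixes f y × Aᵉ.Maps f d (real ∘ e)
              conjugate {d} (same-a , _ , s′ , s⊑α , ext) {e} r = go (ext D D-bdd ⊆D)
                where
                go : Σ[ b′ ∈ Aᵉ.Tup n ] Tᵉ.SameType b′ d (range α ∪ C) × ¬ Tᵉ.LascarSplits b′ D (range s′) →
                     ∃[ f ] Aᵉ.Fixes f y × Aᵉ.Maps f d (real ∘ e)
                go (b′ , same-d , ns) =
                  case Aᵉ.type⇒∼ same-a of λ { (f₀ , f₀α , f₀a) →
                  case Aᵉ.galois⇒∼ (same-d α (λ i → inj₁ (i , Mᵉ.refl))) of λ { (f₁ , f₁α , f₁b) →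
                  case Aᵉ.galois⇒∼ (same-d y (λ i → inj₂ (y⊑C i))) of λ { (f₂ , f₂y , f₂b) →
                  finish (Aᵉ.inv f₁ Aᵉ.∘ₐ f₀) (Aᵉ.maps-∘ (Aᵉ.inv f₁) f₀ (Aᵉ.maps-inv f₁ f₁α) f₀α)
                    (Aᵉ.maps-∘ (Aᵉ.inv f₁) f₀ (Aᵉ.maps-inv f₁ f₁b) f₀a) f₂ f₂y f₂b } } }
                  where
                  finish : ∀ f → Aᵉ.Fixes f α → Aᵉ.Maps f (real ∘ a) b′ → ∀ f₂ → Aᵉ.Fixes f₂ y → Aᵉ.Maps f₂ b′ d →
                           ∃[ f ] Aᵉ.Fixes f y × Aᵉ.Maps f d (real ∘ e)
                  finish f fα fa f₂ f₂y f₂b =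
                    case U.unique generic′ same-c r of λ { (h , hc , hd) →
                      h ᵉ Aᵉ.∘ₐ Aᵉ.inv f₂
                      , Aᵉ.maps-∘ (h ᵉ) (Aᵉ.inv f₂) (fixes-⌊⌋ y h (maps-++ˡ h hc)) (Aᵉ.maps-inv f₂ f₂y)
                      , Aᵉ.maps-∘ (h ᵉ) (Aᵉ.inv f₂) (Aᵉ.maps-≈ˡ (h ᵉ) b′≈d′ (real-maps h hd)) (Aᵉ.maps-inv f₂ f₂b) }
                    where
                    g : Aut
                    g = restrict f
                    d′ : Tup n
                    d′ i = g · a i
                    b′≈d′ : ∀ i → b′ i Mᵉ.≈ real (d′ i)
                    b′≈d′ i = Mᵉ.trans (Mᵉ.sym (fa i)) (restrict-real f (a i))
                    generic′ : Generic d′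
                    generic′ 𝒟 =
                      let (e₁ , g₁ , real₁ , Hg₁ , g₁a) = a-generic 𝒟
                      in e₁ , g ∘ₐ g₁ , real₁ , H-∘ {g} {g₁} (α-fixed⇒H f fα) Hg₁ , maps-∘ g g₁ (maps-img g) g₁a
                    same-c : ∀ c′ → c′ ⊑ᵐ U.limit → c ∼ c′ over U.𝒜 → ∃[ h ] Maps h c c′ × Fixes h d′
                    same-c c′ c′⊑ c∼c′ = from-em em
                      where
                      from-em : Dec (Tᵉ.SameType (b′ ++ (real ∘ c)) (b′ ++ (real ∘ c′)) (range s′)) → ∃[ h ] Maps h c c′ × Fixes h d′
                      from-em (no ¬st) = ⊥-elim (ns (_ , real ∘ c , real ∘ c′ , (λ i → inj₂ (⊑X (inj₂ ∘ ⊑-range) i)) , (λ i → inj₂ (⊑X (inj₁ ∘ c′⊑) i))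
                        , type⇒sameLascar s⊑α U.𝒜 U.𝒜-base c∼c′ , ¬st))
                      from-em (yes st) =
                        let (q , _ , qbc) = Aᵉ.type⇒∼ st
                            qb = Aᵉ.maps-++ˡ q {b′} {b′} qbc
                            qc = Aᵉ.maps-++ʳ q {b′} {b′} qbc
                        in restrict q , (λ i → real-injective (Mᵉ.trans (Mᵉ.sym (restrict-real q (c i))) (qc i)))
                           , (λ i → real-injective (Mᵉ.trans (Mᵉ.sym (restrict-real q (d′ i)))
                               (Mᵉ.trans (Aᵉ.·-cong q (Mᵉ.sym (b′≈d′ i))) (Mᵉ.trans (qb i) (b′≈d′ i)))))

              conjugates : ∀ {d₁ d₂} → Tᵉ.FreeExtension d₁ C (real ∘ a) (range α) → Tᵉ.FreeExtension d₂ C (real ∘ a) (range α) →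
                           d₁ Aᵉ.∼[ y ] d₂
              conjugates free₁ free₂ =
                let (_ , r) = P.realize idₐ maps-id c
                in Aᵉ.∼-trans {s = y} (conjugate free₁ r) (Aᵉ.∼-sym {s = y} (conjugate free₂ r))

        stationary : Types.Stationary M^eq δ (real ∘ a) (range α)
        stationary C C-bdd α⊆C =
          FreeExtensionsExist.free-extension C C-bdd α⊆C ,
          λ d₁ d₂ free₁ free₂ y y⊑ → Aᵉ.∼⇒galois (FreeExtensionsConjugate.conjugates C C-bdd α⊆C y y⊑ free₁ free₂)

lemma2p83 :
  (em : ∀ {a : Level} → ExcludedMiddle a) →
  (fe : ∀ {a b : Level} → Extensionality a b) →
  {ℓ : Level} {L : Language ℓ} (𝒦 : AEC L) (𝕄 : Monster 𝒦) →
  FUR 𝒦 𝕄 →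
  (𝕄′ : SuperMonster 𝕄) (ℰ : Imaginaries 𝕄) →
  Global.Standing 𝕄′ ℰ →
  {n : ℕ} (a : Vector ∣ Monster.M 𝕄 ∣ n) →
  (A : Subset (Structure.dom (Monster.M 𝕄))) →
  Types.Bounded (Monster.M 𝕄) (Monster.δ 𝕄) A →
  {k : ℕ} (α : Vector ∣ Meq.M^eq ℰ ∣ k) →
  Global.IsCb 𝕄′ ℰ α a A →
  Types.Stationary (Meq.M^eq ℰ) (Monster.δ 𝕄) (Meq.real ℰ ∘ a) (range α)
lemma2p83 em fe 𝒦 𝕄 fur 𝕄′ ℰ _ a A _ α cb = CanonicalBase.stationary em fe 𝒦 𝕄 fur 𝕄′ ℰ a A α cb
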